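{- Let $n\ge 6$ be an even integer, let $c$ be an integer with $1<c<n/2$, let $S=\{\pm 1,\pm c,n/2\}\subseteq\mathbb{Z}_n$, and assume that $\Gamma=\mathrm{Cay}(\mathbb{Z}_n;S)$ is closed distance magic. Then there exists $j\in\mathcal{J}_n(S)$ which is of type $2$ or of type $3^+$.
   Context: $\mathrm{Cay}(\mathbb{Z}_n;S)$ is the graph with vertex set $\mathbb{Z}_n$ in which $g,h$ are adjacent iff $h-g\in S$. A graph $\Gamma=(V,E)$ of order $n$ is closed distance magic if there are a bijection $\ell:V\to\{1,\ldots,n\}$ and a positive integer $r$ such that for all $u\in V$ the sum of the labels of $u$ and all its neighbors equals $r$. For $0\le j\le n-1$ let $\chi_j(x)=\cos(2\pi xj/n)+\mathbf{i}\sin(2\pi xj/n)$ and $\chi_j(S)=\sum_{x\in S}\chi_j(x)$; $\mathcal{J}_n(S)$ is the set of $j\in\{0,\ldots,n-1\}$ with $\chi_j(S)=-1$. An even $j\in\mathcal{J}_n(S)$ is of type $2$ if $\{\frac{2\pi j}{n},\frac{2\pi jc}{n}\}=\{\pm\frac{2\pi}{3}+2k_1\pi,\pm\frac{2\pi}{3}+2k_2\pi\}$ for some $k_1,k_2\in\mathbb{Z}$ and some (independent) choice of signs. An odd $j\in\mathcal{J}_n(S)$ is of type $3^+$ if $j=\frac{n(2k+1)}{2(c+1)}$ for some $k\in\mathbb{Z}$. -}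

module Defs where

open import Algebra.Definitions.RawMonoid using (sum)
open import Data.Bool.Base using (if_then_else_)
open import Data.Fin.Base using (Fin; toℕ; fromℕ<)
open import Data.Fin.Subset using (Subset; ⁅_⁆; _∪_; _∈_)
open import Data.Fin.Subset.Properties using (_∈?_)
open import Data.Integer.Base as ℤ using (ℤ; +_; -[1+_]; _◃_)
open import Data.Integer.DivMod using (_%ℕ_; n%ℕd<d)
import Data.Integer.Properties as ℤ
open import Data.Nat.Base as ℕ using (ℕ; zero; suc)
import Data.Nat.Coprimality as Coprimality
open import Data.Nat.Divisibility using (_∣_)
import Data.Nat.Properties as ℕ
open import Data.Product.Base using (Σ; ∃; _×_; _,_)
open import Data.Rational.Base
open import Data.Rational.Properties
open import Data.Rational.Solver using (module +-*-Solver)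
open import Data.Sign.Base using (Sign)
open import Data.Sum.Base using (_⊎_; inj₁; inj₂)
open import Data.Vec.Functional using (foldr)
open import Function.Base using (_$_)
open import Function.Bundles using (_⤖_; module Bijection)
open import Relation.Binary.Definitions using (Decidable)
open import Relation.Binary.PropositionalEquality
open import Relation.Nullary.Decidable.Core using (does)
open import Relation.Nullary.Negation.Core using (¬_)
open import Relation.Unary using (_≐_)

private

  open +-*-Solver using (solve; _:=_; _:+_; _:*_; _:-_; :-_; con)

  nat : ℕ → ℚ
  nat n = mkℚ (+ n) 0 (Coprimality.sym (Coprimality.1-coprimeTo n))

  inv : ℕ → ℚ
  inv k = mkℚ (+ 1) k (Coprimality.1-coprimeTo (suc k))

  1/suc≡inv : ∀ k → (+ 1 / suc k) ≡ inv k
  1/suc≡inv k = normalize-coprime (Coprimality.1-coprimeTo (suc k))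

  inv*nat : ∀ k → inv k * nat (suc k) ≡ 1ℚ
  inv*nat k = *-inverseˡ (nat (suc k))

  0≤nat : ∀ n → 0ℚ ≤ nat n
  0≤nat n = nonNegative⁻¹ (nat n)

  0<nat : ∀ n → 0ℚ < nat (suc n)
  0<nat n = positive⁻¹ (nat (suc n))

  0≤inv : ∀ n → 0ℚ ≤ inv n
  0≤inv n = nonNegative⁻¹ (inv n)

  0<inv : ∀ n → 0ℚ < inv n
  0<inv n = positive⁻¹ (inv n)

  0<1 : 0ℚ < 1ℚ
  0<1 = positive⁻¹ 1ℚ

  nat-mono : ∀ {m n} → m ℕ.≤ n → nat m ≤ nat n
  nat-mono {m} {n} m≤n =
    *≤* (subst₂ ℤ._≤_ (sym (ℤ.*-identityʳ (+ m))) (sym (ℤ.*-identityʳ (+ n))) (ℤ.+≤+ m≤n))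

  archimedean : ∀ q → ∃ λ n → q ≤ nat n
  archimedean q@(mkℚ (+ n) d _) = n , *≤* (ℤ.*-monoˡ-≤-nonNeg (+ n) (ℤ.+≤+ (ℕ.s≤s ℕ.z≤n)))
  archimedean q@(mkℚ -[1+ n ] d _) = 0 , *≤* (subst (ℤ._≤ + 0 ℤ.* + suc d) (sym (ℤ.*-identityʳ -[1+ n ])) ℤ.-≤+)

  mulʳ : ∀ {p q} r → 0ℚ ≤ r → p ≤ q → p * r ≤ q * r
  mulʳ r 0≤r = *-monoʳ-≤-nonNeg r {{nonNegative 0≤r}}

  mulˡ : ∀ {p q} r → 0ℚ ≤ r → p ≤ q → r * p ≤ r * q
  mulˡ r 0≤r = *-monoˡ-≤-nonNeg r {{nonNegative 0≤r}}

  0≤* : ∀ {p q} → 0ℚ ≤ p → 0ℚ ≤ q → 0ℚ ≤ p * q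
  0≤* {p} {q} 0≤p 0≤q = subst (_≤ p * q) (*-zeroˡ q) (mulʳ q 0≤q 0≤p)

  0<* : ∀ {p q} → 0ℚ < p → 0ℚ < q → 0ℚ < p * q
  0<* {p} {q} 0<p 0<q = positive⁻¹ (p * q) {{pos*pos⇒pos p {{positive 0<p}} q {{positive 0<q}}}}

  0≤+ : ∀ {p q} → 0ℚ ≤ p → 0ℚ ≤ q → 0ℚ ≤ p + q
  0≤+ 0≤p 0≤q = +-mono-≤ 0≤p 0≤q

  ≤-+ʳ : ∀ {p q} → 0ℚ ≤ q → p ≤ p + q
  ≤-+ʳ {p} {q} 0≤q = subst (_≤ p + q) (+-identityʳ p) (+-monoʳ-≤ p 0≤q)

  ≤-+ˡ : ∀ {p q} → 0ℚ ≤ q → p ≤ q + p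
  ≤-+ˡ {p} {q} 0≤q = subst (_≤ q + p) (+-identityˡ p) (+-monoˡ-≤ p 0≤q)

  0<½* : ∀ {ε} → 0ℚ < ε → 0ℚ < ½ * ε
  0<½* = 0<* (positive⁻¹ ½)

  halves : ∀ ε → ½ * ε + ½ * ε ≡ ε
  halves ε = trans (sym (*-distribʳ-+ ε ½ ½)) (*-identityˡ ε)

  ∣-∣-swap : ∀ p q → ∣ p - q ∣ ≡ ∣ q - p ∣
  ∣-∣-swap p q = trans (cong ∣_∣ (solve 2 (λ x y → x :- y := :- (y :- x)) refl p q)) (∣-p∣≡∣p∣ (q - p))

IsCauchy : (ℕ → ℚ) → Set
IsCauchy f = ∀ ε → 0ℚ < ε → ∃ λ N → ∀ m n → N ℕ.≤ m → N ℕ.≤ n → ∣ f m - f n ∣ ≤ ε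

record ℝ : Set where
  constructor mkℝ
  field
    seq      : ℕ → ℚ
    isCauchy : IsCauchy seq

open ℝ public

infix 4 _≈_ _<ℝ_

_≈_ : ℝ → ℝ → Set
x ≈ y = ∀ ε → 0ℚ < ε → ∃ λ N → ∀ n → N ℕ.≤ n → ∣ seq x n - seq y n ∣ ≤ ε

_<ℝ_ : ℝ → ℝ → Set
x <ℝ y = ∃ λ ε → 0ℚ < ε × ∃ λ N → ∀ n → N ℕ.≤ n → seq x n + ε ≤ seq y n

-- The set {x , y}; sets of reals are compared extensionally by _≐_.
pair : ℝ → ℝ → ℝ → Set
pair x y z = z ≈ x ⊎ z ≈ y

fromℚ : ℚ → ℝ
fromℚ q = mkℝ (λ _ → q) λ ε 0<ε → 0 , λ _ _ _ _ →
  subst (λ r → ∣ r ∣ ≤ ε) (sym (+-inverseʳ q)) (<⇒≤ 0<ε)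

0ℝ 1ℝ : ℝ
0ℝ = fromℚ 0ℚ
1ℝ = fromℚ 1ℚ

private

  abstract

    +-isCauchy : ∀ f g → IsCauchy f → IsCauchy g → IsCauchy (λ n → f n + g n)
    +-isCauchy f g cf cg ε 0<ε with cf (½ * ε) (0<½* 0<ε) | cg (½ * ε) (0<½* 0<ε)
    ... | N₁ , h₁ | N₂ , h₂ = N₁ ℕ.⊔ N₂ , λ m n N≤m N≤n → begin
      ∣ (f m + g m) - (f n + g n) ∣
        ≡⟨ cong ∣_∣ (solve 4 (λ a b c d → (a :+ b) :- (c :+ d) := (a :- c) :+ (b :- d)) refl (f m) (g m) (f n) (g n)) ⟩
      ∣ (f m - f n) + (g m - g n) ∣
        ≤⟨ ∣p+q∣≤∣p∣+∣q∣ (f m - f n) (g m - g n) ⟩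
      ∣ f m - f n ∣ + ∣ g m - g n ∣
        ≤⟨ +-mono-≤ (h₁ m n (ℕ.m⊔n≤o⇒m≤o N₁ N₂ N≤m) (ℕ.m⊔n≤o⇒m≤o N₁ N₂ N≤n))
                    (h₂ m n (ℕ.m⊔n≤o⇒n≤o N₁ N₂ N≤m) (ℕ.m⊔n≤o⇒n≤o N₁ N₂ N≤n)) ⟩
      ½ * ε + ½ * ε
        ≡⟨ halves ε ⟩
      ε ∎
      where open ≤-Reasoning

  shrink : ∀ {ε} l → 0ℚ < ε → 0ℚ < ε * inv l
  shrink l 0<ε = 0<* 0<ε (0<inv l)

  shrink-bound : ∀ {ε d L} l → 0ℚ ≤ d → d ≤ ε * inv l → L ≤ nat l → d * L ≤ ε
  shrink-bound {ε} {d} {L} l 0≤d d≤ L≤ = begin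
    d * L                      ≤⟨ mulˡ d 0≤d (≤-trans L≤ (nat-mono (ℕ.n≤1+n l))) ⟩
    d * nat (suc l)            ≤⟨ mulʳ (nat (suc l)) (0≤nat (suc l)) d≤ ⟩
    ε * inv l * nat (suc l)    ≡⟨ *-assoc ε (inv l) (nat (suc l)) ⟩
    ε * (inv l * nat (suc l))  ≡⟨ cong (ε *_) (inv*nat l) ⟩
    ε * 1ℚ                     ≡⟨ *-identityʳ ε ⟩
    ε ∎
    where open ≤-Reasoning

  abstract

    ·-isCauchy : ∀ q f → IsCauchy f → IsCauchy (λ n → q * f n)
    ·-isCauchy q f cf ε 0<ε with archimedean ∣ q ∣
    ... | l , ∣q∣≤l with cf (ε * inv l) (shrink l 0<ε)
    ... | N , h = N , λ m n N≤m N≤n → begin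
      ∣ q * f m - q * f n ∣
        ≡⟨ cong ∣_∣ (solve 3 (λ a b c → a :* b :- a :* c := (b :- c) :* a) refl q (f m) (f n)) ⟩
      ∣ (f m - f n) * q ∣
        ≡⟨ ∣p*q∣≡∣p∣*∣q∣ (f m - f n) q ⟩
      ∣ f m - f n ∣ * ∣ q ∣
        ≤⟨ shrink-bound l (0≤∣p∣ (f m - f n)) (h m n N≤m N≤n) ∣q∣≤l ⟩
      ε ∎
      where open ≤-Reasoning

infixl 6 _+ℝ_
infixr 7 _·_

_+ℝ_ : ℝ → ℝ → ℝ
x +ℝ y = mkℝ (λ n → seq x n + seq y n) (+-isCauchy (seq x) (seq y) (isCauchy x) (isCauchy y))

_·_ : ℚ → ℝ → ℝ
q · x = mkℝ (λ n → q * seq x n) (·-isCauchy q (seq x) (isCauchy x))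

-- term q k = q ^ k / k !
term : ℚ → ℕ → ℚ
term q zero    = 1ℚ
term q (suc k) = term q k * (q * (+ 1 / suc k))

-- The sum over k < n of a k * q ^ k / k !
partialSum : (ℕ → ℚ) → ℚ → ℕ → ℚ
partialSum a q zero    = 0ℚ
partialSum a q (suc n) = partialSum a q n + a n * term q n

-- The derivatives at 0 of cosine and of sine: 1, 0, -1, 0, … and 0, 1, 0, -1, …
cosCoeff sinCoeff : ℕ → ℚ
cosCoeff zero    = 1ℚ
cosCoeff (suc k) = - sinCoeff k
sinCoeff zero    = 0ℚ
sinCoeff (suc k) = cosCoeff k

private

  ∣cosCoeff∣≤1 : ∀ k → ∣ cosCoeff k ∣ ≤ 1ℚ
  ∣sinCoeff∣≤1 : ∀ k → ∣ sinCoeff k ∣ ≤ 1ℚ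
  ∣cosCoeff∣≤1 zero    = ≤-refl
  ∣cosCoeff∣≤1 (suc k) = subst (_≤ 1ℚ) (sym (∣-p∣≡∣p∣ (sinCoeff k))) (∣sinCoeff∣≤1 k)
  ∣sinCoeff∣≤1 zero    = <⇒≤ 0<1
  ∣sinCoeff∣≤1 (suc k) = ∣cosCoeff∣≤1 k

  term-suc : ∀ q k → term q (suc k) ≡ term q k * (q * inv k)
  term-suc q k = cong (λ r → term q k * (q * r)) (1/suc≡inv k)

  module Majorant (C : ℚ) (0≤C : 0ℚ ≤ C) where

    M : ℕ → ℚ
    M = term C

    0≤M : ∀ k → 0ℚ ≤ M k
    0≤M zero    = <⇒≤ 0<1
    0≤M (suc k) = subst (0ℚ ≤_) (sym (term-suc C k)) (0≤* (0≤M k) (0≤* 0≤C (0≤inv k)))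

    S : ℕ → ℚ
    S zero    = 0ℚ
    S (suc n) = S n + M n

    0≤S : ∀ n → 0ℚ ≤ S n
    0≤S zero    = ≤-refl
    0≤S (suc n) = 0≤+ (0≤S n) (0≤M n)

    term-bound : ∀ q → ∣ q ∣ ≤ C → ∀ k → ∣ term q k ∣ ≤ M k
    term-bound q q≤C zero    = ≤-refl
    term-bound q q≤C (suc k) = begin
      ∣ term q (suc k) ∣              ≡⟨ cong ∣_∣ (term-suc q k) ⟩
      ∣ term q k * (q * inv k) ∣      ≡⟨ ∣p*q∣≡∣p∣*∣q∣ (term q k) (q * inv k) ⟩
      ∣ term q k ∣ * ∣ q * inv k ∣    ≡⟨ cong (∣ term q k ∣ *_) (∣p*q∣≡∣p∣*∣q∣ q (inv k)) ⟩
      ∣ term q k ∣ * (∣ q ∣ * inv k)  ≤⟨ mulʳ (∣ q ∣ * inv k) (0≤* (0≤∣p∣ q) (0≤inv k)) (term-bound q q≤C k) ⟩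
      M k * (∣ q ∣ * inv k)           ≤⟨ mulˡ (M k) (0≤M k) (mulʳ (inv k) (0≤inv k) q≤C) ⟩
      M k * (C * inv k)               ≡⟨ term-suc C k ⟨
      M (suc k) ∎
      where open ≤-Reasoning

    term-lipschitz : ∀ p q → ∣ p ∣ ≤ C → ∣ q ∣ + 1ℚ ≤ C → ∀ k →
                     ∣ term p k - term q k ∣ ≤ ∣ p - q ∣ * M k
    term-lipschitz p q p≤C q≤C zero    = 0≤* (0≤∣p∣ (p - q)) (0≤M 0)
    term-lipschitz p q p≤C q≤C (suc k) = begin
      ∣ term p (suc k) - term q (suc k) ∣
        ≡⟨ cong ∣_∣ (cong₂ _-_ (term-suc p k) (term-suc q k)) ⟩
      ∣ s * (p * r) - t * (q * r) ∣
        ≡⟨ cong ∣_∣ (solve 5 (λ s t p q r → s :* (p :* r) :- t :* (q :* r) := (s :* (p :- q) :+ (s :- t) :* q) :* r) refl s t p q r) ⟩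
      ∣ (s * (p - q) + (s - t) * q) * r ∣
        ≡⟨ ∣p*q∣≡∣p∣*∣q∣ (s * (p - q) + (s - t) * q) r ⟩
      ∣ s * (p - q) + (s - t) * q ∣ * r
        ≤⟨ mulʳ r (0≤inv k) (∣p+q∣≤∣p∣+∣q∣ (s * (p - q)) ((s - t) * q)) ⟩
      (∣ s * (p - q) ∣ + ∣ (s - t) * q ∣) * r
        ≡⟨ cong (_* r) (cong₂ _+_ (∣p*q∣≡∣p∣*∣q∣ s (p - q)) (∣p*q∣≡∣p∣*∣q∣ (s - t) q)) ⟩
      (∣ s ∣ * d + ∣ s - t ∣ * ∣ q ∣) * r
        ≤⟨ mulʳ r (0≤inv k) (+-mono-≤ (mulʳ d (0≤∣p∣ (p - q)) (term-bound p p≤C k))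
                                      (mulʳ ∣ q ∣ (0≤∣p∣ q) (term-lipschitz p q p≤C q≤C k))) ⟩
      (M k * d + d * M k * ∣ q ∣) * r
        ≡⟨ solve 4 (λ m d q r → (m :* d :+ d :* m :* q) :* r := (d :* m) :* ((q :+ con 1ℚ) :* r)) refl (M k) d ∣ q ∣ r ⟩
      d * M k * ((∣ q ∣ + 1ℚ) * r)
        ≤⟨ mulˡ (d * M k) (0≤* (0≤∣p∣ (p - q)) (0≤M k)) (mulʳ r (0≤inv k) q≤C) ⟩
      d * M k * (C * r)
        ≡⟨ *-assoc d (M k) (C * r) ⟩
      d * (M k * (C * r))
        ≡⟨ cong (d *_) (term-suc C k) ⟨
      d * M (suc k) ∎
      where
        open ≤-Reasoning
        s t r d : ℚ
        s = term p k
        t = term q k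
        r = inv k
        d = ∣ p - q ∣

    module _ (a : ℕ → ℚ) (a≤1 : ∀ k → ∣ a k ∣ ≤ 1ℚ) where

      ∣a*∣≤ : ∀ k q → ∣ a k * q ∣ ≤ ∣ q ∣
      ∣a*∣≤ k q = begin
        ∣ a k * q ∣      ≡⟨ ∣p*q∣≡∣p∣*∣q∣ (a k) q ⟩
        ∣ a k ∣ * ∣ q ∣  ≤⟨ mulʳ ∣ q ∣ (0≤∣p∣ q) (a≤1 k) ⟩
        1ℚ * ∣ q ∣       ≡⟨ *-identityˡ ∣ q ∣ ⟩
        ∣ q ∣ ∎
        where open ≤-Reasoning

      sum-lipschitz : ∀ p q → ∣ p ∣ ≤ C → ∣ q ∣ + 1ℚ ≤ C → ∀ n →
                      ∣ partialSum a p n - partialSum a q n ∣ ≤ ∣ p - q ∣ * S n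
      sum-lipschitz p q p≤C q≤C zero    = 0≤* (0≤∣p∣ (p - q)) ≤-refl
      sum-lipschitz p q p≤C q≤C (suc n) = begin
        ∣ (P + a n * s) - (Q + a n * t) ∣
          ≡⟨ cong ∣_∣ (solve 5 (λ P Q a s t → (P :+ a :* s) :- (Q :+ a :* t) := (P :- Q) :+ a :* (s :- t)) refl P Q (a n) s t) ⟩
        ∣ (P - Q) + a n * (s - t) ∣
          ≤⟨ ∣p+q∣≤∣p∣+∣q∣ (P - Q) (a n * (s - t)) ⟩
        ∣ P - Q ∣ + ∣ a n * (s - t) ∣
          ≤⟨ +-mono-≤ (sum-lipschitz p q p≤C q≤C n) (≤-trans (∣a*∣≤ n (s - t)) (term-lipschitz p q p≤C q≤C n)) ⟩
        ∣ p - q ∣ * S n + ∣ p - q ∣ * M n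
          ≡⟨ *-distribˡ-+ ∣ p - q ∣ (S n) (M n) ⟨
        ∣ p - q ∣ * S (suc n) ∎
        where
          open ≤-Reasoning
          P Q s t : ℚ
          P = partialSum a p n
          Q = partialSum a q n
          s = term p n
          t = term q n

      sum-step : ∀ q → ∣ q ∣ ≤ C → ∀ n i →
                 ∣ partialSum a q (i ℕ.+ n) - partialSum a q n ∣ ≤ S (i ℕ.+ n) - S n
      sum-step q q≤C n zero = ≤-reflexive $ trans
        (cong ∣_∣ (+-inverseʳ (partialSum a q n))) (sym (+-inverseʳ (S n)))
      sum-step q q≤C n (suc i) = begin
        ∣ (P + a k * t) - Q ∣
          ≡⟨ cong ∣_∣ (solve 3 (λ P x Q → (P :+ x) :- Q := (P :- Q) :+ x) refl P (a k * t) Q) ⟩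
        ∣ (P - Q) + a k * t ∣
          ≤⟨ ∣p+q∣≤∣p∣+∣q∣ (P - Q) (a k * t) ⟩
        ∣ P - Q ∣ + ∣ a k * t ∣
          ≤⟨ +-mono-≤ (sum-step q q≤C n i) (≤-trans (∣a*∣≤ k t) (term-bound q q≤C k)) ⟩
        (S k - S n) + M k
          ≡⟨ solve 3 (λ x y z → (x :- y) :+ z := (x :+ z) :- y) refl (S k) (S n) (M k) ⟩
        (S k + M k) - S n ∎
        where
          open ≤-Reasoning
          k : ℕ
          k = i ℕ.+ n
          P Q t : ℚ
          P = partialSum a q k
          Q = partialSum a q n
          t = term q k

    module Tail (K : ℕ) (2C≤K : C + C ≤ nat K) where

      M-halves : ∀ k → K ℕ.≤ k → M (suc k) + M (suc k) ≤ M k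
      M-halves k K≤k = begin
        M (suc k) + M (suc k)
          ≡⟨ cong₂ _+_ (term-suc C k) (term-suc C k) ⟩
        M k * (C * inv k) + M k * (C * inv k)
          ≡⟨ solve 3 (λ m c r → m :* (c :* r) :+ m :* (c :* r) := m :* (r :* (c :+ c))) refl (M k) C (inv k) ⟩
        M k * (inv k * (C + C))
          ≤⟨ mulˡ (M k) (0≤M k) (mulˡ (inv k) (0≤inv k) (≤-trans 2C≤K (nat-mono (ℕ.m≤n⇒m≤1+n K≤k)))) ⟩
        M k * (inv k * nat (suc k))
          ≡⟨ cong (M k *_) (inv*nat k) ⟩
        M k * 1ℚ
          ≡⟨ *-identityʳ (M k) ⟩
        M k ∎
        where open ≤-Reasoning

      M-antitone : ∀ i → M (i ℕ.+ K) ≤ M K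
      M-antitone zero    = ≤-refl
      M-antitone (suc i) = begin
        M (suc k)              ≤⟨ ≤-+ʳ (0≤M (suc k)) ⟩
        M (suc k) + M (suc k)  ≤⟨ M-halves k (ℕ.m≤n+m K i) ⟩
        M k                    ≤⟨ M-antitone i ⟩
        M K ∎
        where
          open ≤-Reasoning
          k : ℕ
          k = i ℕ.+ K

      U : ℕ → ℚ
      U n = S n + (M n + M n)

      U-antitone : ∀ n i → K ℕ.≤ n → U (i ℕ.+ n) ≤ U n
      U-antitone n zero    K≤n = ≤-refl
      U-antitone n (suc i) K≤n = begin
        S k + M k + (M (suc k) + M (suc k))
          ≤⟨ +-monoʳ-≤ (S k + M k) (M-halves k (ℕ.≤-trans K≤n (ℕ.m≤n+m n i))) ⟩
        S k + M k + M k
          ≡⟨ +-assoc (S k) (M k) (M k) ⟩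
        U k
          ≤⟨ U-antitone n i K≤n ⟩
        U n ∎
        where
          open ≤-Reasoning
          k : ℕ
          k = i ℕ.+ n

      S≤U : ∀ n i → K ℕ.≤ n → S (i ℕ.+ n) ≤ U n
      S≤U n i K≤n = ≤-trans (≤-+ʳ (0≤+ (0≤M (i ℕ.+ n)) (0≤M (i ℕ.+ n)))) (U-antitone n i K≤n)

      S-bounded : ∀ n → K ℕ.≤ n → S n ≤ U K
      S-bounded n K≤n = subst (λ m → S m ≤ U K) (ℕ.m∸n+n≡m K≤n) (S≤U K (n ℕ.∸ K) ℕ.≤-refl)

      S-tail : ∀ n i → K ℕ.≤ n → S (i ℕ.+ n) - S n ≤ M n + M n
      S-tail n i K≤n = begin
        S (i ℕ.+ n) - S n          ≤⟨ +-monoˡ-≤ (- S n) (S≤U n i K≤n) ⟩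
        S n + (M n + M n) - S n    ≡⟨ solve 2 (λ s m → s :+ m :- s := m) refl (S n) (M n + M n) ⟩
        M n + M n ∎
        where open ≤-Reasoning

      -- M (k + 1) = M k * C / (k + 1) ≤ M K * C / (k + 1)
      M-decay : ∀ i → M (suc (i ℕ.+ K)) * nat (suc (i ℕ.+ K)) ≤ M K * C
      M-decay i = begin
        M (suc k) * nat (suc k)
          ≡⟨ cong (_* nat (suc k)) (term-suc C k) ⟩
        M k * (C * inv k) * nat (suc k)
          ≡⟨ solve 4 (λ m c r n → m :* (c :* r) :* n := m :* c :* (r :* n)) refl (M k) C (inv k) (nat (suc k)) ⟩
        M k * C * (inv k * nat (suc k))
          ≡⟨ cong (M k * C *_) (inv*nat k) ⟩
        M k * C * 1ℚ
          ≡⟨ *-identityʳ (M k * C) ⟩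
        M k * C
          ≤⟨ mulʳ C 0≤C (M-antitone i) ⟩
        M K * C ∎
        where
          open ≤-Reasoning
          k : ℕ
          k = i ℕ.+ K

      M-null : ∀ ε → 0ℚ < ε → ∃ λ N → K ℕ.≤ N × (∀ n → N ℕ.≤ n → M n + M n ≤ ε)
      M-null ε 0<ε with archimedean (((A + A) * (1/ ε) {{>-nonZero 0<ε}}))
        where A = M K * C
      ... | N , A/ε≤N = suc (N ℕ.+ K) , ℕ.m≤n⇒m≤1+n (ℕ.m≤n+m K N) , go
        where
        A : ℚ
        A = M K * C
        instance
          ε≢0 : NonZero ε
          ε≢0 = >-nonZero 0<ε
        2A≤ : ∀ k → N ℕ.≤ k → A + A ≤ ε * nat k
        2A≤ k N≤k = begin
          A + A                 ≡⟨ *-identityʳ (A + A) ⟨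
          (A + A) * 1ℚ          ≡⟨ cong ((A + A) *_) (*-inverseˡ ε) ⟨
          (A + A) * (1/ ε * ε)  ≡⟨ *-assoc (A + A) (1/ ε) ε ⟨
          (A + A) * 1/ ε * ε    ≤⟨ mulʳ ε (<⇒≤ 0<ε) (≤-trans A/ε≤N (nat-mono N≤k)) ⟩
          nat k * ε             ≡⟨ *-comm (nat k) ε ⟩
          ε * nat k ∎
          where open ≤-Reasoning
        bound : ∀ i → N ℕ.≤ i → M (suc (i ℕ.+ K)) + M (suc (i ℕ.+ K)) ≤ ε
        bound i N≤i = *-cancelʳ-≤-pos (nat k) $ begin
          (M k + M k) * nat k        ≡⟨ *-distribʳ-+ (nat k) (M k) (M k) ⟩
          M k * nat k + M k * nat k  ≤⟨ +-mono-≤ (M-decay i) (M-decay i) ⟩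
          A + A                      ≤⟨ 2A≤ k (ℕ.≤-trans N≤i (ℕ.≤-trans (ℕ.m≤m+n i K) (ℕ.n≤1+n _))) ⟩
          ε * nat k ∎
          where
          open ≤-Reasoning
          k : ℕ
          k = suc (i ℕ.+ K)
        go : ∀ n → suc (N ℕ.+ K) ℕ.≤ n → M n + M n ≤ ε
        go (suc n) (ℕ.s≤s N+K≤n) =
          subst (λ m → M (suc m) + M (suc m) ≤ ε) (ℕ.m∸n+n≡m (ℕ.≤-trans (ℕ.m≤n+m K N) N+K≤n))
            (bound (n ℕ.∸ K) (ℕ.m+n≤o⇒m≤o∸n N N+K≤n))

  cauchy-bounded : ∀ f → IsCauchy f → ∃ λ B → ∀ n → ∣ f n ∣ ≤ B
  cauchy-bounded f cf with cf 1ℚ 0<1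
  ... | N , h = G N + (∣ f N ∣ + 1ℚ) , bound
    where
    G : ℕ → ℚ
    G zero    = 0ℚ
    G (suc n) = G n + ∣ f n ∣

    0≤G : ∀ n → 0ℚ ≤ G n
    0≤G zero    = ≤-refl
    0≤G (suc n) = 0≤+ (0≤G n) (0≤∣p∣ (f n))

    G-bound : ∀ n k → k ℕ.< n → ∣ f k ∣ ≤ G n
    G-bound (suc n) k (ℕ.s≤s k≤n) with ℕ.m≤n⇒m<n∨m≡n k≤n
    ... | inj₁ k<n  = ≤-trans (G-bound n k k<n) (≤-+ʳ (0≤∣p∣ (f n)))
    ... | inj₂ refl = ≤-+ˡ (0≤G n)

    bound : ∀ n → ∣ f n ∣ ≤ G N + (∣ f N ∣ + 1ℚ)
    bound n with ℕ.<-≤-connex n N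
    ... | inj₁ n<N = ≤-trans (G-bound N n n<N) (≤-+ʳ (0≤+ (0≤∣p∣ (f N)) (<⇒≤ 0<1)))
    ... | inj₂ N≤n = begin
      ∣ f n ∣                  ≡⟨ cong ∣_∣ (solve 2 (λ x y → x := y :+ (x :- y)) refl (f n) (f N)) ⟩
      ∣ f N + (f n - f N) ∣    ≤⟨ ∣p+q∣≤∣p∣+∣q∣ (f N) (f n - f N) ⟩
      ∣ f N ∣ + ∣ f n - f N ∣  ≤⟨ +-monoʳ-≤ ∣ f N ∣ (h n N N≤n ℕ.≤-refl) ⟩
      ∣ f N ∣ + 1ℚ             ≤⟨ ≤-+ˡ (0≤G N) ⟩
      G N + (∣ f N ∣ + 1ℚ) ∎
      where open ≤-Reasoning

  abstract

    series-isCauchy : ∀ a → (∀ k → ∣ a k ∣ ≤ 1ℚ) → ∀ f → IsCauchy f → IsCauchy (λ n → partialSum a (f n) n)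
    series-isCauchy a a≤1 f cf ε 0<ε = N , λ m n N≤m N≤n → begin
      ∣ F m m - F n n ∣
        ≡⟨ cong ∣_∣ (solve 3 (λ x y z → x :- z := (x :- y) :+ (y :- z)) refl (F m m) (F n m) (F n n)) ⟩
      ∣ (F m m - F n m) + (F n m - F n n) ∣
        ≤⟨ ∣p+q∣≤∣p∣+∣q∣ (F m m - F n m) (F n m - F n n) ⟩
      ∣ F m m - F n m ∣ + ∣ F n m - F n n ∣
        ≤⟨ +-mono-≤ (near m n N≤m N≤n) (tail (f n) (f≤C n) m n (ℕ.m⊔n≤o⇒n≤o N₁ N₂ N≤m) (ℕ.m⊔n≤o⇒n≤o N₁ N₂ N≤n)) ⟩
      ½ * ε + ½ * ε
        ≡⟨ halves ε ⟩
      ε ∎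
      where
      open ≤-Reasoning
      F : ℕ → ℕ → ℚ
      F i = partialSum a (f i)

      B C : ℚ
      B = cauchy-bounded f cf .Σ.proj₁
      C = B + 1ℚ

      f≤B : ∀ n → ∣ f n ∣ ≤ B
      f≤B = cauchy-bounded f cf .Σ.proj₂

      f≤C : ∀ n → ∣ f n ∣ ≤ C
      f≤C n = ≤-trans (f≤B n) (≤-+ʳ (<⇒≤ 0<1))

      open Majorant C (≤-trans (0≤∣p∣ (f 0)) (f≤C 0))

      K l : ℕ
      K = archimedean (C + C) .Σ.proj₁

      open Tail K (archimedean (C + C) .Σ.proj₂)

      l = archimedean (U K) .Σ.proj₁

      close : ∃ λ N → ∀ m n → N ℕ.≤ m → N ℕ.≤ n → ∣ f m - f n ∣ ≤ ½ * ε * inv l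
      close = cf (½ * ε * inv l) (shrink l (0<½* 0<ε))

      null : ∃ λ N → K ℕ.≤ N × (∀ n → N ℕ.≤ n → M n + M n ≤ ½ * ε)
      null = M-null (½ * ε) (0<½* 0<ε)

      N₁ N₂ N : ℕ
      N₁ = close .Σ.proj₁
      N₂ = null .Σ.proj₁
      N  = N₁ ℕ.⊔ N₂

      K≤N₂ : K ℕ.≤ N₂
      K≤N₂ = null .Σ.proj₂ .Σ.proj₁

      near : ∀ m n → N ℕ.≤ m → N ℕ.≤ n → ∣ F m m - F n m ∣ ≤ ½ * ε
      near m n N≤m N≤n = begin
        ∣ F m m - F n m ∣
          ≤⟨ sum-lipschitz a a≤1 (f m) (f n) (f≤C m) (+-monoˡ-≤ 1ℚ (f≤B n)) m ⟩
        ∣ f m - f n ∣ * S m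
          ≤⟨ shrink-bound l (0≤∣p∣ (f m - f n))
               (close .Σ.proj₂ m n (ℕ.m⊔n≤o⇒m≤o N₁ N₂ N≤m) (ℕ.m⊔n≤o⇒m≤o N₁ N₂ N≤n))
               (≤-trans (S-bounded m (ℕ.≤-trans K≤N₂ (ℕ.m⊔n≤o⇒n≤o N₁ N₂ N≤m))) (archimedean (U K) .Σ.proj₂)) ⟩
        ½ * ε ∎

      tail≤ : ∀ q → ∣ q ∣ ≤ C → ∀ m n → N₂ ℕ.≤ n → n ℕ.≤ m → ∣ partialSum a q m - partialSum a q n ∣ ≤ ½ * ε
      tail≤ q q≤C m n N₂≤n n≤m = subst (λ k → ∣ partialSum a q k - partialSum a q n ∣ ≤ ½ * ε) (ℕ.m∸n+n≡m n≤m) $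
        ≤-trans (sum-step a a≤1 q q≤C n (m ℕ.∸ n))
          (≤-trans (S-tail n (m ℕ.∸ n) (ℕ.≤-trans K≤N₂ N₂≤n)) (null .Σ.proj₂ .Σ.proj₂ n N₂≤n))

      tail : ∀ q → ∣ q ∣ ≤ C → ∀ m n → N₂ ℕ.≤ m → N₂ ℕ.≤ n → ∣ partialSum a q m - partialSum a q n ∣ ≤ ½ * ε
      tail q q≤C m n N₂≤m N₂≤n with ℕ.≤-total n m
      ... | inj₁ n≤m = tail≤ q q≤C m n N₂≤n n≤m
      ... | inj₂ m≤n = subst (_≤ ½ * ε) (∣-∣-swap (partialSum a q n) (partialSum a q m)) (tail≤ q q≤C n m N₂≤m m≤n)

-- The diagonal sequence n ↦ Σ_{k<n} aₖ xₙᵏ / k! has the same limit as the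
-- series at x, because the series converges uniformly on bounded sets.
cos sin : ℝ → ℝ
cos x = mkℝ (λ n → partialSum cosCoeff (seq x n) n) (series-isCauchy cosCoeff ∣cosCoeff∣≤1 (seq x) (isCauchy x))
sin x = mkℝ (λ n → partialSum sinCoeff (seq x n) n) (series-isCauchy sinCoeff ∣sinCoeff∣≤1 (seq x) (isCauchy x))

-- This determines π up to _≈_ as the first positive zero of sine, sine being
-- positive between 0 and its first positive zero.
record IsPi (π : ℝ) : Set where
  field
    positive-π : 0ℝ <ℝ π
    sin-π      : sin π ≈ 0ℝ
    sin-before : ∀ x → 0ℝ <ℝ x → x <ℝ π → 0ℝ <ℝ sin x

infix  4 _≈ℂ_
infixl 6 _+ℂ_
infix  5 _+i_

record ℂ : Set where
  constructor _+i_
  field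
    re im : ℝ

open ℂ public

_≈ℂ_ : ℂ → ℂ → Set
z ≈ℂ w = re z ≈ re w × im z ≈ im w

_+ℂ_ : ℂ → ℂ → ℂ
z +ℂ w = (re z +ℝ re w) +i (im z +ℝ im w)

0ℂ -1ℂ : ℂ
0ℂ  = 0ℝ +i 0ℝ
-1ℂ = fromℚ (- 1ℚ) +i 0ℝ

-- Symmetry and irreflexivity are not recorded: the only graph concerned is
-- Cay n S with S = - S and 0 ∉ S, which has both.
record Graph (n : ℕ) : Set₁ where
  field
    Adj  : Fin n → Fin n → Set
    adj? : Decidable Adj

record ClosedDistanceMagic {n : ℕ} (Γ : Graph n) : Set where
  open Graph Γ
  field
    ℓ : Fin n ⤖ Fin n

  -- ℓ followed by Fin n ≅ {1, …, n}
  label : Fin n → ℕ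
  label v = suc (toℕ (Bijection.to ℓ v))

  field
    r     : ℕ
    0<r   : 0 ℕ.< r
    magic : ∀ u → label u ℕ.+ sum ℕ.+-0-rawMonoid (λ v → if does (adj? u v) then label v else 0) ≡ r

module _ (n : ℕ) .{{_ : ℕ.NonZero n}} where

  residue : ℤ → Fin n
  residue z = fromℕ< (n%ℕd<d z n)

  Cay : Subset n → Graph n
  Cay S = record
    { Adj  = λ g h → residue (+ toℕ h ℤ.- + toℕ g) ∈ S
    ; adj? = λ g h → residue (+ toℕ h ℤ.- + toℕ g) ∈? S
    }

  connectionSet : ℕ → Subset n
  connectionSet c =
    ⁅ residue (+ 1) ⁆ ∪ ⁅ residue (ℤ.- + 1) ⁆ ∪
    ⁅ residue (+ c) ⁆ ∪ ⁅ residue (ℤ.- + c) ⁆ ∪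
    ⁅ residue (+ (n ℕ./ 2)) ⁆

  module _ (π : ℝ) where

    -- χ j x is the value χⱼ(x); here 2πxj/n is written (2xj/n) · π.
    χ : Fin n → Fin n → ℂ
    χ j x = cos θ +i sin θ
      where
      θ : ℝ
      θ = (+ (2 ℕ.* toℕ x ℕ.* toℕ j) / n) · π

    χ-sum : Fin n → Subset n → ℂ
    χ-sum j S = foldr _+ℂ_ 0ℂ (λ x → if does (x ∈? S) then χ j x else 0ℂ)

    𝓙 : Subset n → Fin n → Set
    𝓙 S j = χ-sum j S ≈ℂ -1ℂ

    ±2π/3+2kπ : Sign → ℤ → ℝ
    ±2π/3+2kπ s k = ((s ◃ 2) / 3) · π +ℝ (((+ 2) ℤ.* k) / 1) · π

    Type2 : ℕ → Fin n → Set
    Type2 c j = 𝓙 (connectionSet c) j × 2 ∣ toℕ j ×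
      ∃ λ k₁ → ∃ λ k₂ → ∃ λ s₁ → ∃ λ s₂ →
        pair ((+ (2 ℕ.* toℕ j) / n) · π) ((+ (2 ℕ.* toℕ j ℕ.* c) / n) · π)
        ≐ pair (±2π/3+2kπ s₁ k₁) (±2π/3+2kπ s₂ k₂)

    Type3⁺ : ℕ → Fin n → Set
    Type3⁺ c j = 𝓙 (connectionSet c) j × ¬ 2 ∣ toℕ j ×
      ∃ λ k → + toℕ j / 1 ≡ (+ n ℤ.* (+ 2 ℤ.* k ℤ.+ + 1)) / (2 ℕ.* suc c)

{-# OPTIONS --safe #-}

-- Write n = 2h and let T be the translation by 1 on functions on ℤ/n.
--
-- If 3 divides h but not c, then j = n/3 is of type 2.  If 2 has the same
-- exponent in c + 1 and in h, then j = h / gcd (c + 1, h) is of type 3⁺.  Both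
-- follow from the addition formulas for sine and cosine, from cos π = -1 and
-- from cos (2π/3) = -1/2.
--
-- Otherwise a closed magic labelling f would be periodic.  On f⁻ = f - T^h f
-- the magic equation reads (T^(c+1) + 1) (T^(c-1) + 1) f⁻ = 0, and T^(c+1) + 1
-- is injective on {T^h = -1}; hence T^(2(c-1)) f⁻ = f⁻.  On F = (T - 1) (f + T^h f)
-- it reads (2 + A + B) F = 0 with A = T + T⁻¹ and B = T^c + T^-c.  Then R = A + 1
-- satisfies ‖F‖² = ‖R F‖² + ‖(1 + T) (1 + T^c) F‖².  As F has integer values,
-- descent on ‖F‖² gives A (A + 1) (A + 2) F = 0.  The kernels of A + 1 and A + 2
-- contribute nothing, and that of A only if c ≡ 2 and h ≡ 0 modulo 4.  So f has
-- period 2(c-1), or 4(c-1) in that last case, and neither is a multiple of n.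
module Submission where

open import Defs
open import Algebra.Bundles using (CommutativeMonoid)
open import Data.Bool.Base using (Bool; if_then_else_; true; false)
open import Data.Fin.Base as Fin using (Fin; toℕ; fromℕ<; punchIn)
import Data.Fin.Properties as Fin
open import Data.Fin.Subset using (Subset; ⁅_⁆; _∪_; _∈_; _∉_)
open import Data.Fin.Subset.Properties using (_∈?_; x∈⁅x⁆; x∈⁅y⁆⇒x≡y; x∈p∪q⁻; x∈p∪q⁺)
open import Data.Integer.Base as ℤ using (ℤ; +_; -[1+_])
open import Data.Integer.DivMod using (_%ℕ_; _/ℕ_; n%ℕd<d; a≡a%ℕn+[a/ℕn]*n)
import Data.Integer.Properties as ℤ
import Data.Integer.Tactic.RingSolver as ℤ-Solver
open import Data.Nat.Base as ℕ using (ℕ; zero; suc)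
open import Data.Nat.DivMod using (m/n*n≡m)
import Data.Nat.Induction as ℕ
import Data.Nat.Properties as ℕ
import Data.Nat.Tactic.RingSolver as ℕ-Solver
open import Data.Product.Base using (∃; _×_; _,_; proj₁; proj₂)
open import Data.Sign.Base as Sign using (Sign)
open import Data.Sum.Base using (_⊎_; inj₁; inj₂; [_,_]′)
open import Data.Vec.Functional using (foldr)
open import Function.Base using (_∘_; id)
open import Function.Bundles using (module Bijection)
open import Induction.WellFounded using (Acc; acc)
open import Level using (0ℓ)
open import Relation.Binary.PropositionalEquality
open import Relation.Nullary using (¬_; Dec; yes; no; does; contradiction)
open import Relation.Unary using (_≐_)

-- Behind the descent stands Kronecker's theorem. On a character of angle θ the equation (2 + A + B)
-- F = 0 reads 2 cos θ = -2 - 2 cos cθ. So 2 cos θ ≤ 0, and the eigenvalue 1 + 2 cos θ of R lies in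
-- [-1, 1]. The same holds for its Galois conjugates, and an algebraic integer whose conjugates are
-- all real and in [-1, 1] is -1, 0 or 1; hence the cubic. Integrality of the labels replaces the
-- conjugates: all R^k F are integer-valued with non-increasing norm, so no Fourier transform has to
-- be formed. The norm identity comes from R² + (2 + A) (2 + B) = 1 on solutions, since R² - 1 = A
-- (A + 2) and 2 + B acts as -A, together with 2 + T^s + T^-s = (1 + T^s)* (1 + T^s). The index j
-- depends on the arithmetic of c and h alone; the labelling only excludes the pairs (c, h) that
-- admit neither construction. So just a few values of sine and cosine are needed. They are derived
-- from π as the first positive zero of sine, and every formula with a product of reals becomes a
-- statement on the approximating rational sequences.

-- Cauchy products and partial sums of the exponential series.

module CauchyProduct where

  open import Data.Rational.Base
  open import Data.Rational.Properties
  import Data.Rational.Unnormalised.Base as ℚᵘ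
  import Data.Rational.Unnormalised.Properties as ℚᵘ
  open import Data.Rational.Solver using (module +-*-Solver)
  open +-*-Solver using (solve; _:=_; _:+_; _:*_; _:-_; :-_; con)

  mulʳ : ∀ {p q} r → 0ℚ ≤ r → p ≤ q → p * r ≤ q * r
  mulʳ r 0≤r = *-monoʳ-≤-nonNeg r {{nonNegative 0≤r}}

  mulˡ : ∀ {p q} r → 0ℚ ≤ r → p ≤ q → r * p ≤ r * q
  mulˡ r 0≤r = *-monoˡ-≤-nonNeg r {{nonNegative 0≤r}}

  0≤* : ∀ {p q} → 0ℚ ≤ p → 0ℚ ≤ q → 0ℚ ≤ p * q
  0≤* {p} {q} 0≤p 0≤q = subst (_≤ p * q) (*-zeroˡ q) (mulʳ q 0≤q 0≤p)

  *-mono : ∀ {p q r s} → 0ℚ ≤ q → 0ℚ ≤ r → p ≤ q → r ≤ s → p * r ≤ q * s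
  *-mono {p} {q} {r} {s} 0≤q 0≤r p≤q r≤s = ≤-trans (mulʳ r 0≤r p≤q) (mulˡ q 0≤q r≤s)

  ∣*∣≤ : ∀ p q {P Q} → ∣ p ∣ ≤ P → ∣ q ∣ ≤ Q → ∣ p * q ∣ ≤ P * Q
  ∣*∣≤ p q {P} {Q} p≤P q≤Q = subst (_≤ P * Q) (sym (∣p*q∣≡∣p∣*∣q∣ p q))
    (*-mono (≤-trans (0≤∣p∣ p) p≤P) (0≤∣p∣ q) p≤P q≤Q)

  ∣+∣≤ : ∀ p q {P Q} → ∣ p ∣ ≤ P → ∣ q ∣ ≤ Q → ∣ p + q ∣ ≤ P + Q
  ∣+∣≤ p q p≤P q≤Q = ≤-trans (∣p+q∣≤∣p∣+∣q∣ p q) (+-mono-≤ p≤P q≤Q)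

  Σ< : (ℕ → ℚ) → ℕ → ℚ
  Σ< u zero    = 0ℚ
  Σ< u (suc n) = Σ< u n + u n

  Σ<-cong : ∀ {u v} → u ≗ v → ∀ n → Σ< u n ≡ Σ< v n
  Σ<-cong u≗v zero    = refl
  Σ<-cong u≗v (suc n) = cong₂ _+_ (Σ<-cong u≗v n) (u≗v n)

  Σ<-head : ∀ u n → Σ< u (suc n) ≡ u 0 + Σ< (u ∘ suc) n
  Σ<-head u zero    = trans (+-identityˡ (u 0)) (sym (+-identityʳ (u 0)))
  Σ<-head u (suc n) = trans (cong (_+ u (suc n)) (Σ<-head u n)) (+-assoc (u 0) _ _)

  Σ<-+ : ∀ u v n → Σ< (λ k → u k + v k) n ≡ Σ< u n + Σ< v n
  Σ<-+ u v zero    = refl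
  Σ<-+ u v (suc n) = trans (cong (_+ (u n + v n)) (Σ<-+ u v n))
    (solve 4 (λ U V u v → (U :+ V) :+ (u :+ v) := (U :+ u) :+ (V :+ v)) refl (Σ< u n) (Σ< v n) (u n) (v n))

  Σ<-mono : ∀ u → (∀ k → 0ℚ ≤ u k) → ∀ {m n} → m ℕ.≤ n → Σ< u m ≤ Σ< u n
  Σ<-mono u 0≤u {m} m≤n = go (ℕ.≤⇒≤′ m≤n)
    where
    go : ∀ {n} → m ℕ.≤′ n → Σ< u m ≤ Σ< u n
    go ℕ.≤′-refl     = ≤-refl
    go (ℕ.≤′-step {n} m≤′n) =
      subst (_≤ Σ< u n + u n) (+-identityʳ _) (+-mono-≤ (go m≤′n) (0≤u n))

  Σ<-tail : ∀ u U → (∀ k → ∣ u k ∣ ≤ U k) → ∀ {m n} → m ℕ.≤ n → ∣ Σ< u n - Σ< u m ∣ ≤ Σ< U n - Σ< U m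
  Σ<-tail u U u≤U {m} m≤n = go (ℕ.≤⇒≤′ m≤n)
    where
    go : ∀ {n} → m ℕ.≤′ n → ∣ Σ< u n - Σ< u m ∣ ≤ Σ< U n - Σ< U m
    go ℕ.≤′-refl = ≤-reflexive (trans (cong ∣_∣ (+-inverseʳ (Σ< u m))) (sym (+-inverseʳ (Σ< U m))))
    go (ℕ.≤′-step {n} m≤′n) = subst₂ (λ p q → ∣ p ∣ ≤ q) (rearrange u) (rearrange U)
      (∣+∣≤ (Σ< u n - Σ< u m) (u n) (go m≤′n) (u≤U n))
      where
      rearrange : ∀ w → Σ< w n - Σ< w m + w n ≡ Σ< w (suc n) - Σ< w m
      rearrange w = solve 3 (λ x y z → x :- y :+ z := x :+ z :- y) refl (Σ< w n) (Σ< w m) (w n)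

  infixl 7 _⋆_
  -- The Cauchy product of coefficient sequences. The recursion walks along the antidiagonal by
  -- shifting `u`, so that inductions can treat `u ∘ suc` as a new first factor.
  _⋆_ : (ℕ → ℚ) → (ℕ → ℚ) → ℕ → ℚ
  (u ⋆ v) zero    = u 0 * v 0
  (u ⋆ v) (suc n) = u 0 * v (suc n) + ((u ∘ suc) ⋆ v) n

  ⋆-cong : ∀ {u u′ v v′} → u ≗ u′ → v ≗ v′ → u ⋆ v ≗ u′ ⋆ v′
  ⋆-cong p q zero    = cong₂ _*_ (p 0) (q 0)
  ⋆-cong p q (suc n) = cong₂ _+_ (cong₂ _*_ (p 0) (q (suc n))) (⋆-cong (p ∘ suc) q n)

  ⋆-last : ∀ u v n → (u ⋆ v) (suc n) ≡ (u ⋆ (v ∘ suc)) n + u (suc n) * v 0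
  ⋆-last u v zero    = refl
  ⋆-last u v (suc n) = trans (cong (_+_ (u 0 * v (suc (suc n)))) (⋆-last (u ∘ suc) v n)) (sym (+-assoc (u 0 * v (suc (suc n))) _ _))

  ⋆-scaleˡ : ∀ x u v n → ((λ k → x * u k) ⋆ v) n ≡ x * (u ⋆ v) n
  ⋆-scaleˡ x u v zero    = *-assoc x (u 0) (v 0)
  ⋆-scaleˡ x u v (suc n) = trans (cong (_+_ (x * u 0 * v (suc n))) (⋆-scaleˡ x (u ∘ suc) v n))
    (solve 4 (λ x u v w → x :* u :* v :+ x :* w := x :* (u :* v :+ w)) refl x (u 0) (v (suc n)) _)

  ⋆-scaleʳ : ∀ x u v n → (u ⋆ (λ k → x * v k)) n ≡ x * (u ⋆ v) n
  ⋆-scaleʳ x u v zero    = solve 3 (λ x u v → u :* (x :* v) := x :* (u :* v)) refl x (u 0) (v 0)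
  ⋆-scaleʳ x u v (suc n) = trans (cong (_+_ (u 0 * (x * v (suc n)))) (⋆-scaleʳ x (u ∘ suc) v n))
    (solve 4 (λ x u v w → u :* (x :* v) :+ x :* w := x :* (u :* v :+ w)) refl x (u 0) (v (suc n)) _)

  ⋆-+ˡ : ∀ u u′ v n → ((λ k → u k + u′ k) ⋆ v) n ≡ (u ⋆ v) n + (u′ ⋆ v) n
  ⋆-+ˡ u u′ v zero    = *-distribʳ-+ (v 0) (u 0) (u′ 0)
  ⋆-+ˡ u u′ v (suc n) = trans (cong (_+_ ((u 0 + u′ 0) * v (suc n))) (⋆-+ˡ (u ∘ suc) (u′ ∘ suc) v n))
    (solve 5 (λ u u′ v w w′ → (u :+ u′) :* v :+ (w :+ w′) := (u :* v :+ w) :+ (u′ :* v :+ w′)) refl (u 0) (u′ 0) (v (suc n)) _ _)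

  ⋆-nonNeg : ∀ u v → (∀ k → 0ℚ ≤ u k) → (∀ k → 0ℚ ≤ v k) → ∀ n → 0ℚ ≤ (u ⋆ v) n
  ⋆-nonNeg u v 0≤u 0≤v zero    = 0≤* (0≤u 0) (0≤v 0)
  ⋆-nonNeg u v 0≤u 0≤v (suc n) = +-mono-≤ (0≤* (0≤u 0) (0≤v (suc n))) (⋆-nonNeg (u ∘ suc) v (0≤u ∘ suc) 0≤v n)

  /-cross : ∀ a b m n .{{_ : ℕ.NonZero m}} .{{_ : ℕ.NonZero n}} → a ℤ.* + n ≡ b ℤ.* + m → a / m ≡ b / n
  /-cross a b (suc m) (suc n) eq = fromℚᵘ-cong {ℚᵘ.mkℚᵘ a m} {ℚᵘ.mkℚᵘ b n} (ℚᵘ.*≡* eq)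

  toℚᵘ-/ : ∀ a m → toℚᵘ (a / suc m) ℚᵘ.≃ ℚᵘ.mkℚᵘ a m
  toℚᵘ-/ a m = toℚᵘ-fromℚᵘ (ℚᵘ.mkℚᵘ a m)

  /-+ : ∀ a b m .{{_ : ℕ.NonZero m}} → a / m + b / m ≡ (a ℤ.+ b) / m
  /-+ a b (suc m) = toℚᵘ-injective (ℚᵘ.≃-trans (toℚᵘ-homo-+ (a / suc m) (b / suc m))
    (ℚᵘ.≃-trans (ℚᵘ.+-cong (toℚᵘ-/ a m) (toℚᵘ-/ b m))
    (ℚᵘ.≃-trans (ℚᵘ.*≡* (identity a b (+ suc m))) (ℚᵘ.≃-sym (toℚᵘ-/ (a ℤ.+ b) m)))))
    where
    identity : ∀ a b m → (a ℤ.* m ℤ.+ b ℤ.* m) ℤ.* m ≡ (a ℤ.+ b) ℤ.* (m ℤ.* m)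
    identity = ℤ-Solver.solve-∀

  fromℕ : ℕ → ℚ
  fromℕ n = + n / 1

  fromℕ-suc : ∀ n → fromℕ (suc n) ≡ fromℕ n + 1ℚ
  fromℕ-suc n = trans (cong (_/ 1) (ℤ.+-comm (+ 1) (+ n))) (sym (/-+ (+ n) (+ 1) 1))

  fromℕ*1/ : ∀ k → fromℕ (suc k) * (+ 1 / suc k) ≡ 1ℚ
  fromℕ*1/ k = toℚᵘ-injective (ℚᵘ.≃-trans (toℚᵘ-homo-* (fromℕ (suc k)) (+ 1 / suc k))
    (ℚᵘ.≃-trans (ℚᵘ.*-cong (toℚᵘ-/ (+ suc k) 0) (toℚᵘ-/ (+ 1) k))
    (ℚᵘ.*≡* (cong +_ (identity (suc k))))))
    where
    identity : ∀ k → k ℕ.* 1 ℕ.* 1 ≡ 1 ℕ.* (1 ℕ.* k)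
    identity = ℕ-Solver.solve-∀

  -- The Euler operator: if `u` lists the coefficients of a power series g, these are the
  -- coefficients of X g′(X).
  weighted : (ℕ → ℚ) → ℕ → ℚ
  weighted u k = fromℕ k * u k

  -- The product rule for the Euler operator: on the antidiagonal i + j = n the two weights add up
  -- to n.
  ⋆-leibniz : ∀ u v n → (weighted u ⋆ v) n + (u ⋆ weighted v) n ≡ fromℕ n * (u ⋆ v) n
  ⋆-leibniz u v zero    = solve 2 (λ u v → con 0ℚ :* u :* v :+ u :* (con 0ℚ :* v) := con 0ℚ :* (u :* v)) refl (u 0) (v 0)
  ⋆-leibniz u v (suc n) = begin
    (0ℚ * u 0 * v₁ + ((weighted u ∘ suc) ⋆ v) n) + (u 0 * (fromℕ (suc n) * v₁) + (u′ ⋆ weighted v) n)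
      ≡⟨ cong₂ (λ z f → (0ℚ * u 0 * v₁ + z) + (u 0 * (f * v₁) + (u′ ⋆ weighted v) n)) split (fromℕ-suc n) ⟩
    (0ℚ * u 0 * v₁ + ((weighted u′ ⋆ v) n + (u′ ⋆ v) n)) + (u 0 * ((fromℕ n + 1ℚ) * v₁) + (u′ ⋆ weighted v) n)
      ≡⟨ solve 6 (λ u v f a b c → (con 0ℚ :* u :* v :+ (a :+ b)) :+ (u :* ((f :+ con 1ℚ) :* v) :+ c)
                               := (f :+ con 1ℚ) :* (u :* v) :+ ((a :+ c) :+ b)) refl
                 (u 0) v₁ (fromℕ n) ((weighted u′ ⋆ v) n) ((u′ ⋆ v) n) ((u′ ⋆ weighted v) n) ⟩
    (fromℕ n + 1ℚ) * (u 0 * v₁) + (((weighted u′ ⋆ v) n + (u′ ⋆ weighted v) n) + (u′ ⋆ v) n)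
      ≡⟨ cong (λ z → (fromℕ n + 1ℚ) * (u 0 * v₁) + (z + (u′ ⋆ v) n)) (⋆-leibniz u′ v n) ⟩
    (fromℕ n + 1ℚ) * (u 0 * v₁) + (fromℕ n * (u′ ⋆ v) n + (u′ ⋆ v) n)
      ≡⟨ solve 3 (λ f a b → (f :+ con 1ℚ) :* a :+ (f :* b :+ b) := (f :+ con 1ℚ) :* (a :+ b)) refl (fromℕ n) (u 0 * v₁) _ ⟩
    (fromℕ n + 1ℚ) * (u 0 * v₁ + (u′ ⋆ v) n)
      ≡⟨ cong (_* (u 0 * v₁ + (u′ ⋆ v) n)) (fromℕ-suc n) ⟨
    fromℕ (suc n) * (u 0 * v₁ + (u′ ⋆ v) n) ∎
    where
    open ≡-Reasoning
    u′ : ℕ → ℚ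
    u′ = u ∘ suc
    v₁ : ℚ
    v₁ = v (suc n)
    weighted-suc : ∀ k → weighted u (suc k) ≡ weighted u′ k + u′ k
    weighted-suc k = trans (cong (_* u′ k) (fromℕ-suc k))
      (solve 2 (λ f u → (f :+ con 1ℚ) :* u := f :* u :+ u) refl (fromℕ k) (u′ k))
    split : ((weighted u ∘ suc) ⋆ v) n ≡ (weighted u′ ⋆ v) n + (u′ ⋆ v) n
    split = trans (⋆-cong {v = v} weighted-suc (λ _ → refl) n) (⋆-+ˡ (weighted u′) u′ v n)

  -- The differential equation X E′ = x X E of the series E = exp (x X), read off in degree k + 1.
  weighted-term : ∀ x k → weighted (term x) (suc k) ≡ x * term x k
  weighted-term x k = begin
    fromℕ (suc k) * (term x k * (x * (+ 1 / suc k)))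
      ≡⟨ solve 4 (λ f t x i → f :* (t :* (x :* i)) := f :* i :* (x :* t)) refl (fromℕ (suc k)) (term x k) x (+ 1 / suc k) ⟩
    fromℕ (suc k) * (+ 1 / suc k) * (x * term x k)
      ≡⟨ cong (_* (x * term x k)) (fromℕ*1/ k) ⟩
    1ℚ * (x * term x k)
      ≡⟨ *-identityˡ _ ⟩
    x * term x k ∎
    where open ≡-Reasoning

  -- The binomial theorem without binomial coefficients: both sides satisfy (n + 1) t (n + 1) = (x +
  -- y) t n. For the Cauchy product this recursion is the product rule combined with
  -- `weighted-term`.
  term-+ : ∀ x y n → term (x + y) n ≡ (term x ⋆ term y) n
  term-+ x y zero    = refl
  term-+ x y (suc n) = begin
    term (x + y) n * ((x + y) * i)
      ≡⟨ cong (_* ((x + y) * i)) (term-+ x y n) ⟩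
    c n * ((x + y) * i)
      ≡⟨ solve 4 (λ c x y i → c :* ((x :+ y) :* i) := i :* (x :* c :+ y :* c)) refl (c n) x y i ⟩
    i * (x * c n + y * c n)
      ≡⟨ cong (i *_) (cong₂ _+_ left right) ⟨
    i * ((weighted (term x) ⋆ term y) (suc n) + (term x ⋆ weighted (term y)) (suc n))
      ≡⟨ cong (i *_) (⋆-leibniz (term x) (term y) (suc n)) ⟩
    i * (fromℕ (suc n) * c (suc n))
      ≡⟨ solve 3 (λ i f c → i :* (f :* c) := f :* i :* c) refl i (fromℕ (suc n)) (c (suc n)) ⟩
    fromℕ (suc n) * i * c (suc n)
      ≡⟨ cong (_* c (suc n)) (fromℕ*1/ n) ⟩
    1ℚ * c (suc n)
      ≡⟨ *-identityˡ _ ⟩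
    c (suc n) ∎
    where
    open ≡-Reasoning
    i : ℚ
    i = + 1 / suc n
    c : ℕ → ℚ
    c = term x ⋆ term y
    left : (weighted (term x) ⋆ term y) (suc n) ≡ x * c n
    left = begin
      0ℚ * 1ℚ * term y (suc n) + ((weighted (term x) ∘ suc) ⋆ term y) n
        ≡⟨ cong₂ _+_ (*-zeroˡ (term y (suc n))) (⋆-cong {v = term y} (weighted-term x) (λ _ → refl) n) ⟩
      0ℚ + ((λ k → x * term x k) ⋆ term y) n
        ≡⟨ +-identityˡ _ ⟩
      ((λ k → x * term x k) ⋆ term y) n
        ≡⟨ ⋆-scaleˡ x (term x) (term y) n ⟩
      x * c n ∎
    right : (term x ⋆ weighted (term y)) (suc n) ≡ y * c n
    right = begin
      (term x ⋆ weighted (term y)) (suc n)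
        ≡⟨ ⋆-last (term x) (weighted (term y)) n ⟩
      (term x ⋆ (weighted (term y) ∘ suc)) n + term x (suc n) * 0ℚ
        ≡⟨ cong₂ _+_ (⋆-cong {u = term x} (λ _ → refl) (weighted-term y) n) (*-zeroʳ (term x (suc n))) ⟩
      (term x ⋆ (λ k → y * term y k)) n + 0ℚ
        ≡⟨ +-identityʳ _ ⟩
      (term x ⋆ (λ k → y * term y k)) n
        ≡⟨ ⋆-scaleʳ y (term x) (term y) n ⟩
      y * c n ∎

  Σ<-⋆ : ∀ u v n → Σ< (u ⋆ v) (suc n) ≡ u 0 * Σ< v (suc n) + Σ< ((u ∘ suc) ⋆ v) n
  Σ<-⋆ u v zero    = solve 2 (λ a b → con 0ℚ :+ a :* b := a :* (con 0ℚ :+ b) :+ con 0ℚ) refl (u 0) (v 0)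
  Σ<-⋆ u v (suc n) = trans (cong (_+ (u 0 * v (suc n) + ((u ∘ suc) ⋆ v) n)) (Σ<-⋆ u v n))
    (solve 5 (λ a s b p q → (a :* s :+ p) :+ (a :* b :+ q) := a :* (s :+ b) :+ (p :+ q)) refl
       (u 0) (Σ< v (suc n)) (v (suc n)) (Σ< ((u ∘ suc) ⋆ v) n) (((u ∘ suc) ⋆ v) n))

  -- For m ≤ N this is the sum of u i * v j over i < m and j < N with i + j ≥ m.
  excess : (ℕ → ℚ) → (ℕ → ℚ) → ℕ → ℕ → ℚ
  excess u v N m = Σ< u m * Σ< v N - Σ< (u ⋆ v) m

  excess-suc : ∀ u v N m → excess u v N (suc m) ≡ u 0 * (Σ< v N - Σ< v (suc m)) + excess (u ∘ suc) v N m
  excess-suc u v N m = trans (cong₂ (λ p q → p * Σ< v N - q) (Σ<-head u m) (Σ<-⋆ u v m))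
    (solve 5 (λ a s V W P → (a :+ s) :* V :- (a :* W :+ P) := a :* (V :- W) :+ (s :* V :- P)) refl
       (u 0) (Σ< (u ∘ suc) m) (Σ< v N) (Σ< v (suc m)) (Σ< ((u ∘ suc) ⋆ v) m))

  -- By `excess-suc` the excess is a sum over rows. The condition `m ≤ N` makes each row a stretch
  -- of `v` taken with positive sign, so termwise bounds carry over.
  excess-mono : ∀ u v U V → (∀ k → ∣ u k ∣ ≤ U k) → (∀ k → ∣ v k ∣ ≤ V k) → ∀ N m → m ℕ.≤ N →
                ∣ excess u v N m ∣ ≤ excess U V N m
  excess-mono u v U V u≤U v≤V N zero    _   = ≤-reflexive (trans (cong ∣_∣ (base v)) (sym (base V)))
    where
    base : ∀ w → 0ℚ * Σ< w N - 0ℚ ≡ 0ℚ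
    base w = solve 1 (λ x → con 0ℚ :* x :- con 0ℚ := con 0ℚ) refl (Σ< w N)
  excess-mono u v U V u≤U v≤V N (suc m) m<N = subst₂ (λ p q → ∣ p ∣ ≤ q) (sym (excess-suc u v N m)) (sym (excess-suc U V N m))
    (∣+∣≤ _ (excess (u ∘ suc) v N m) (∣*∣≤ (u 0) _ (u≤U 0) (Σ<-tail v V v≤V m<N))
       (excess-mono (u ∘ suc) v (U ∘ suc) V (u≤U ∘ suc) v≤V N m (ℕ.<⇒≤ m<N)))

  -- The rectangle i < m, j < N lies inside the triangle i + j < m + N, and all products are
  -- nonnegative.
  Σ<-*-Σ<≤ : ∀ u v → (∀ k → 0ℚ ≤ u k) → (∀ k → 0ℚ ≤ v k) → ∀ m N → Σ< u m * Σ< v N ≤ Σ< (u ⋆ v) (m ℕ.+ N)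
  Σ<-*-Σ<≤ u v 0≤u 0≤v zero    N = subst (_≤ Σ< (u ⋆ v) N) (sym (*-zeroˡ (Σ< v N)))
    (Σ<-mono (u ⋆ v) (⋆-nonNeg u v 0≤u 0≤v) (ℕ.z≤n {N}))
  Σ<-*-Σ<≤ u v 0≤u 0≤v (suc m) N = begin
    Σ< u (suc m) * Σ< v N
      ≡⟨ cong (_* Σ< v N) (Σ<-head u m) ⟩
    (u 0 + Σ< (u ∘ suc) m) * Σ< v N
      ≡⟨ *-distribʳ-+ (Σ< v N) (u 0) (Σ< (u ∘ suc) m) ⟩
    u 0 * Σ< v N + Σ< (u ∘ suc) m * Σ< v N
      ≤⟨ +-mono-≤ (mulˡ (u 0) (0≤u 0) (Σ<-mono v 0≤v (ℕ.m≤n⇒m≤1+n (ℕ.m≤n+m N m))))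
                  (Σ<-*-Σ<≤ (u ∘ suc) v (0≤u ∘ suc) 0≤v m N) ⟩
    u 0 * Σ< v (suc (m ℕ.+ N)) + Σ< ((u ∘ suc) ⋆ v) (m ℕ.+ N)
      ≡⟨ Σ<-⋆ u v (m ℕ.+ N) ⟨
    Σ< (u ⋆ v) (suc (m ℕ.+ N)) ∎
    where open ≤-Reasoning

  -- Square minus triangle lies in the band n ≤ i + j < 2n, which bounds the excess by a stretch of
  -- the product of the majorants. For exponential majorants that product is again exponential, by
  -- `term-+`.
  excess≤ : ∀ u v U V → (∀ k → ∣ u k ∣ ≤ U k) → (∀ k → ∣ v k ∣ ≤ V k) → ∀ n →
            ∣ excess u v n n ∣ ≤ Σ< (U ⋆ V) (n ℕ.+ n) - Σ< (U ⋆ V) n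
  excess≤ u v U V u≤U v≤V n = ≤-trans (excess-mono u v U V u≤U v≤V n n ℕ.≤-refl)
    (+-monoˡ-≤ (- Σ< (U ⋆ V) n) (Σ<-*-Σ<≤ U V (λ k → ≤-trans (0≤∣p∣ (u k)) (u≤U k)) (λ k → ≤-trans (0≤∣p∣ (v k)) (v≤V k)) n n))

  -- Here `a`, `b`, `c`, `d` will be, up to sign, the derivatives at 0 of sine and cosine. Their
  -- combination is constant along each antidiagonal and can be pulled out of the Cauchy product of
  -- the powers.
  ⋆-coefficients : ∀ (a b c d e u v : ℕ → ℚ) → (∀ i j → a i * b j + c i * d j ≡ e (i ℕ.+ j)) → ∀ n →
    ((λ k → a k * u k) ⋆ (λ k → b k * v k)) n + ((λ k → c k * u k) ⋆ (λ k → d k * v k)) n ≡ e n * (u ⋆ v) n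
  ⋆-coefficients a b c d e u v h zero    = trans
    (solve 6 (λ a b c d u v → a :* u :* (b :* v) :+ c :* u :* (d :* v) := (a :* b :+ c :* d) :* (u :* v)) refl
       (a 0) (b 0) (c 0) (d 0) (u 0) (v 0))
    (cong (_* (u 0 * v 0)) (h 0 0))
  ⋆-coefficients a b c d e u v h (suc n) = begin
    (a 0 * u 0 * (b₁ * v₁) + p) + (c 0 * u 0 * (d₁ * v₁) + q)
      ≡⟨ solve 8 (λ a b c d u v p q → (a :* u :* (b :* v) :+ p) :+ (c :* u :* (d :* v) :+ q)
                                   := (a :* b :+ c :* d) :* (u :* v) :+ (p :+ q)) refl (a 0) b₁ (c 0) d₁ (u 0) v₁ p q ⟩
    (a 0 * b₁ + c 0 * d₁) * (u 0 * v₁) + (p + q)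
      ≡⟨ cong₂ _+_ (cong (_* (u 0 * v₁)) (h 0 (suc n)))
           (⋆-coefficients (a ∘ suc) b (c ∘ suc) d (e ∘ suc) (u ∘ suc) v (h ∘ suc) n) ⟩
    e (suc n) * (u 0 * v₁) + e (suc n) * ((u ∘ suc) ⋆ v) n
      ≡⟨ *-distribˡ-+ (e (suc n)) _ _ ⟨
    e (suc n) * (u 0 * v₁ + ((u ∘ suc) ⋆ v) n) ∎
    where
    open ≡-Reasoning
    b₁ d₁ v₁ p q : ℚ
    b₁ = b (suc n)
    d₁ = d (suc n)
    v₁ = v (suc n)
    p = ((λ k → a (suc k) * u (suc k)) ⋆ (λ k → b k * v k)) n
    q = ((λ k → c (suc k) * u (suc k)) ⋆ (λ k → d k * v k)) n

-- Sine and cosine: tail estimates and addition formulas.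

module Trigonometry where

  open CauchyProduct
  open import Data.Rational.Base
  open import Data.Rational.Properties
  open import Data.Rational.Solver using (module +-*-Solver)
  open +-*-Solver using (solve; _:=_; _:+_; _:*_; _:-_; :-_; con)

  0<* : ∀ {p q} → 0ℚ < p → 0ℚ < q → 0ℚ < p * q
  0<* {p} {q} 0<p 0<q = positive⁻¹ (p * q) {{pos*pos⇒pos p {{positive 0<p}} q {{positive 0<q}}}}

  0<½* : ∀ {ε} → 0ℚ < ε → 0ℚ < ½ * ε
  0<½* = 0<* (positive⁻¹ ½)

  halves : ∀ ε → ½ * ε + ½ * ε ≡ ε
  halves ε = trans (sym (*-distribʳ-+ ε ½ ½)) (*-identityˡ ε)

  -- Relations between reals are handled as null sequences of rationals: `x ≈ y` says that the
  -- difference of the two sequences is null, and products of sines and cosines are products of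
  -- rationals.
  record Null (f : ℕ → ℚ) : Set where
    constructor mkNull
    field small : ∀ ε → 0ℚ < ε → ∃ λ N → ∀ n → N ℕ.≤ n → ∣ f n ∣ ≤ ε

  open Null public

  record Bounded (f : ℕ → ℚ) : Set where
    constructor mkBounded
    field
      {bound}  : ℚ
      {start}  : ℕ
      positive-bound : 0ℚ < bound
      bounded        : ∀ n → start ℕ.≤ n → ∣ f n ∣ ≤ bound

  record EventuallyPositive (f : ℕ → ℚ) : Set where
    constructor mkPositive
    field
      {bound}  : ℚ
      {start}  : ℕ
      positive-bound : 0ℚ < bound
      bounded        : ∀ n → start ℕ.≤ n → bound ≤ f n

  null-≗ : ∀ {f g} → f ≗ g → Null g → Null f
  null-≗ f≗g (mkNull null) = mkNull λ ε 0<ε →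
    let N , h = null ε 0<ε in N , λ n N≤n → subst (λ p → ∣ p ∣ ≤ ε) (sym (f≗g n)) (h n N≤n)

  null-+ : ∀ {f g} → Null f → Null g → Null (λ n → f n + g n)
  null-+ {f} {g} (mkNull null-f) (mkNull null-g) = mkNull λ ε 0<ε →
    let M , hf = null-f (½ * ε) (0<½* 0<ε)
        N , hg = null-g (½ * ε) (0<½* 0<ε)
    in M ℕ.⊔ N , λ n ≤n → subst (∣ f n + g n ∣ ≤_) (halves ε)
         (∣+∣≤ (f n) (g n) (hf n (ℕ.m⊔n≤o⇒m≤o M N ≤n)) (hg n (ℕ.m⊔n≤o⇒n≤o M N ≤n)))

  null-* : ∀ {f g} → Null f → Bounded g → Null (λ n → f n * g n)
  null-* {f} {g} (mkNull null-f) (mkBounded {B} {M} 0<B hg) = mkNull λ ε 0<ε →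
    let N , hf = null-f (ε * 1/B) (0<* 0<ε (positive⁻¹ 1/B {{1/pos⇒pos B {{positive 0<B}}}}))
    in M ℕ.⊔ N , λ n ≤n → subst (∣ f n * g n ∣ ≤_) (cancel ε)
         (∣*∣≤ (f n) (g n) (hf n (ℕ.m⊔n≤o⇒n≤o M N ≤n)) (hg n (ℕ.m⊔n≤o⇒m≤o M N ≤n)))
    where
    1/B : ℚ
    1/B = (1/ B) {{>-nonZero 0<B}}
    cancel : ∀ ε → ε * 1/B * B ≡ ε
    cancel ε = trans (*-assoc ε 1/B B) (trans (cong (ε *_) (*-inverseˡ B {{>-nonZero 0<B}})) (*-identityʳ ε))

  null-neg : ∀ {f} → Null f → Null (λ n → - f n)
  null-neg {f} (mkNull null) = mkNull λ ε 0<ε →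
    let N , h = null ε 0<ε in N , λ n N≤n → subst (_≤ ε) (sym (∣-p∣≡∣p∣ (f n))) (h n N≤n)

  null-- : ∀ {f g} → Null f → Null g → Null (λ n → f n - g n)
  null-- null-f null-g = null-+ null-f (null-neg null-g)

  p≤∣p∣ : ∀ p → p ≤ ∣ p ∣
  p≤∣p∣ p with ≤-total 0ℚ p
  ... | inj₁ 0≤p = ≤-reflexive (sym (0≤p⇒∣p∣≡p 0≤p))
  ... | inj₂ p≤0 = ≤-trans p≤0 (0≤∣p∣ p)

  null-squeeze : ∀ {f g N} → (∀ n → N ℕ.≤ n → ∣ f n ∣ ≤ g n) → Null g → Null f
  null-squeeze {f} {g} {N} f≤g (mkNull null) = mkNull λ ε 0<ε →
    let M , h = null ε 0<ε
    in M ℕ.⊔ N , λ n ≤n → ≤-trans (f≤g n (ℕ.m⊔n≤o⇒n≤o M N ≤n))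
         (≤-trans (p≤∣p∣ (g n)) (h n (ℕ.m⊔n≤o⇒m≤o M N ≤n)))

  null-eventually : ∀ {f} N → (∀ n → N ℕ.≤ n → f n ≡ 0ℚ) → Null f
  null-eventually N h = mkNull λ ε 0<ε → N , λ n N≤n → subst (λ p → ∣ p ∣ ≤ ε) (sym (h n N≤n)) (<⇒≤ 0<ε)

  -- Division by a sequence that stays above some δ > 0. It cancels a factor sin t with 0 < t < π.
  null-cancel : ∀ {f g} → EventuallyPositive f → Null (λ n → f n * g n) → Null g
  null-cancel {f} {g} (mkPositive {δ} {M} 0<δ δ≤f) (mkNull null) = mkNull λ ε 0<ε →
    let N , h = null (δ * ε) (0<* 0<δ 0<ε)
    in M ℕ.⊔ N , λ n ≤n → *-cancelˡ-≤-pos δ {{positive 0<δ}}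
         (≤-trans (lower n (ℕ.m⊔n≤o⇒m≤o M N ≤n)) (h n (ℕ.m⊔n≤o⇒n≤o M N ≤n)))
    where
    open ≤-Reasoning
    lower : ∀ n → M ℕ.≤ n → δ * ∣ g n ∣ ≤ ∣ f n * g n ∣
    lower n M≤n = begin
      δ * ∣ g n ∣        ≤⟨ mulʳ ∣ g n ∣ (0≤∣p∣ (g n)) (≤-trans (δ≤f n M≤n) (p≤∣p∣ (f n))) ⟩
      ∣ f n ∣ * ∣ g n ∣  ≡⟨ ∣p*q∣≡∣p∣*∣q∣ (f n) (g n) ⟨
      ∣ f n * g n ∣      ∎

  bounded-const : ∀ q → Bounded (λ _ → q)
  bounded-const q = mkBounded {start = 0} (+-mono-≤-< (0≤∣p∣ q) (positive⁻¹ 1ℚ)) λ _ _ →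
    subst (_≤ ∣ q ∣ + 1ℚ) (+-identityʳ ∣ q ∣) (+-monoʳ-≤ ∣ q ∣ (<⇒≤ (positive⁻¹ 1ℚ)))

  bounded-seq : ∀ x → Bounded (seq x)
  bounded-seq x with isCauchy x 1ℚ (positive⁻¹ 1ℚ)
  ... | N , h = mkBounded (+-mono-≤-< (0≤∣p∣ (seq x N)) (positive⁻¹ 1ℚ)) λ n N≤n → begin
    ∣ seq x n ∣
      ≡⟨ cong ∣_∣ (solve 2 (λ x y → x := y :+ (x :- y)) refl (seq x n) (seq x N)) ⟩
    ∣ seq x N + (seq x n - seq x N) ∣
      ≤⟨ ∣+∣≤ (seq x N) (seq x n - seq x N) ≤-refl (h n N N≤n ℕ.≤-refl) ⟩
    ∣ seq x N ∣ + 1ℚ ∎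
    where open ≤-Reasoning

  partialSum≡Σ< : ∀ a q n → partialSum a q n ≡ Σ< (λ k → a k * term q k) n
  partialSum≡Σ< a q zero    = refl
  partialSum≡Σ< a q (suc n) = cong (_+ a n * term q n) (partialSum≡Σ< a q n)

  ∣cosCoeff∣+∣sinCoeff∣ : ∀ k → ∣ cosCoeff k ∣ + ∣ sinCoeff k ∣ ≡ 1ℚ
  ∣cosCoeff∣+∣sinCoeff∣ zero    = refl
  ∣cosCoeff∣+∣sinCoeff∣ (suc k) = trans (cong (_+ ∣ cosCoeff k ∣) (∣-p∣≡∣p∣ (sinCoeff k)))
    (trans (+-comm (∣ sinCoeff k ∣) (∣ cosCoeff k ∣)) (∣cosCoeff∣+∣sinCoeff∣ k))

  increment-null : ∀ x → Null (λ n → seq x (suc n) - seq x n)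
  increment-null x = mkNull λ ε 0<ε →
    let N , h = isCauchy x ε 0<ε in N , λ n N≤n → h (suc n) n (ℕ.m≤n⇒m≤1+n N≤n) N≤n

  -- In each degree one of the two coefficients is ±1 and the other 0, so the increments of the
  -- cosine and sine series together have the size of the exponential term. The Cauchy property of
  -- `cos` and `sin` at the constant `q` thus makes the terms null.
  ∣term∣≤increments : ∀ q n → ∣ term q n ∣ ≤
    ∣ seq (cos (fromℚ q)) (suc n) - seq (cos (fromℚ q)) n ∣ + ∣ seq (sin (fromℚ q)) (suc n) - seq (sin (fromℚ q)) n ∣
  ∣term∣≤increments q n = ≤-reflexive (begin
    ∣ term q n ∣
      ≡⟨ *-identityˡ ∣ term q n ∣ ⟨
    1ℚ * ∣ term q n ∣
      ≡⟨ cong (_* ∣ term q n ∣) (∣cosCoeff∣+∣sinCoeff∣ n) ⟨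
    (∣ cosCoeff n ∣ + ∣ sinCoeff n ∣) * ∣ term q n ∣
      ≡⟨ *-distribʳ-+ (∣ term q n ∣) (∣ cosCoeff n ∣) (∣ sinCoeff n ∣) ⟩
    ∣ cosCoeff n ∣ * ∣ term q n ∣ + ∣ sinCoeff n ∣ * ∣ term q n ∣
      ≡⟨ cong₂ _+_ (increment cosCoeff) (increment sinCoeff) ⟩
    ∣ partialSum cosCoeff q (suc n) - partialSum cosCoeff q n ∣ + ∣ partialSum sinCoeff q (suc n) - partialSum sinCoeff q n ∣ ∎)
    where
    open ≡-Reasoning
    increment : ∀ a → ∣ a n ∣ * ∣ term q n ∣ ≡ ∣ partialSum a q (suc n) - partialSum a q n ∣
    increment a = trans (sym (∣p*q∣≡∣p∣*∣q∣ (a n) (term q n)))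
      (cong ∣_∣ (solve 2 (λ s t → t := s :+ t :- s) refl (partialSum a q n) (a n * term q n)))

  null-∣∣ : ∀ {f} → Null f → Null (λ n → ∣ f n ∣)
  null-∣∣ {f} (mkNull null) = mkNull λ ε 0<ε →
    let N , h = null ε 0<ε in N , λ n N≤n → subst (_≤ ε) (sym (∣∣p∣∣≡∣p∣ (f n))) (h n N≤n)

  term-null : ∀ q → Null (term q)
  term-null q = null-squeeze {N = 0} (λ n _ → ∣term∣≤increments q n)
    (null-+ (null-∣∣ (increment-null (cos (fromℚ q)))) (null-∣∣ (increment-null (sin (fromℚ q)))))

  ½^ : ℕ → ℚ
  ½^ zero    = 1ℚ
  ½^ (suc k) = ½^ k * ½

  0≤½^ : ∀ k → 0ℚ ≤ ½^ k
  0≤½^ zero    = <⇒≤ (positive⁻¹ 1ℚ)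
  0≤½^ (suc k) = 0≤* (0≤½^ k) (<⇒≤ (positive⁻¹ ½))

  ½^≤1 : ∀ k → ½^ k ≤ 1ℚ
  ½^≤1 zero    = ≤-refl
  ½^≤1 (suc k) = ≤-trans (*-mono {p = ½^ k} (<⇒≤ (positive⁻¹ 1ℚ)) (<⇒≤ (positive⁻¹ ½)) (½^≤1 k) ≤-refl) (*≤* (ℤ.+≤+ (ℕ.s≤s ℕ.z≤n)))

  term-½ : ∀ q k → term (½ * q) k ≡ ½^ k * term q k
  term-½ q zero    = refl
  term-½ q (suc k) = trans (cong (_* (½ * q * (+ 1 / suc k))) (term-½ q k))
    (solve 5 (λ h p t q i → p :* t :* (h :* q :* i) := p :* h :* (t :* (q :* i))) refl ½ (½^ k) (term q k) q (+ 1 / suc k))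

  -- The stretch ends at 2n because the band between triangle and square in `excess≤` does.
  Tail : ℚ → ℕ → ℚ
  Tail q n = Σ< (term q) (n ℕ.+ n) - Σ< (term q) n

  -- The k-th term of the exponential series at q / 2 is (½)ᵏ times the one at q.
  geometric-tail : ∀ q ε N → (∀ n → N ℕ.≤ n → ∣ term q n ∣ ≤ ε) → ∀ {m n} → N ℕ.≤ n → n ℕ.≤ m →
    ∣ Σ< (term (½ * q)) m - Σ< (term (½ * q)) n ∣ ≤ ε * (½^ n + ½^ n) - ε * (½^ m + ½^ m)
  geometric-tail q ε N h {n = n} N≤n n≤m = go (ℕ.≤⇒≤′ n≤m)
    where
    T : ℕ → ℚ
    T = Σ< (term (½ * q))
    go : ∀ {m} → n ℕ.≤′ m → ∣ T m - T n ∣ ≤ ε * (½^ n + ½^ n) - ε * (½^ m + ½^ m)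
    go ℕ.≤′-refl = ≤-reflexive (trans (cong ∣_∣ (+-inverseʳ (T n))) (sym (+-inverseʳ (ε * (½^ n + ½^ n)))))
    go (ℕ.≤′-step {m} n≤′m) = begin
      ∣ T m + term (½ * q) m - T n ∣
        ≡⟨ cong ∣_∣ (solve 3 (λ x y z → x :+ z :- y := x :- y :+ z) refl (T m) (T n) (term (½ * q) m)) ⟩
      ∣ T m - T n + term (½ * q) m ∣
        ≤⟨ ∣+∣≤ (T m - T n) (term (½ * q) m) (go n≤′m) term≤ ⟩
      ε * (½^ n + ½^ n) - ε * (½^ m + ½^ m) + ½^ m * ε
        ≡⟨ solve 3 (λ e a b → e :* (a :+ a) :- e :* (b :+ b) :+ b :* e := e :* (a :+ a) :- e :* (b :* con ½ :+ b :* con ½)) refl ε (½^ n) (½^ m) ⟩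
      ε * (½^ n + ½^ n) - ε * (½^ (suc m) + ½^ (suc m)) ∎
      where
      open ≤-Reasoning
      term≤ : ∣ term (½ * q) m ∣ ≤ ½^ m * ε
      term≤ = subst (λ p → ∣ p ∣ ≤ ½^ m * ε) (sym (term-½ q m))
        (∣*∣≤ (½^ m) (term q m) (≤-reflexive (0≤p⇒∣p∣≡p (0≤½^ m))) (h m (ℕ.≤-trans N≤n (ℕ.≤′⇒≤ n≤′m))))

  Tail-½≤ : ∀ q ε N → 0ℚ < ε → (∀ n → N ℕ.≤ n → ∣ term q n ∣ ≤ ½ * ε) → ∀ n → N ℕ.≤ n → ∣ Tail (½ * q) n ∣ ≤ ε
  Tail-½≤ q ε N 0<ε h n N≤n = ≤-trans (geometric-tail q (½ * ε) N h N≤n (ℕ.m≤m+n n n)) (bound (½^ n) (½^ (n ℕ.+ n)) (½^≤1 n) (0≤½^ (n ℕ.+ n)))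
    where
    open ≤-Reasoning
    bound : ∀ x y → x ≤ 1ℚ → 0ℚ ≤ y → ½ * ε * (x + x) - ½ * ε * (y + y) ≤ ε
    bound x y x≤1 0≤y = begin
      ½ * ε * (x + x) - ½ * ε * (y + y)
        ≡⟨ solve 3 (λ e x y → con ½ :* e :* (x :+ x) :- con ½ :* e :* (y :+ y) := e :* (x :- y)) refl ε x y ⟩
      ε * (x - y)
        ≤⟨ mulˡ ε (<⇒≤ 0<ε) (+-mono-≤ x≤1 (neg-antimono-≤ 0≤y)) ⟩
      ε * 1ℚ
        ≡⟨ *-identityʳ ε ⟩
      ε ∎

  -- That the terms tend to zero does not bound their sum. Writing `q` as half of `q + q` supplies a
  -- geometric factor.
  Tail-null : ∀ q → Null (Tail q)
  Tail-null q = subst (λ p → Null (Tail p)) (trans (*-distribˡ-+ ½ q q) (halves q)) null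
    where
    null : Null (Tail (½ * (q + q)))
    null = mkNull λ ε 0<ε →
      let N , h = small (term-null (q + q)) (½ * ε) (0<½* 0<ε)
      in N , Tail-½≤ (q + q) ε N 0<ε h

  ∣term∣≤ : ∀ {x X} → ∣ x ∣ ≤ X → ∀ k → ∣ term x k ∣ ≤ term X k
  ∣term∣≤ x≤X zero    = ≤-refl
  ∣term∣≤ {x} {X} x≤X (suc k) = ∣*∣≤ (term x k) (x * (+ 1 / suc k)) (∣term∣≤ x≤X k)
    (∣*∣≤ x (+ 1 / suc k) x≤X (≤-reflexive (0≤p⇒∣p∣≡p (nonNegative⁻¹ (+ 1 / suc k) {{normalize-nonNeg 1 (suc k)}}))))

  ∣coeff*term∣≤ : ∀ (a : ℕ → ℚ) → (∀ k → ∣ a k ∣ ≤ 1ℚ) → ∀ {x X} → ∣ x ∣ ≤ X → ∀ k → ∣ a k * term x k ∣ ≤ term X k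
  ∣coeff*term∣≤ a a≤1 {x} {X} x≤X k = subst (∣ a k * term x k ∣ ≤_) (*-identityˡ (term X k)) (∣*∣≤ (a k) (term x k) (a≤1 k) (∣term∣≤ x≤X k))

  -- One argument for both formulas: cosine takes cos, cos, -sin, sin with result cos, and sine
  -- takes sin, cos, cos, sin with result sin.
  module Addition (a b c d e : ℕ → ℚ)
    (a≤1 : ∀ k → ∣ a k ∣ ≤ 1ℚ) (b≤1 : ∀ k → ∣ b k ∣ ≤ 1ℚ) (c≤1 : ∀ k → ∣ c k ∣ ≤ 1ℚ) (d≤1 : ∀ k → ∣ d k ∣ ≤ 1ℚ)
    (coefficients : ∀ i j → a i * b j + c i * d j ≡ e (i ℕ.+ j)) where

    defect : ℚ → ℚ → ℕ → ℚ
    defect x y n = partialSum a x n * partialSum b y n + partialSum c x n * partialSum d y n - partialSum e (x + y) n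

    _◂_ : (ℕ → ℚ) → (ℕ → ℚ) → ℕ → ℚ
    (w ◂ u) k = w k * u k

    defect≡ : ∀ x y n → defect x y n ≡ excess (a ◂ term x) (b ◂ term y) n n + excess (c ◂ term x) (d ◂ term y) n n
    defect≡ x y n = begin
      partialSum a x n * partialSum b y n + partialSum c x n * partialSum d y n - partialSum e (x + y) n
        ≡⟨ cong₂ _-_ (cong₂ _+_ (cong₂ _*_ (partialSum≡Σ< a x n) (partialSum≡Σ< b y n)) (cong₂ _*_ (partialSum≡Σ< c x n) (partialSum≡Σ< d y n))) sum-e ⟩
      A * B + C * D - (P + Q)
        ≡⟨ solve 6 (λ A B C D P Q → A :* B :+ C :* D :- (P :+ Q) := (A :* B :- P) :+ (C :* D :- Q)) refl A B C D P Q ⟩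
      (A * B - P) + (C * D - Q) ∎
      where
      open ≡-Reasoning
      A B C D P Q : ℚ
      A = Σ< (a ◂ term x) n
      B = Σ< (b ◂ term y) n
      C = Σ< (c ◂ term x) n
      D = Σ< (d ◂ term y) n
      P = Σ< ((a ◂ term x) ⋆ (b ◂ term y)) n
      Q = Σ< ((c ◂ term x) ⋆ (d ◂ term y)) n
      sum-e : partialSum e (x + y) n ≡ P + Q
      sum-e = begin
        partialSum e (x + y) n
          ≡⟨ partialSum≡Σ< e (x + y) n ⟩
        Σ< (e ◂ term (x + y)) n
          ≡⟨ Σ<-cong (λ k → trans (cong (e k *_) (term-+ x y k))
               (sym (⋆-coefficients a b c d e (term x) (term y) coefficients k))) n ⟩
        Σ< (λ k → ((a ◂ term x) ⋆ (b ◂ term y)) k + ((c ◂ term x) ⋆ (d ◂ term y)) k) n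
          ≡⟨ Σ<-+ _ _ n ⟩
        P + Q ∎

    -- The bound depends on `x` and `y` only through `X` and `Y`. This uniformity is what matters:
    -- in the diagonal sequence of `cos x` the argument `seq x n` moves together with the truncation
    -- `n`.
    ∣defect∣≤ : ∀ {x y X Y} → ∣ x ∣ ≤ X → ∣ y ∣ ≤ Y → ∀ n → ∣ defect x y n ∣ ≤ Tail (X + Y) n + Tail (X + Y) n
    ∣defect∣≤ {x} {y} {X} {Y} x≤X y≤Y n = subst (λ p → ∣ p ∣ ≤ Tail (X + Y) n + Tail (X + Y) n) (sym (defect≡ x y n))
      (∣+∣≤ (excess (a ◂ term x) (b ◂ term y) n n) (excess (c ◂ term x) (d ◂ term y) n n) (bound a b a≤1 b≤1) (bound c d c≤1 d≤1))
      where
      bound : ∀ (v w : ℕ → ℚ) → (∀ k → ∣ v k ∣ ≤ 1ℚ) → (∀ k → ∣ w k ∣ ≤ 1ℚ) → ∣ excess (v ◂ term x) (w ◂ term y) n n ∣ ≤ Tail (X + Y) n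
      bound v w v≤1 w≤1 = subst (∣ excess (v ◂ term x) (w ◂ term y) n n ∣ ≤_)
        (sym (cong₂ _-_ (Σ<-cong (term-+ X Y) (n ℕ.+ n)) (Σ<-cong (term-+ X Y) n)))
        (excess≤ (v ◂ term x) (w ◂ term y) (term X) (term Y) (∣coeff*term∣≤ v v≤1 x≤X) (∣coeff*term∣≤ w w≤1 y≤Y) n)

    defect-null : ∀ {f g} → Bounded f → Bounded g → Null (λ n → defect (f n) (g n) n)
    defect-null (mkBounded {X} {M} _ hf) (mkBounded {Y} {N} _ hg) =
      null-squeeze {N = M ℕ.⊔ N}
        (λ n ≤n → ∣defect∣≤ (hf n (ℕ.m⊔n≤o⇒m≤o M N ≤n)) (hg n (ℕ.m⊔n≤o⇒n≤o M N ≤n)) n)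
        (null-+ (Tail-null (X + Y)) (Tail-null (X + Y)))

  ∣cosCoeff∣≤1 : ∀ k → ∣ cosCoeff k ∣ ≤ 1ℚ
  ∣cosCoeff∣≤1 k = subst₂ _≤_ (+-identityʳ _) (∣cosCoeff∣+∣sinCoeff∣ k) (+-monoʳ-≤ ∣ cosCoeff k ∣ (0≤∣p∣ (sinCoeff k)))

  ∣sinCoeff∣≤1 : ∀ k → ∣ sinCoeff k ∣ ≤ 1ℚ
  ∣sinCoeff∣≤1 k = bound (∣cosCoeff∣+∣sinCoeff∣ k)
    where
    bound : ∣ cosCoeff k ∣ + ∣ sinCoeff k ∣ ≡ 1ℚ → ∣ sinCoeff k ∣ ≤ 1ℚ
    bound eq = subst₂ _≤_ (+-identityˡ _) eq (+-monoˡ-≤ ∣ sinCoeff k ∣ (0≤∣p∣ (cosCoeff k)))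

  -- The addition formulas at quarter turns: `cosCoeff k` and `sinCoeff k` are cos (kπ/2) and sin
  -- (kπ/2).
  cosCoeff-+ : ∀ i j → cosCoeff i * cosCoeff j + (- sinCoeff i) * sinCoeff j ≡ cosCoeff (i ℕ.+ j)
  sinCoeff-+ : ∀ i j → sinCoeff i * cosCoeff j + cosCoeff i * sinCoeff j ≡ sinCoeff (i ℕ.+ j)
  cosCoeff-+ zero    j = solve 2 (λ c s → con 1ℚ :* c :+ (:- con 0ℚ) :* s := c) refl (cosCoeff j) (sinCoeff j)
  cosCoeff-+ (suc i) j = trans
    (solve 4 (λ c s c′ s′ → (:- s) :* c′ :+ (:- c) :* s′ := :- (s :* c′ :+ c :* s′)) refl (cosCoeff i) (sinCoeff i) (cosCoeff j) (sinCoeff j))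
    (cong -_ (sinCoeff-+ i j))
  sinCoeff-+ zero    j = solve 2 (λ c s → con 0ℚ :* c :+ con 1ℚ :* s := s) refl (cosCoeff j) (sinCoeff j)
  sinCoeff-+ (suc i) j = cosCoeff-+ i j

  partialSum-neg : ∀ a q n → partialSum (λ k → - a k) q n ≡ - partialSum a q n
  partialSum-neg a q zero    = refl
  partialSum-neg a q (suc n) = trans (cong (_+ (- a n) * term q n) (partialSum-neg a q n))
    (solve 3 (λ p a t → (:- p) :+ (:- a) :* t := :- (p :+ a :* t)) refl (partialSum a q n) (a n) (term q n))

  cos-+ : ∀ x y → Null (λ n → seq (cos x) n * seq (cos y) n - seq (sin x) n * seq (sin y) n - seq (cos (x +ℝ y)) n)
  cos-+ x y = null-≗ (λ n → cong (_- seq (cos (x +ℝ y)) n) (cong (_+_ (seq (cos x) n * seq (cos y) n))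
      (trans (neg-distribˡ-* (seq (sin x) n) (seq (sin y) n)) (cong (_* seq (sin y) n) (sym (partialSum-neg sinCoeff (seq x n) n))))))
    (Addition.defect-null cosCoeff cosCoeff (λ k → - sinCoeff k) sinCoeff cosCoeff ∣cosCoeff∣≤1 ∣cosCoeff∣≤1
      (λ k → subst (_≤ 1ℚ) (sym (∣-p∣≡∣p∣ (sinCoeff k))) (∣sinCoeff∣≤1 k)) ∣sinCoeff∣≤1 cosCoeff-+ (bounded-seq x) (bounded-seq y))

  sin-+ : ∀ x y → Null (λ n → seq (sin x) n * seq (cos y) n + seq (cos x) n * seq (sin y) n - seq (sin (x +ℝ y)) n)
  sin-+ x y = Addition.defect-null sinCoeff cosCoeff cosCoeff sinCoeff sinCoeff ∣sinCoeff∣≤1 ∣cosCoeff∣≤1 ∣cosCoeff∣≤1 ∣sinCoeff∣≤1 sinCoeff-+ (bounded-seq x) (bounded-seq y)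

-- Sine and cosine at rational multiples of π.

module PiMultiples where

  open CauchyProduct
  open Trigonometry
  open import Data.Rational.Base
  open import Data.Rational.Properties
  open import Data.Rational.Solver using (module +-*-Solver)
  open +-*-Solver using (solve; _:=_; _:+_; _:*_; _:-_; :-_; con)

  -- `C p` and `S p` stand for sequences with limits cos pπ and sin pπ. The fields are the
  -- properties from which all character values below are computed.
  record HalfTurns (C S : ℚ → ℕ → ℚ) : Set where
    field
      bounded-C : ∀ p → Bounded (C p)
      bounded-S : ∀ p → Bounded (S p)
      C-+       : ∀ p q → Null (λ n → C p n * C q n - S p n * S q n - C (p + q) n)
      S-+       : ∀ p q → Null (λ n → S p n * C q n + C p n * S q n - S (p + q) n)
      C-neg     : ∀ p n → C (- p) n ≡ C p n
      S-neg     : ∀ p n → S (- p) n ≡ - S p n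
      C-0       : Null (λ n → C 0ℚ n - 1ℚ)
      S-1       : Null (S 1ℚ)
      S-pos     : ∀ p → 0ℚ < p → p < 1ℚ → EventuallyPositive (S p)

  sgn : ℕ → ℚ
  sgn zero    = 1ℚ
  sgn (suc k) = - sgn k

  sgn-even : ∀ k → sgn (k ℕ.* 2) ≡ 1ℚ
  sgn-even zero    = refl
  sgn-even (suc k) = cong (λ p → - (- p)) (sgn-even k)

  sgn-odd : ∀ k → sgn (suc (k ℕ.* 2)) ≡ - 1ℚ
  sgn-odd k = cong -_ (sgn-even k)

  shift-ℕ : (X : ℚ → ℕ → ℚ) → (∀ p → Null (λ n → X (p + 1ℚ) n + X p n)) →
            ∀ k p → Null (λ n → X (p + fromℕ k) n - sgn k * X p n)
  shift-ℕ X h zero p = null-eventually 0 λ n _ →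
    trans (cong (λ r → X r n - 1ℚ * X p n) (+-identityʳ p))
          (solve 1 (λ x → x :- con 1ℚ :* x := con 0ℚ) refl (X p n))
  shift-ℕ X h (suc k) p = null-≗
    (λ n → trans (cong (λ r → X r n - sgn (suc k) * X p n) p+1+k)
                 (solve 4 (λ y x z s → y :- (:- s) :* x := (y :+ z) :- (z :- s :* x)) refl
                    (X ((p + fromℕ k) + 1ℚ) n) (X p n) (X (p + fromℕ k) n) (sgn k)))
    (null-- (h (p + fromℕ k)) (shift-ℕ X h k p))
    where
    p+1+k : p + fromℕ (suc k) ≡ (p + fromℕ k) + 1ℚ
    p+1+k = trans (cong (_+_ p) (fromℕ-suc k)) (sym (+-assoc p (fromℕ k) 1ℚ))

  ⅓ : ℚ
  ⅓ = + 1 / 3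

  module _ {C S : ℚ → ℕ → ℚ} (turns : HalfTurns C S) where

    open HalfTurns turns

    pythagoras : ∀ p → Null (λ n → C p n * C p n + S p n * S p n - 1ℚ)
    pythagoras p = null-≗ (λ n → identity n (C-neg p n) (S-neg p n) (cong (λ q → C q n) (+-inverseʳ p)))
      (null-+ (C-+ p (- p)) C-0)
      where
      identity : ∀ n → C (- p) n ≡ C p n → S (- p) n ≡ - S p n → C (p - p) n ≡ C 0ℚ n →
        C p n * C p n + S p n * S p n - 1ℚ ≡ (C p n * C (- p) n - S p n * S (- p) n - C (p - p) n) + (C 0ℚ n - 1ℚ)
      identity n ec es e0 = trans
        (solve 3 (λ c s z → c :* c :+ s :* s :- con 1ℚ := (c :* c :- s :* (:- s) :- z) :+ (z :- con 1ℚ)) refl (C p n) (S p n) (C 0ℚ n))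
        (cong (_+ (C 0ℚ n - 1ℚ)) (sym (cong₂ _-_ (cong₂ _-_ (cong (C p n *_) ec) (cong (S p n *_) es)) e0)))

    -- From 0 = sin π = 2 sin (π/2) cos (π/2), where sin (π/2) is positive.
    C-½ : Null (C ½)
    C-½ = null-cancel (S-pos ½ (positive⁻¹ ½) (*<* (ℤ.+<+ (ℕ.s≤s (ℕ.s≤s ℕ.z≤n)))))
      (null-≗ (λ n → solve 3 (λ c s t → s :* c := ((s :* c :+ c :* s :- t) :+ t) :* con ½) refl (C ½ n) (S ½ n) (S 1ℚ n))
        (null-* (null-+ (S-+ ½ ½) S-1) (bounded-const ½)))

    -- The formula cos 2t = 2 cos² t - 1 at t = π/2.
    C-1 : Null (λ n → C 1ℚ n + 1ℚ)
    C-1 = null-≗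
      (λ n → solve 3 (λ c s d → d :+ con 1ℚ := c :* c :+ c :* c :- ((c :* c :- s :* s :- d) :+ (c :* c :+ s :* s :- con 1ℚ))) refl (C ½ n) (S ½ n) (C 1ℚ n))
      (null-- (null-+ C½² C½²) (null-+ (C-+ ½ ½) (pythagoras ½)))
      where
      C½² : Null (λ n → C ½ n * C ½ n)
      C½² = null-* C-½ (bounded-C ½)

    C-shift : ∀ p → Null (λ n → C (p + 1ℚ) n + C p n)
    C-shift p = null-≗
      (λ n → solve 5 (λ c s c₁ s₁ d → d :+ c := ((c₁ :+ con 1ℚ) :* c :- s₁ :* s) :- (c :* c₁ :- s :* s₁ :- d)) refl
               (C p n) (S p n) (C 1ℚ n) (S 1ℚ n) (C (p + 1ℚ) n))
      (null-- (null-- (null-* C-1 (bounded-C p)) (null-* S-1 (bounded-S p))) (C-+ p 1ℚ))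

    S-shift : ∀ p → Null (λ n → S (p + 1ℚ) n + S p n)
    S-shift p = null-≗
      (λ n → solve 5 (λ c s c₁ s₁ d → d :+ s := ((c₁ :+ con 1ℚ) :* s :+ s₁ :* c) :- (s :* c₁ :+ c :* s₁ :- d)) refl
               (C p n) (S p n) (C 1ℚ n) (S 1ℚ n) (S (p + 1ℚ) n))
      (null-- (null-+ (null-* C-1 (bounded-S p)) (null-* S-1 (bounded-C p))) (S-+ p 1ℚ))

    C-shift-ℕ : ∀ k p → Null (λ n → C (p + fromℕ k) n - sgn k * C p n)
    C-shift-ℕ = shift-ℕ C C-shift

    S-shift-ℕ : ∀ k p → Null (λ n → S (p + fromℕ k) n - sgn k * S p n)
    S-shift-ℕ = shift-ℕ S S-shift

    S-0 : Null (S 0ℚ)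
    S-0 = null-≗
      (λ n → solve 2 (λ s t → s := (t :+ s) :- t) refl (S 0ℚ n) (S 1ℚ n)) (null-- (S-shift 0ℚ) S-1)

    -- sin 3t = (4 cos² t - 1) sin t, which vanishes at t = π / 3 although sin t does not.
    4C⅓²-1 : Null (λ n → C ⅓ n * C ⅓ n * (1ℚ + 1ℚ + 1ℚ + 1ℚ) - 1ℚ)
    4C⅓²-1 = null-cancel (S-pos ⅓ (positive⁻¹ ⅓) (*<* (ℤ.+<+ (ℕ.s≤s (ℕ.s≤s ℕ.z≤n)))))
      (null-≗ (λ n → solve 5 (λ c s c₂ s₂ t → s :* (c :* c :* (con 1ℚ :+ con 1ℚ :+ con 1ℚ :+ con 1ℚ) :- con 1ℚ)
                        := t :+ ((s :* c₂ :+ c :* s₂ :- t) :+ (((c :* c :+ s :* s :- con 1ℚ) :* s :+ (c :* c :- s :* s :- c₂) :* s)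
                           :+ (s :* c :+ c :* s :- s₂) :* c))) refl
                        (C ⅓ n) (S ⅓ n) (C (⅓ + ⅓) n) (S (⅓ + ⅓) n) (S 1ℚ n))
        (null-+ S-1 (null-+ (S-+ ⅓ (⅓ + ⅓)) (null-+ (null-+ (null-* (pythagoras ⅓) (bounded-S ⅓)) (null-* (C-+ ⅓ ⅓) (bounded-S ⅓)))
          (null-* (S-+ ⅓ ⅓) (bounded-C ⅓))))))

    -- The formula cos 2t = 2 cos² t - 1 at t = π/3, where cos² t = 1/4.
    C-⅔ : Null (λ n → C (+ 2 / 3) n + ½)
    C-⅔ = null-≗
      (λ n → solve 3 (λ c s c₂ → c₂ :+ con ½ := (c :* c :* (con 1ℚ :+ con 1ℚ :+ con 1ℚ :+ con 1ℚ) :- con 1ℚ) :* con ½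
                                   :- ((c :* c :+ s :* s :- con 1ℚ) :+ (c :* c :- s :* s :- c₂))) refl
               (C ⅓ n) (S ⅓ n) (C (+ 2 / 3) n))
      (null-- (null-* 4C⅓²-1 (bounded-const ½)) (null-+ (pythagoras ⅓) (C-+ ⅓ ⅓)))

  private
    -- Cosine has only even powers and sine only odd ones. The two claims go together because the
    -- step from `k` to `suc k` interchanges the coefficients.
    parity : ∀ q k → cosCoeff k * term (- q) k ≡ cosCoeff k * term q k × sinCoeff k * term (- q) k ≡ - (sinCoeff k * term q k)
    parity q zero    = refl , refl
    parity q (suc k) =
        trans (solve 4 (λ s t q i → (:- s) :* (t :* ((:- q) :* i)) := s :* t :* (q :* i)) refl (sinCoeff k) (term (- q) k) q (+ 1 / suc k))
          (trans (cong (_* (q * (+ 1 / suc k))) (proj₂ (parity q k)))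
            (solve 4 (λ s t q i → (:- (s :* t)) :* (q :* i) := (:- s) :* (t :* (q :* i))) refl (sinCoeff k) (term q k) q (+ 1 / suc k)))
      , trans (solve 4 (λ c t q i → c :* (t :* ((:- q) :* i)) := :- (c :* t :* (q :* i))) refl (cosCoeff k) (term (- q) k) q (+ 1 / suc k))
          (trans (cong (λ z → - (z * (q * (+ 1 / suc k)))) (proj₁ (parity q k)))
            (solve 4 (λ c t q i → :- (c :* t :* (q :* i)) := :- (c :* (t :* (q :* i)))) refl (cosCoeff k) (term q k) q (+ 1 / suc k)))

  partialSum-cos-neg : ∀ q n → partialSum cosCoeff (- q) n ≡ partialSum cosCoeff q n
  partialSum-cos-neg q zero    = refl
  partialSum-cos-neg q (suc n) = cong₂ _+_ (partialSum-cos-neg q n) (proj₁ (parity q n))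

  partialSum-sin-neg : ∀ q n → partialSum sinCoeff (- q) n ≡ - partialSum sinCoeff q n
  partialSum-sin-neg q zero    = refl
  partialSum-sin-neg q (suc n) = trans (cong₂ _+_ (partialSum-sin-neg q n) (proj₂ (parity q n)))
    (sym (neg-distrib-+ (partialSum sinCoeff q n) (sinCoeff n * term q n)))

  partialSum-cos-0 : ∀ n → partialSum cosCoeff 0ℚ (suc n) ≡ 1ℚ
  partialSum-cos-0 zero    = refl
  partialSum-cos-0 (suc n) = trans (cong₂ _+_ (partialSum-cos-0 n) vanish) (+-identityʳ 1ℚ)
    where
    vanish : cosCoeff (suc n) * term 0ℚ (suc n) ≡ 0ℚ
    vanish = solve 3 (λ c t i → c :* (t :* (con 0ℚ :* i)) := con 0ℚ) refl (cosCoeff (suc n)) (term 0ℚ n) (+ 1 / suc n)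

  module _ (π : ℝ) (isPi : IsPi π) where

    open IsPi isPi

    cosπ sinπ : ℚ → ℕ → ℚ
    cosπ p = seq (cos (p · π))
    sinπ p = seq (sin (p · π))

    -- An eventual lower bound ε of π gives the gap p ε between 0 and p π and the gap (1 - p) ε
    -- between p π and π.
    sinπ-pos : ∀ p → 0ℚ < p → p < 1ℚ → EventuallyPositive (sinπ p)
    sinπ-pos p 0<p p<1 =
      let ε , 0<ε , N , h = positive-π
          0<1-p = subst (_< 1ℚ - p) (+-inverseʳ p) (+-monoˡ-< (- p) p<1)
          δ , 0<δ , M , g = sin-before (p · π)
            (p * ε , 0<* 0<p 0<ε , N , λ n N≤n → subst (_≤ p * seq π n) (sym (+-identityˡ (p * ε)))
              (mulˡ p (<⇒≤ 0<p) (subst (_≤ seq π n) (+-identityˡ ε) (h n N≤n))))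
            ((1ℚ - p) * ε , 0<* 0<1-p 0<ε , N , λ n N≤n → subst (p * seq π n + (1ℚ - p) * ε ≤_)
              (solve 2 (λ p x → p :* x :+ (con 1ℚ :- p) :* x := x) refl p (seq π n))
              (+-monoʳ-≤ (p * seq π n) (mulˡ (1ℚ - p) (<⇒≤ 0<1-p) (subst (_≤ seq π n) (+-identityˡ ε) (h n N≤n)))))
      in mkPositive 0<δ λ n M≤n → subst (_≤ sinπ p n) (+-identityˡ δ) (g n M≤n)

    halfTurns : HalfTurns cosπ sinπ
    halfTurns = record
      { bounded-C = λ p → bounded-seq (cos (p · π))
      ; bounded-S = λ p → bounded-seq (sin (p · π))
      ; C-+       = λ p q → null-≗ (λ n → cong (λ z → cosπ p n * cosπ q n - sinπ p n * sinπ q n - partialSum cosCoeff z n) (*-distribʳ-+ (seq π n) p q))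
                              (cos-+ (p · π) (q · π))
      ; S-+       = λ p q → null-≗ (λ n → cong (λ z → sinπ p n * cosπ q n + cosπ p n * sinπ q n - partialSum sinCoeff z n) (*-distribʳ-+ (seq π n) p q))
                              (sin-+ (p · π) (q · π))
      ; C-neg     = λ p n → trans (cong (λ z → partialSum cosCoeff z n) (sym (neg-distribˡ-* p (seq π n)))) (partialSum-cos-neg (p * seq π n) n)
      ; S-neg     = λ p n → trans (cong (λ z → partialSum sinCoeff z n) (sym (neg-distribˡ-* p (seq π n)))) (partialSum-sin-neg (p * seq π n) n)
      -- The partial sums at 0 equal 1 from index 1 on; the empty sum at index 0 is 0.
      ; C-0       = null-eventually 1 λ { (suc n) _ → trans (cong (λ z → partialSum cosCoeff z (suc n) - 1ℚ) (*-zeroˡ (seq π (suc n))))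
                      (cong (_- 1ℚ) (partialSum-cos-0 n)) }
      ; S-1       = null-≗ (λ n → trans (cong (λ z → partialSum sinCoeff z n) (*-identityˡ (seq π n))) (sym (+-identityʳ (seq (sin π) n)))) (mkNull sin-π)
      ; S-pos     = sinπ-pos
      }

-- Integer-valued periodic functions: translations, norm and descent.

module PeriodicFunctions where

  open import Algebra.Properties.AbelianGroup ℤ.+-0-abelianGroup using () renaming (∙-cancelʳ to +-cancelʳ)
  open import Data.Integer.Base using (_+_; _*_; _-_; -_; 0ℤ)

  *-zero-cancel : ∀ k x → + suc k * x ≡ 0ℤ → x ≡ 0ℤ
  *-zero-cancel k x eq with ℤ.i*j≡0⇒i≡0∨j≡0 (+ suc k) eq
  ... | inj₂ x≡0 = x≡0

  Zero : (ℤ → ℤ) → Set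
  Zero F = ∀ z → F z ≡ 0ℤ

  -- Functions on ℤ/n are kept as functions on ℤ, so that several periods of one function can be
  -- compared.
  Period AntiPeriod : ℕ → (ℤ → ℤ) → Set
  Period s F = ∀ z → F (z + + s) ≡ F z
  AntiPeriod s F = ∀ z → F (z + + s) ≡ - F z

  period-back : ∀ {s F} → Period s F → ∀ z → F (z - + s) ≡ F z
  period-back {s} {F} per z = trans (sym (per (z - + s))) (cong F (identity z (+ s)))
    where
    identity : ∀ z s → z - s + s ≡ z
    identity = ℤ-Solver.solve-∀

  period-* : ∀ {s F} → Period s F → ∀ k → Period (k ℕ.* s) F
  period-* {F = F} per zero    z = cong F (ℤ.+-identityʳ z)
  period-* {s} {F} per (suc k) z = trans (cong F (sym (ℤ.+-assoc z (+ s) (+ (k ℕ.* s))))) (trans (period-* per k (z + + s)) (per z))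

  period-ℤ : ∀ {s F} → Period s F → ∀ q z → F (z + q * + s) ≡ F z
  period-ℤ {s} {F} per (+ q)    z = trans (cong (λ t → F (z + t)) (sym (ℤ.pos-* q s))) (period-* per q z)
  period-ℤ {s} {F} per -[1+ q ] z = trans
    (cong (λ t → F (z + t)) (trans (sym (ℤ.neg-distribˡ-* (+ suc q) (+ s))) (cong -_ (sym (ℤ.pos-* (suc q) s)))))
    (period-back {suc q ℕ.* s} (period-* per (suc q)) z)

  period-+ : ∀ {s t F} → Period s F → Period t F → Period (s ℕ.+ t) F
  period-+ {s} {t} {F} ps pt z = trans (cong F (sym (ℤ.+-assoc z (+ s) (+ t)))) (trans (pt (z + + s)) (ps z))

  period-anti : ∀ {s t F} → Period s F → AntiPeriod t F → AntiPeriod (s ℕ.+ t) F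
  period-anti {s} {t} {F} ps at z = trans (cong F (sym (ℤ.+-assoc z (+ s) (+ t)))) (trans (at (z + + s)) (cong -_ (ps z)))

  anti-anti : ∀ {s F} → AntiPeriod s F → Period (2 ℕ.* s) F
  anti-anti {s} {F} anti z = begin
    F (z + + (2 ℕ.* s))    ≡⟨ cong (λ t → F (z + + t)) (cong (s ℕ.+_) (ℕ.+-identityʳ s)) ⟩
    F (z + + (s ℕ.+ s))    ≡⟨ cong F (ℤ.+-assoc z (+ s) (+ s)) ⟨
    F (z + + s + + s)      ≡⟨ anti (z + + s) ⟩
    - F (z + + s)          ≡⟨ cong -_ (anti z) ⟩
    - (- F z)              ≡⟨ ℤ.neg-involutive (F z) ⟩
    F z                    ∎
    where open ≡-Reasoning

  period∧anti⇒zero : ∀ {s F} → Period s F → AntiPeriod s F → Zero F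
  period∧anti⇒zero {s} {F} per anti z = *-zero-cancel 1 (F z) (trans (double (F z)) (trans (cong (_+ F z) (trans (sym (per z)) (anti z))) (ℤ.+-inverseˡ (F z))))
    where
    double : ∀ x → + 2 * x ≡ x + x
    double = ℤ-Solver.solve-∀

  Σ< : (ℤ → ℤ) → ℕ → ℤ
  Σ< F zero    = 0ℤ
  Σ< F (suc n) = Σ< F n + F (+ n)

  Σ<-cong : ∀ {F G} → F ≗ G → ∀ n → Σ< F n ≡ Σ< G n
  Σ<-cong F≗G zero    = refl
  Σ<-cong F≗G (suc n) = cong₂ _+_ (Σ<-cong F≗G n) (F≗G (+ n))

  Σ<-+ : ∀ F G n → Σ< (λ z → F z + G z) n ≡ Σ< F n + Σ< G n
  Σ<-+ F G zero    = refl
  Σ<-+ F G (suc n) = trans (cong (_+ (F (+ n) + G (+ n))) (Σ<-+ F G n)) (identity (Σ< F n) (Σ< G n) (F (+ n)) (G (+ n)))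
    where
    identity : ∀ a b c d → a + b + (c + d) ≡ a + c + (b + d)
    identity = ℤ-Solver.solve-∀

  -- Each shift by one trades the summand at 0 for the one at `n`, and these agree.
  Σ<-shift : ∀ n F → Period n F → ∀ s → Σ< (λ z → F (z + + s)) n ≡ Σ< F n
  Σ<-shift n F per zero    = Σ<-cong (λ z → cong F (ℤ.+-identityʳ z)) n
  Σ<-shift n F per (suc s) = begin
    Σ< (λ z → F (z + + suc s)) n      ≡⟨ Σ<-cong (λ z → cong F (assoc z (+ s))) n ⟩
    Σ< (λ z → F (z + + s + + 1)) n    ≡⟨ Σ<-cong (λ z → cong F (swap z (+ s) (+ 1))) n ⟩
    Σ< (λ z → F (z + + 1 + + s)) n    ≡⟨ step (λ z → F (z + + s)) (λ z → trans (cong F (swap z (+ n) (+ s))) (per (z + + s))) ⟩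
    Σ< (λ z → F (z + + s)) n          ≡⟨ Σ<-shift n F per s ⟩
    Σ< F n                            ∎
    where
    open ≡-Reasoning
    assoc : ∀ z s → z + (+ 1 + s) ≡ z + s + + 1
    assoc = ℤ-Solver.solve-∀
    swap : ∀ z s t → z + s + t ≡ z + t + s
    swap = ℤ-Solver.solve-∀
    telescope : ∀ G k → Σ< (λ z → G (z + + 1)) k + G 0ℤ ≡ Σ< G k + G (+ k)
    telescope G zero    = refl
    telescope G (suc k) = begin
      Σ< (λ z → G (z + + 1)) k + G (+ k + + 1) + G 0ℤ  ≡⟨ swap (Σ< (λ z → G (z + + 1)) k) _ _ ⟩
      Σ< (λ z → G (z + + 1)) k + G 0ℤ + G (+ k + + 1)  ≡⟨ cong₂ _+_ (telescope G k) (cong G (ℤ.+-comm (+ k) (+ 1))) ⟩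
      Σ< G k + G (+ k) + G (+ suc k)                   ∎
    step : ∀ G → Period n G → Σ< (λ z → G (z + + 1)) n ≡ Σ< G n
    step G perG = +-cancelʳ (G 0ℤ) _ _ (trans (telescope G n)
      (cong (_+_ (Σ< G n)) (trans (cong G (sym (ℤ.+-identityˡ (+ n)))) (perG 0ℤ))))

  -- A natural number, since it is the measure of the descent in `RD-zero`.
  normSq : ℕ → (ℤ → ℤ) → ℕ
  normSq zero    F = 0
  normSq (suc n) F = normSq n F ℕ.+ ℤ.∣ F (+ n) ∣ ℕ.* ℤ.∣ F (+ n) ∣

  Σ<-square : ∀ n F → Σ< (λ z → F z * F z) n ≡ + normSq n F
  Σ<-square zero    F = refl
  Σ<-square (suc n) F = cong₂ _+_ (Σ<-square n F) (square (F (+ n)))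
    where
    square : ∀ x → x * x ≡ + (ℤ.∣ x ∣ ℕ.* ℤ.∣ x ∣)
    square (+ m)      = sym (ℤ.pos-* m m)
    square -[1+ m ]   = refl

  normSq≡0⇒zero : ∀ n F .{{_ : ℕ.NonZero n}} → Period n F → normSq n F ≡ 0 → Zero F
  normSq≡0⇒zero n F per eq z = trans (cong F (a≡a%ℕn+[a/ℕn]*n z n)) (trans (period-ℤ per (z /ℕ n) (+ (z %ℕ n))) (below n eq (n%ℕd<d z n)))
    where
    below : ∀ m → normSq m F ≡ 0 → ∀ {k} → k ℕ.< m → F (+ k) ≡ 0ℤ
    below (suc m) eq {k} (ℕ.s≤s k≤m) with ℕ.m≤n⇒m<n∨m≡n k≤m
    ... | inj₁ k<m  = below m (ℕ.m+n≡0⇒m≡0 (normSq m F) eq) k<m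
    ... | inj₂ refl with ℕ.m*n≡0⇒m≡0∨n≡0 (ℤ.∣ F (+ k) ∣) (ℕ.m+n≡0⇒n≡0 (normSq m F) eq)
    ...   | inj₁ e = ℤ.∣i∣≡0⇒i≡0 e
    ...   | inj₂ e = ℤ.∣i∣≡0⇒i≡0 e

  -- `A 1` and `A c` are the operators A and B. `P s` is 1 + T^s, and `Δ s` is its composition with
  -- the adjoint 1 + T^-s.
  Δ A P : ℕ → (ℤ → ℤ) → ℤ → ℤ
  A s F z = F (z + + s) + F (z - + s)
  Δ s F z = + 2 * F z + A s F z
  P s F z = F z + F (z + + s)

  R : (ℤ → ℤ) → ℤ → ℤ
  R F z = A 1 F z + F z

  private
    swap⁺⁺ : ∀ z s t → z + s + t ≡ z + t + s
    swap⁺⁺ = ℤ-Solver.solve-∀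
    swap⁻⁺ : ∀ z s t → z - s + t ≡ z + t - s
    swap⁻⁺ = ℤ-Solver.solve-∀
    swap⁻⁻ : ∀ z s t → z - s - t ≡ z - t - s
    swap⁻⁻ = ℤ-Solver.solve-∀
    cancel⁻⁺ : ∀ z s → z - s + s ≡ z
    cancel⁻⁺ = ℤ-Solver.solve-∀
    cancel⁺⁻ : ∀ z s → z + s - s ≡ z
    cancel⁺⁻ = ℤ-Solver.solve-∀

  A-cong : ∀ s {F G} → F ≗ G → A s F ≗ A s G
  A-cong s F≗G z = cong₂ _+_ (F≗G (z + + s)) (F≗G (z - + s))

  R-cong : ∀ {F G} → F ≗ G → R F ≗ R G
  R-cong F≗G z = cong₂ _+_ (A-cong 1 F≗G z) (F≗G z)

  R-zero : ∀ {F} → Zero F → Zero (R F)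
  R-zero zero-F z = cong₂ _+_ (cong₂ _+_ (zero-F (z + + 1)) (zero-F (z - + 1))) (zero-F z)

  A-+ : ∀ s F G z → A s (λ z → F z + G z) z ≡ A s F z + A s G z
  A-+ s F G z = identity (F (z + + s)) (G (z + + s)) (F (z - + s)) (G (z - + s))
    where
    identity : ∀ a b c d → a + b + (c + d) ≡ a + c + (b + d)
    identity = ℤ-Solver.solve-∀

  A-* : ∀ s k F z → A s (λ z → k * F z) z ≡ k * A s F z
  A-* s k F z = sym (ℤ.*-distribˡ-+ k (F (z + + s)) (F (z - + s)))

  A-comm : ∀ s t F → A s (A t F) ≗ A t (A s F)
  A-comm s t F z = trans
    (cong₂ _+_ (cong₂ _+_ (cong F (swap⁺⁺ z (+ s) (+ t))) (cong F (sym (swap⁻⁺ z (+ t) (+ s)))))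
               (cong₂ _+_ (cong F (swap⁻⁺ z (+ s) (+ t))) (cong F (swap⁻⁻ z (+ s) (+ t)))))
    (identity (F (z + + t + + s)) (F (z - + t + + s)) (F (z + + t - + s)) (F (z - + t - + s)))
    where
    identity : ∀ a b c d → a + b + (c + d) ≡ a + c + (b + d)
    identity = ℤ-Solver.solve-∀

  Δ-P-comm : ∀ s t F → Δ s (P t F) ≗ P t (Δ s F)
  Δ-P-comm s t F z = trans
    (cong₂ (λ p q → + 2 * (F z + F (z + + t)) + ((F (z + + s) + p) + (F (z - + s) + q)))
       (cong F (swap⁺⁺ z (+ s) (+ t))) (cong F (swap⁻⁺ z (+ s) (+ t))))
    (identity (F z) (F (z + + t)) (F (z + + s)) (F (z + + t + + s)) (F (z - + s)) (F (z + + t - + s)))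
    where
    identity : ∀ a b c d e f → + 2 * (a + b) + ((c + d) + (e + f)) ≡ (+ 2 * a + (c + e)) + (+ 2 * b + (d + f))
    identity = ℤ-Solver.solve-∀

  Δ≡P+P : ∀ s F z → Δ s F z ≡ P s F z + P s F (z - + s)
  Δ≡P+P s F z = trans (identity (F z) (F (z + + s)) (F (z - + s)))
    (cong (λ y → F z + F (z + + s) + (F (z - + s) + F y)) (sym (cancel⁻⁺ z (+ s))))
    where
    identity : ∀ a b c → + 2 * a + (b + c) ≡ a + b + (c + a)
    identity = ℤ-Solver.solve-∀

  period-map : ∀ {n F G s t} → Period n F → (∀ z → G z ≡ F (z + s) + F (z + t)) → Period n G
  period-map {n} {F} {G} {s} {t} per G≗ z = trans (G≗ (z + + n)) (trans
    (cong₂ _+_ (trans (cong F (swap⁺⁺ z (+ n) s)) (per (z + s))) (trans (cong F (swap⁺⁺ z (+ n) t)) (per (z + t))))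
    (sym (G≗ z)))

  period-A : ∀ {n F} s → Period n F → Period n (A s F)
  period-A s per = period-map {s = + s} {t = - + s} per (λ z → refl)

  period-P : ∀ {n F} s → Period n F → Period n (P s F)
  period-P {F = F} s per = period-map {s = 0ℤ} {t = + s} per (λ z → cong (λ y → F y + F (z + + s)) (sym (ℤ.+-identityʳ z)))

  period-sum : ∀ {n F G} → Period n F → Period n G → Period n (λ z → F z + G z)
  period-sum pF pG z = cong₂ _+_ (pF z) (pG z)

  period-scale : ∀ {n F} k → Period n F → Period n (λ z → k * F z)
  period-scale k per z = cong (k *_) (per z)

  period-R : ∀ {n F} → Period n F → Period n (R F)
  period-R per = period-sum (period-A 1 per) per

  module _ (n : ℕ) where

    inner : (ℤ → ℤ) → (ℤ → ℤ) → ℤ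
    inner F G = Σ< (λ z → F z * G z) n

    private
      ⟨_,_⟩ : (ℤ → ℤ) → (ℤ → ℤ) → ℤ
      ⟨_,_⟩ = inner

    ⟨⟩-congʳ : ∀ F {G H} → G ≗ H → ⟨ F , G ⟩ ≡ ⟨ F , H ⟩
    ⟨⟩-congʳ F G≗H = Σ<-cong (λ z → cong (F z *_) (G≗H z)) n

    ⟨⟩-+ʳ : ∀ F G H → ⟨ F , (λ z → G z + H z) ⟩ ≡ ⟨ F , G ⟩ + ⟨ F , H ⟩
    ⟨⟩-+ʳ F G H = trans (Σ<-cong (λ z → ℤ.*-distribˡ-+ (F z) (G z) (H z)) n) (Σ<-+ (λ z → F z * G z) (λ z → F z * H z) n)

    ⟨⟩-+ˡ : ∀ F G H → ⟨ (λ z → F z + G z) , H ⟩ ≡ ⟨ F , H ⟩ + ⟨ G , H ⟩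
    ⟨⟩-+ˡ F G H = trans (Σ<-cong (λ z → ℤ.*-distribʳ-+ (H z) (F z) (G z)) n) (Σ<-+ (λ z → F z * H z) (λ z → G z * H z) n)

    ⟨⟩-shift : ∀ {F G} → Period n F → Period n G → ∀ s → ⟨ (λ z → F (z + + s)) , (λ z → G (z + + s)) ⟩ ≡ ⟨ F , G ⟩
    ⟨⟩-shift {F} {G} pF pG s = Σ<-shift n (λ z → F z * G z) (λ z → cong₂ _*_ (pF z) (pG z)) s

    shift-adjoint : ∀ {F G} → Period n F → Period n G → ∀ s → ⟨ (λ z → F (z + + s)) , G ⟩ ≡ ⟨ F , (λ z → G (z - + s)) ⟩
    shift-adjoint {F} {G} pF pG s = trans
      (⟨⟩-congʳ (λ z → F (z + + s)) (λ z → cong G (sym (cancel⁺⁻ z (+ s)))))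
      (⟨⟩-shift {F} {λ z → G (z - + s)} pF (λ z → trans (cong G (swap⁺⁺ z (+ n) (- + s))) (pG (z - + s))) s)

    shift-adjoint⁻ : ∀ {F G} → Period n F → Period n G → ∀ s → ⟨ (λ z → F (z - + s)) , G ⟩ ≡ ⟨ F , (λ z → G (z + + s)) ⟩
    shift-adjoint⁻ {F} {G} pF pG s = trans
      (Σ<-cong (λ z → ℤ.*-comm (F (z - + s)) (G z)) n)
      (trans (sym (shift-adjoint {G} {F} pG pF s)) (Σ<-cong (λ z → ℤ.*-comm (G (z + + s)) (F z)) n))

    A-selfAdjoint : ∀ {F G} → Period n F → Period n G → ∀ s → ⟨ A s F , G ⟩ ≡ ⟨ F , A s G ⟩
    A-selfAdjoint {F} {G} pF pG s = begin
      ⟨ A s F , G ⟩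
        ≡⟨ ⟨⟩-+ˡ (λ z → F (z + + s)) (λ z → F (z - + s)) G ⟩
      ⟨ (λ z → F (z + + s)) , G ⟩ + ⟨ (λ z → F (z - + s)) , G ⟩
        ≡⟨ cong₂ _+_ (shift-adjoint pF pG s) (shift-adjoint⁻ pF pG s) ⟩
      ⟨ F , (λ z → G (z - + s)) ⟩ + ⟨ F , (λ z → G (z + + s)) ⟩
        ≡⟨ ℤ.+-comm ⟨ F , (λ z → G (z - + s)) ⟩ _ ⟩
      ⟨ F , (λ z → G (z + + s)) ⟩ + ⟨ F , (λ z → G (z - + s)) ⟩
        ≡⟨ ⟨⟩-+ʳ F (λ z → G (z + + s)) (λ z → G (z - + s)) ⟨
      ⟨ F , A s G ⟩ ∎
      where open ≡-Reasoning

    R-selfAdjoint : ∀ {F G} → Period n F → Period n G → ⟨ R F , G ⟩ ≡ ⟨ F , R G ⟩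
    R-selfAdjoint {F} {G} pF pG = trans (⟨⟩-+ˡ (A 1 F) F G)
      (trans (cong (_+ ⟨ F , G ⟩) (A-selfAdjoint pF pG 1)) (sym (⟨⟩-+ʳ F (A 1 G) G)))

    -- (1 + T)* (1 + T) = 2 + T + T⁻¹, where T is the translation by s.
    P-P : ∀ {F G} → Period n F → Period n G → ∀ s → ⟨ P s F , P s G ⟩ ≡ ⟨ F , Δ s G ⟩
    P-P {F} {G} pF pG s = begin
      ⟨ P s F , P s G ⟩
        ≡⟨ ⟨⟩-+ˡ F F⁺ (P s G) ⟩
      ⟨ F , P s G ⟩ + ⟨ F⁺ , P s G ⟩
        ≡⟨ cong (_+_ ⟨ F , P s G ⟩) (shift-adjoint pF (period-P s pG) s) ⟩
      ⟨ F , P s G ⟩ + ⟨ F , (λ z → P s G (z - + s)) ⟩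
        ≡⟨ ⟨⟩-+ʳ F (P s G) (λ z → P s G (z - + s)) ⟨
      ⟨ F , (λ z → P s G z + P s G (z - + s)) ⟩
        ≡⟨ ⟨⟩-congʳ F (Δ≡P+P s G) ⟨
      ⟨ F , Δ s G ⟩ ∎
      where
      open ≡-Reasoning
      F⁺ : ℤ → ℤ
      F⁺ z = F (z + + s)

    -- Combined with an adjunction such as ⟨R G, R G⟩ = ⟨G, R (R G)⟩, this shows that a self-adjoint
    -- operator has the same kernel as its square.
    zero-of-⟨⟩ : ∀ {F G H} .{{_ : ℕ.NonZero n}} → Period n F → ⟨ F , F ⟩ ≡ ⟨ H , G ⟩ → Zero G → Zero F
    zero-of-⟨⟩ {F} {G} {H} per eq zero-G = normSq≡0⇒zero n F per (ℤ.+-injective (trans (sym (Σ<-square n F)) (trans eq (vanish n))))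
      where
      vanish : ∀ m → Σ< (λ z → H z * G z) m ≡ 0ℤ
      vanish zero    = refl
      vanish (suc m) = cong₂ _+_ (vanish m) (trans (cong (H (+ m) *_) (zero-G (+ m))) (ℤ.*-zeroʳ (H (+ m))))

  -- The equation (2 + A + B) F = 0, grouped as A + (2 + B) because 2 + B = `Δ c` factors through
  -- `P c`.
  Harmonic : ℕ → (ℤ → ℤ) → Set
  Harmonic c F = ∀ z → A 1 F z + Δ c F z ≡ 0ℤ

  harmonic-A : ∀ c F → Harmonic c F → Harmonic c (A 1 F)
  harmonic-A c F har z = begin
    A 1 (A 1 F) z + (+ 2 * A 1 F z + A c (A 1 F) z)
      ≡⟨ cong (λ x → A 1 (A 1 F) z + (+ 2 * A 1 F z + x)) (A-comm c 1 F z) ⟩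
    A 1 (A 1 F) z + (+ 2 * A 1 F z + A 1 (A c F) z)
      ≡⟨ cong (λ x → A 1 (A 1 F) z + (x + A 1 (A c F) z)) (A-* 1 (+ 2) F z) ⟨
    A 1 (A 1 F) z + (A 1 (λ z → + 2 * F z) z + A 1 (A c F) z)
      ≡⟨ cong (_+_ (A 1 (A 1 F) z)) (A-+ 1 (λ z → + 2 * F z) (A c F) z) ⟨
    A 1 (A 1 F) z + A 1 (Δ c F) z
      ≡⟨ A-+ 1 (A 1 F) (Δ c F) z ⟨
    A 1 (λ z → A 1 F z + Δ c F z) z
      ≡⟨ cong₂ _+_ (har (z + + 1)) (har (z - + 1)) ⟩
    0ℤ ∎
    where open ≡-Reasoning

  harmonic-+ : ∀ c F G → Harmonic c F → Harmonic c G → Harmonic c (λ z → F z + G z)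
  harmonic-+ c F G hF hG z = trans
    (cong₂ _+_ (A-+ 1 F G z) (cong (_+_ (+ 2 * (F z + G z))) (A-+ c F G z)))
    (trans (identity (F z) (G z) (A 1 F z) (A 1 G z) (A c F z) (A c G z)) (cong₂ _+_ (hF z) (hG z)))
    where
    identity : ∀ f g a b p q → (a + b) + (+ 2 * (f + g) + (p + q)) ≡ (a + (+ 2 * f + p)) + (b + (+ 2 * g + q))
    identity = ℤ-Solver.solve-∀

  harmonic-* : ∀ c F k → Harmonic c F → Harmonic c (λ z → k * F z)
  harmonic-* c F k hF z = trans
    (cong₂ _+_ (A-* 1 k F z) (cong (_+_ (+ 2 * (k * F z))) (A-* c k F z)))
    (trans (identity k (F z) (A 1 F z) (A c F z)) (trans (cong (k *_) (hF z)) (ℤ.*-zeroʳ k)))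
    where
    identity : ∀ k f a p → k * a + (+ 2 * (k * f) + k * p) ≡ k * (a + (+ 2 * f + p))
    identity = ℤ-Solver.solve-∀

  harmonic-R : ∀ c F → Harmonic c F → Harmonic c (R F)
  harmonic-R c F har = harmonic-+ c (A 1 F) F (harmonic-A c F har) har

  -- The operator A (A + 2) = R² - 1.
  D : (ℤ → ℤ) → ℤ → ℤ
  D F z = A 1 (A 1 F) z + + 2 * A 1 F z

  D-R : ∀ F → D (R F) ≗ R (D F)
  D-R F z = begin
    A 1 (A 1 (R F)) z + + 2 * A 1 (R F) z
      ≡⟨ cong₂ (λ x y → x + + 2 * y) (trans (A-cong 1 (A-+ 1 (A 1 F) F) z) (A-+ 1 (A 1 (A 1 F)) (A 1 F) z)) (A-+ 1 (A 1 F) F z) ⟩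
    (a₃ + a₂) + + 2 * (a₂ + a₁)
      ≡⟨ identity a₁ a₂ a₃ ⟩
    (a₃ + + 2 * a₂) + (a₂ + + 2 * a₁)
      ≡⟨ cong (_+ (a₂ + + 2 * a₁)) (trans (A-+ 1 (A 1 (A 1 F)) (λ z → + 2 * A 1 F z) z) (cong (_+_ a₃) (A-* 1 (+ 2) (A 1 F) z))) ⟨
    R (D F) z ∎
    where
    open ≡-Reasoning
    a₁ a₂ a₃ : ℤ
    a₁ = A 1 F z
    a₂ = A 1 (A 1 F) z
    a₃ = A 1 (A 1 (A 1 F)) z
    identity : ∀ a b c → (c + b) + + 2 * (b + a) ≡ (c + + 2 * b) + (b + + 2 * a)
    identity = ℤ-Solver.solve-∀

  -- This is 2 + A applied to the harmonic equation.
  D+ΔΔ : ∀ c F → Harmonic c F → ∀ z → D F z + Δ 1 (Δ c F) z ≡ 0ℤ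
  D+ΔΔ c F har z = trans
    (identity (A 1 F z) (A 1 F (z + + 1)) (A 1 F (z - + 1)) (Δ c F z) (Δ c F (z + + 1)) (Δ c F (z - + 1)))
    (cong₂ _+_ (cong₂ _+_ (har (z + + 1)) (har (z - + 1))) (cong (+ 2 *_) (har z)))
    where
    identity : ∀ a a₊ a₋ g g₊ g₋ → ((a₊ + a₋) + + 2 * a) + (+ 2 * g + (g₊ + g₋)) ≡ ((a₊ + g₊) + (a₋ + g₋)) + + 2 * (a + g)
    identity = ℤ-Solver.solve-∀

  RR≡D+1 : ∀ F z → R (R F) z ≡ D F z + F z
  RR≡D+1 F z = trans (cong (_+ R F z) (A-+ 1 (A 1 F) F z)) (identity (F z) (A 1 F z) (A 1 (A 1 F) z))
    where
    identity : ∀ f a b → (b + a) + (a + f) ≡ (b + + 2 * a) + f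
    identity = ℤ-Solver.solve-∀

  module _ (n c : ℕ) .{{_ : ℕ.NonZero n}} where

    -- `split` is the identity 1 = R² + (2 + A) (2 + B) on solutions. Pairing it with `F` and moving
    -- one `R`, respectively the adjoint factor of each `Δ`, to the other side produces the squares.
    energy : ∀ {F} → Period n F → Harmonic c F → normSq n F ≡ normSq n (R F) ℕ.+ normSq n (P c (P 1 F))
    energy {F} per har = ℤ.+-injective (begin
      + normSq n F
        ≡⟨ Σ<-square n F ⟨
      inner n F F
        ≡⟨ ⟨⟩-congʳ n F split ⟩
      inner n F (λ z → R (R F) z + Δ 1 (Δ c F) z)
        ≡⟨ ⟨⟩-+ʳ n F (R (R F)) (Δ 1 (Δ c F)) ⟩
      inner n F (R (R F)) + inner n F (Δ 1 (Δ c F))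
        ≡⟨ cong₂ _+_ (sym (R-selfAdjoint n per (period-R per))) (sym (P-P n per perΔ 1)) ⟩
      inner n (R F) (R F) + inner n (P 1 F) (P 1 (Δ c F))
        ≡⟨ cong (_+_ (inner n (R F) (R F))) (⟨⟩-congʳ n (P 1 F) (Δ-P-comm c 1 F)) ⟨
      inner n (R F) (R F) + inner n (P 1 F) (Δ c (P 1 F))
        ≡⟨ cong (_+_ (inner n (R F) (R F))) (P-P n (period-P 1 per) (period-P 1 per) c) ⟨
      inner n (R F) (R F) + inner n (P c (P 1 F)) (P c (P 1 F))
        ≡⟨ cong₂ _+_ (Σ<-square n (R F)) (Σ<-square n (P c (P 1 F))) ⟩
      + normSq n (R F) + + normSq n (P c (P 1 F)) ∎)
      where
      open ≡-Reasoning
      perΔ : Period n (Δ c F)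
      perΔ = period-sum (period-scale (+ 2) per) (period-A c per)
      split : ∀ z → F z ≡ R (R F) z + Δ 1 (Δ c F) z
      split z = sym (trans (cong (_+ Δ 1 (Δ c F) z) (RR≡D+1 F z))
        (trans (swap⁺⁺ (D F z) (F z) (Δ 1 (Δ c F) z)) (trans (cong (_+ F z) (D+ΔΔ c F har z)) (ℤ.+-identityˡ (F z)))))

    -- The case of equality in `energy`: (2 + A) (2 + B) F is built from values of `P c (P 1 F)`,
    -- and on solutions it is -A (A + 2) F.
    PP-zero⇒D-zero : ∀ F → Harmonic c F → Zero (P c (P 1 F)) → Zero (D F)
    PP-zero⇒D-zero F har zero-PP z = trans (sym (ℤ.+-identityʳ (D F z)))
      (trans (cong (_+_ (D F z)) (sym ΔΔ-zero)) (D+ΔΔ c F har z))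
      where
      P-zero : Zero (P 1 (Δ c F))
      P-zero z = trans (sym (Δ-P-comm c 1 F z)) (trans (Δ≡P+P c (P 1 F) z) (cong₂ _+_ (zero-PP z) (zero-PP (z - + c))))
      ΔΔ-zero : Δ 1 (Δ c F) z ≡ 0ℤ
      ΔΔ-zero = trans (Δ≡P+P 1 (Δ c F) z) (cong₂ _+_ (P-zero z) (P-zero (z - + 1)))

    period-D : ∀ {F} → Period n F → Period n (D F)
    period-D per = period-sum (period-A 1 (period-A 1 per)) (period-scale (+ 2) (period-A 1 per))

    -- The norm is a natural number, so it cannot decrease forever along F, R F, R (R F), …
    RD-zero : ∀ {F} → Period n F → Harmonic c F → Zero (R (D F))
    RD-zero {F} per har = go F per har (ℕ.<-wellFounded (normSq n F))
      where
      go : ∀ F → Period n F → Harmonic c F → Acc ℕ._<_ (normSq n F) → Zero (R (D F))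
      go F per har (acc rec) with normSq n (P c (P 1 F)) in eq
      ... | zero  = R-zero (PP-zero⇒D-zero F har (normSq≡0⇒zero n (P c (P 1 F)) (period-P c (period-P 1 per)) eq))
      -- The descent at `R F` yields `R (R (D F))` = 0, and self-adjointness strips off one `R`.
      ... | suc m = zero-of-⟨⟩ n {H = D F} (period-R (period-D per))
                      (R-selfAdjoint n (period-D per) (period-R (period-D per))) RRD-zero
        where
        smaller : normSq n (R F) ℕ.< normSq n F
        smaller = subst (normSq n (R F) ℕ.<_) (sym (trans (energy per har) (cong (normSq n (R F) ℕ.+_) eq))) (ℕ.m<m+n (normSq n (R F)) ℕ.z<s)
        RRD-zero : Zero (R (R (D F)))
        RRD-zero z = trans (sym (R-cong (D-R F) z)) (go (R F) (period-R per) (harmonic-R c F har) (rec smaller) z)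

-- Solutions in the kernels of A, A + 1 and A + 2.

module Components where

  open import Data.Integer.Base using (_+_; _*_; _-_; -_; 0ℤ)
  open PeriodicFunctions

  period-cast : ∀ {s t F} → s ≡ t → Period s F → Period t F
  period-cast refl per = per

  anti-cast : ∀ {s t F} → s ≡ t → AntiPeriod s F → AntiPeriod t F
  anti-cast refl anti = anti

  period-cancel : ∀ {s t F} → Period s F → Period (s ℕ.+ t) F → Period t F
  period-cancel {s} {t} {F} ps pst z = trans (sym (ps (z + + t))) (trans (cong F (identity z (+ s) (+ t))) (pst z))
    where
    identity : ∀ z s t → z + t + s ≡ z + (s + t)
    identity = ℤ-Solver.solve-∀

  anti-even : ∀ {s F} → AntiPeriod s F → ∀ m → Period (m ℕ.* 2 ℕ.* s) F
  anti-even {s} anti m = period-cast (sym (ℕ.*-assoc m 2 s)) (period-* (anti-anti anti) m)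

  anti-odd : ∀ {s F} → AntiPeriod s F → ∀ m → AntiPeriod (suc (m ℕ.* 2) ℕ.* s) F
  anti-odd {s} anti m = anti-cast (ℕ.+-comm (m ℕ.* 2 ℕ.* s) s) (period-anti (anti-even anti m) anti)

  even∧odd⇒zero : ∀ {s t F} m k → m ℕ.* 2 ℕ.* s ≡ suc (k ℕ.* 2) ℕ.* t → AntiPeriod s F → AntiPeriod t F → Zero F
  even∧odd⇒zero m k eq as at = period∧anti⇒zero (period-cast eq (anti-even as m)) (anti-odd at k)

  -- Centred at `z + c`, the equation relates the ends `z` and `z + 2c`, where knowledge of T^(2c)
  -- can be substituted.
  harmonic-at : ∀ {c g} → Harmonic c g → ∀ z → A 1 g (z + + c) + (+ 2 * g (z + + c) + (g (z + + (c ℕ.+ c)) + g z)) ≡ 0ℤ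
  harmonic-at {c} {g} har z = trans
    (cong₂ (λ x y → A 1 g (z + + c) + (+ 2 * g (z + + c) + (x + y))) (cong g (sym (ℤ.+-assoc z (+ c) (+ c)))) (cong g (sym (identity z (+ c)))))
    (har (z + + c))
    where
    identity : ∀ z s → z + s - s ≡ z
    identity = ℤ-Solver.solve-∀

  -- If T^c fixes `g`, then B acts as 2 and the equation forces A = -4.
  harmonic-period : ∀ {c g} → Harmonic c g → Period c g → ∀ z → A 1 g z + + 4 * g z ≡ 0ℤ
  harmonic-period {c} {g} har per z = trans (cong (_+_ (A 1 g z)) (trans (identity (g z)) (cong (_+_ (+ 2 * g z)) (cong₂ _+_ (sym (per z)) (sym (period-back {c} {g} per z)))))) (har z)
    where
    identity : ∀ x → + 4 * x ≡ + 2 * x + (x + x)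
    identity = ℤ-Solver.solve-∀

  ends-zero : ∀ {c g} → Zero (λ z → g (z + + c)) → Zero g
  ends-zero {c} {g} h z = trans (cong g (sym (identity z (+ c)))) (h (z - + c))
    where
    identity : ∀ z s → z - s + s ≡ z
    identity = ℤ-Solver.solve-∀

  -- The norm of (1 + T) g is ⟨g, (2 + A) g⟩ = 0, so T g = -g and T^(2c) g = g. The equation centred
  -- at `z + c` then collapses to 2 g z = 0.
  A=-2⇒zero : ∀ n c {g} .{{_ : ℕ.NonZero n}} → Period n g → Harmonic c g → (∀ z → A 1 g z + + 2 * g z ≡ 0ℤ) → Zero g
  A=-2⇒zero n c {g} per har A=-2 z = *-zero-cancel 1 (g z) (begin
    + 2 * g z
      ≡⟨ identity (g z) (g (z + + c)) (A 1 g (z + + c)) ⟩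
    (A 1 g (z + + c) + (+ 2 * g (z + + c) + (g z + g z))) - (A 1 g (z + + c) + + 2 * g (z + + c))
      ≡⟨ cong₂ _-_ (trans (cong (λ x → A 1 g (z + + c) + (+ 2 * g (z + + c) + (x + g z))) (sym (period-2c z))) (harmonic-at {c} {g} har z)) (A=-2 (z + + c)) ⟩
    0ℤ ∎)
    where
    open ≡-Reasoning
    Δ-zero : Zero (Δ 1 g)
    Δ-zero z = trans (ℤ.+-comm (+ 2 * g z) (A 1 g z)) (A=-2 z)
    P-zero : Zero (P 1 g)
    P-zero = zero-of-⟨⟩ n {H = g} (period-P 1 per) (P-P n per per 1) Δ-zero
    flip : ∀ x y → x + y ≡ 0ℤ → y ≡ - x
    flip x y eq = trans (lemma x y) (trans (cong (_- x) eq) (ℤ.+-identityˡ (- x)))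
      where
      lemma : ∀ x y → y ≡ x + y - x
      lemma = ℤ-Solver.solve-∀
    period-2c : Period (c ℕ.+ c) g
    period-2c = period-cast (identityℕ c) (anti-even {1} (λ z → flip (g z) (g (z + + 1)) (P-zero z)) c)
      where
      identityℕ : ∀ c → c ℕ.* 2 ℕ.* 1 ≡ c ℕ.+ c
      identityℕ = ℕ-Solver.solve-∀
    identity : ∀ x y a → + 2 * x ≡ (a + (+ 2 * y + (x + x))) - (a + + 2 * y)
    identity = ℤ-Solver.solve-∀

  -- T² + T + 1 divides T³ - 1.
  R-zero⇒period-3 : ∀ {g} → Zero (R g) → Period 3 g
  R-zero⇒period-3 {g} Rg z = begin
    g (z + + 3)
      ≡⟨ cong g (sym (shift z)) ⟩
    g (z + + 2 + + 1)
      ≡⟨ identity (g z) (g (z + + 1)) (g (z + + 2)) (g (z + + 2 + + 1)) ⟩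
    ((g (z + + 2 + + 1) + g (z + + 1)) + g (z + + 2)) - ((g (z + + 2) + g z) + g (z + + 1)) + g z
      ≡⟨ cong (_+ g z) (cong₂ _-_ at-2 at-1) ⟩
    0ℤ + g z
      ≡⟨ ℤ.+-identityˡ (g z) ⟩
    g z ∎
    where
    open ≡-Reasoning
    shift : ∀ z → z + + 2 + + 1 ≡ z + + 3
    shift = ℤ-Solver.solve-∀
    down₁ : ∀ z → z + + 1 ≡ z + + 2 - + 1
    down₁ = ℤ-Solver.solve-∀
    up₁ : ∀ z → z + + 2 ≡ z + + 1 + + 1
    up₁ = ℤ-Solver.solve-∀
    down₀ : ∀ z → z ≡ z + + 1 - + 1
    down₀ = ℤ-Solver.solve-∀
    at-2 : (g (z + + 2 + + 1) + g (z + + 1)) + g (z + + 2) ≡ 0ℤ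
    at-2 = trans (cong (λ y → (g (z + + 2 + + 1) + g y) + g (z + + 2)) (down₁ z)) (Rg (z + + 2))
    at-1 : (g (z + + 2) + g z) + g (z + + 1) ≡ 0ℤ
    at-1 = trans (cong₂ (λ x y → (g x + g y) + g (z + + 1)) (up₁ z) (down₀ z)) (Rg (z + + 1))
    identity : ∀ a b c d → d ≡ ((d + b) + c) - ((c + a) + b) + a
    identity = ℤ-Solver.solve-∀

  -- Period 3 makes T^c trivial, so A = -4, whereas `R g` = 0 says A = -1.
  R-zero∧3∣c⇒zero : ∀ {g} q → Zero (R g) → Harmonic (q ℕ.* 3) g → Zero g
  R-zero∧3∣c⇒zero {g} q Rg har z = *-zero-cancel 2 (g z) (trans (identity (A 1 g z) (g z))
    (cong₂ _-_ (harmonic-period {q ℕ.* 3} {g} har (period-* (R-zero⇒period-3 Rg) q) z) (Rg z)))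
    where
    identity : ∀ a x → + 3 * x ≡ (a + + 4 * x) - (a + x)
    identity = ℤ-Solver.solve-∀

  R-zero∧period-1⇒zero : ∀ {g} → Zero (R g) → Period 1 g → Zero g
  R-zero∧period-1⇒zero {g} Rg per z = *-zero-cancel 2 (g z) (trans (identity (g z))
    (trans (cong (_+ g z) (cong₂ _+_ (sym (per z)) (sym (period-back {1} {g} per z)))) (Rg z)))
    where
    identity : ∀ x → + 3 * x ≡ x + x + x
    identity = ℤ-Solver.solve-∀

  -- The coprime periods 3 and `n` leave period 1, and on constants `R` is multiplication by 3.
  R-zero∧3∤n⇒zero : ∀ {n g} → Zero (R g) → Period n g → (∃ λ q → n ≡ q ℕ.* 3 ℕ.+ 1) ⊎ (∃ λ q → n ≡ q ℕ.* 3 ℕ.+ 2) → Zero g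
  R-zero∧3∤n⇒zero Rg per (inj₁ (q , refl)) =
    R-zero∧period-1⇒zero Rg (period-cancel {q ℕ.* 3} (period-* (R-zero⇒period-3 Rg) q) per)
  R-zero∧3∤n⇒zero Rg per (inj₂ (q , refl)) =
    R-zero∧period-1⇒zero Rg (period-cancel {2} (period-cancel {q ℕ.* 3} (period-* (R-zero⇒period-3 Rg) q) per) (R-zero⇒period-3 Rg))

  A-zero⇒anti-2 : ∀ {g} → Zero (A 1 g) → AntiPeriod 2 g
  A-zero⇒anti-2 {g} Ag z = trans (identity (g (z + + 2)) (g z)) (trans (cong (_- g z) (trans (cong₂ (λ x y → g x + g y) (up z) (down z)) (Ag (z + + 1)))) (ℤ.+-identityˡ (- g z)))
    where
    identity : ∀ x y → x ≡ (x + y) - y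
    identity = ℤ-Solver.solve-∀
    up : ∀ z → z + + 2 ≡ z + + 1 + + 1
    up = ℤ-Solver.solve-∀
    down : ∀ z → z ≡ z + + 1 - + 1
    down = ℤ-Solver.solve-∀

  -- Covers all pairs except c ≡ 2, h ≡ 0 modulo 4. Each constructor carries the quotient that
  -- evaluates the relevant power of T once T² = -1.
  data Not2,0Mod4 : ℕ → ℕ → Set where
    c-odd : ∀ {h} m → Not2,0Mod4 (suc (m ℕ.* 2)) h
    c≡0   : ∀ {h} m → Not2,0Mod4 (m ℕ.* 4) h
    h-odd : ∀ {c} m → Not2,0Mod4 c (suc (m ℕ.* 2))
    h≡2   : ∀ {c} m → Not2,0Mod4 c (m ℕ.* 4 ℕ.+ 2)

  A-zero⇒anti-double-odd : ∀ {g} → Zero (A 1 g) → ∀ m → AntiPeriod (suc (m ℕ.* 2) ℕ.+ suc (m ℕ.* 2)) g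
  A-zero⇒anti-double-odd Ag m = anti-cast (identity m) (anti-odd (A-zero⇒anti-2 Ag) m)
    where
    identity : ∀ m → suc (m ℕ.* 2) ℕ.* 2 ≡ suc (m ℕ.* 2) ℕ.+ suc (m ℕ.* 2)
    identity = ℕ-Solver.solve-∀

  -- Here T² = -1. For odd `c`, T^(2c) = -1 cancels the ends of the equation at `z + c` and leaves 2
  -- g = 0. If 4 divides `c`, then T^c = 1 forces A = -4 against A = 0. For odd `h`, T^(2h) is both
  -- 1 and -1; for h ≡ 2 modulo 4 so is T^h.
  A-zero⇒zero : ∀ {c h g} → Not2,0Mod4 c h → Zero (A 1 g) → Harmonic c g → Period h g → Zero g
  A-zero⇒zero {c} {h} {g} (c-odd m) Ag har per = ends-zero {c} λ z → *-zero-cancel 1 (g (z + + c)) (begin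
    + 2 * g (z + + c)
      ≡⟨ identity (g (z + + c)) (g z) ⟩
    0ℤ + (+ 2 * g (z + + c) + (- g z + g z))
      ≡⟨ cong₂ (λ x y → x + (+ 2 * g (z + + c) + (y + g z))) (sym (Ag (z + + c))) (sym (A-zero⇒anti-double-odd {g} Ag m z)) ⟩
    A 1 g (z + + c) + (+ 2 * g (z + + c) + (g (z + + (c ℕ.+ c)) + g z))
      ≡⟨ harmonic-at {c} {g} har z ⟩
    0ℤ ∎)
    where
    open ≡-Reasoning
    identity : ∀ x y → + 2 * x ≡ 0ℤ + (+ 2 * x + (- y + y))
    identity = ℤ-Solver.solve-∀
  A-zero⇒zero {g = g} (c≡0 m) Ag har per z = *-zero-cancel 3 (g z)
    (trans (trans (sym (ℤ.+-identityˡ (+ 4 * g z))) (cong (_+ + 4 * g z) (sym (Ag z))))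
           (harmonic-period {m ℕ.* 4} {g} har (period-* {4} (anti-anti (A-zero⇒anti-2 Ag)) m) z))
  A-zero⇒zero (h-odd m) Ag har per = period∧anti⇒zero (period-+ per per) (A-zero⇒anti-double-odd Ag m)
  A-zero⇒zero (h≡2 m) Ag har per = period∧anti⇒zero per
    (period-anti {m ℕ.* 4} (period-* {4} (anti-anti (A-zero⇒anti-2 Ag)) m) (A-zero⇒anti-2 Ag))

  3∣ : ℕ → Set
  3∣ c = ∃ λ q → c ≡ q ℕ.* 3

  3∤ : ℕ → Set
  3∤ h = (∃ λ q → h ≡ q ℕ.* 3 ℕ.+ 1) ⊎ (∃ λ q → h ≡ q ℕ.* 3 ℕ.+ 2)

  -- The cubic A (A + 1) (A + 2) kills F, and 2F is the sum of the components
  -- (A + 1) (A + 2) F, - 2 A (A + 2) F and A (A + 1) F.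
  module _ (h c : ℕ) .{{_ : ℕ.NonZero h}} {F : ℤ → ℤ} (per : Period h F) (har : Harmonic c F) (three : 3∣ c ⊎ 3∤ h) where

    g₀ g₂ : ℤ → ℤ
    g₀ z = (A 1 (A 1 F) z + + 3 * A 1 F z) + + 2 * F z
    g₂ z = A 1 (A 1 F) z + A 1 F z

    private
      a₁ a₂ a₃ : ℤ → ℤ
      a₁ = A 1 F
      a₂ = A 1 a₁
      a₃ = A 1 a₂

    harmonic-a₁ : Harmonic c (A 1 F)
    harmonic-a₁ = harmonic-A c F har

    harmonic-a₂ : Harmonic c (A 1 (A 1 F))
    harmonic-a₂ = harmonic-A c (A 1 F) harmonic-a₁

    cubic : ∀ z → (a₃ z + + 3 * a₂ z) + + 2 * a₁ z ≡ 0ℤ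
    cubic z = trans (identity (a₁ z) (a₂ z) (a₃ z))
      (trans (cong (_+ D F z) (sym (trans (A-+ 1 a₂ (λ z → + 2 * a₁ z) z) (cong (_+_ (a₃ z)) (A-* 1 (+ 2) a₁ z)))))
        (RD-zero h c per har z))
      where
      identity : ∀ a b c → (c + + 3 * b) + + 2 * a ≡ (c + + 2 * b) + (b + + 2 * a)
      identity = ℤ-Solver.solve-∀

    A-g₀ : Zero (A 1 g₀)
    A-g₀ z = trans (A-+ 1 (λ z → a₂ z + + 3 * a₁ z) (λ z → + 2 * F z) z)
      (trans (cong₂ _+_ (trans (A-+ 1 a₂ (λ z → + 3 * a₁ z) z) (cong (_+_ (a₃ z)) (A-* 1 (+ 3) a₁ z))) (A-* 1 (+ 2) F z)) (cubic z))

    -- This is the component in the kernel of A + 1. The hypothesis `three` negates the condition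
    -- under which j = n/3 is of type 2.
    D-zero : Zero (D F)
    D-zero = cases three
      where
      harmonic-D : Harmonic c (D F)
      harmonic-D = harmonic-+ c a₂ (λ z → + 2 * a₁ z) harmonic-a₂ (harmonic-* c a₁ (+ 2) harmonic-a₁)
      cases : 3∣ c ⊎ 3∤ h → Zero (D F)
      cases (inj₁ (q , eq)) = R-zero∧3∣c⇒zero q (RD-zero h c per har) (subst (λ c → Harmonic c (D F)) eq harmonic-D)
      cases (inj₂ 3∤h)      = R-zero∧3∤n⇒zero {h} (RD-zero h c per har) (period-D h c per) 3∤h

    g₂-zero : Zero g₂
    g₂-zero = A=-2⇒zero h c (period-sum (period-A 1 (period-A 1 per)) (period-A 1 per)) (harmonic-+ c a₂ a₁ harmonic-a₂ harmonic-a₁)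
      λ z → trans (trans (cong (_+ + 2 * g₂ z) (A-+ 1 a₂ a₁ z)) (identity (a₁ z) (a₂ z) (a₃ z))) (cubic z)
      where
      identity : ∀ a b c → (c + b) + + 2 * (b + a) ≡ (c + + 3 * b) + + 2 * a
      identity = ℤ-Solver.solve-∀

    2F≡g₀ : ∀ z → + 2 * F z ≡ g₀ z
    2F≡g₀ z = begin
      + 2 * F z
        ≡⟨ identity (F z) (a₁ z) (a₂ z) ⟩
      g₀ z + (- (+ 2) * D F z + g₂ z)
        ≡⟨ cong₂ (λ x y → g₀ z + (- (+ 2) * x + y)) (D-zero z) (g₂-zero z) ⟩
      g₀ z + 0ℤ
        ≡⟨ ℤ.+-identityʳ (g₀ z) ⟩
      g₀ z ∎
      where
      open ≡-Reasoning
      identity : ∀ f a b → + 2 * f ≡ ((b + + 3 * a) + + 2 * f) + (- (+ 2) * (b + + 2 * a) + (b + a))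
      identity = ℤ-Solver.solve-∀

    -- With the other two components gone, `F` lies in the kernel of A, where T² = -1.
    period-4 : Period 4 F
    period-4 z = ℤ.*-cancelˡ-≡ (+ 2) _ _ (trans (2F≡g₀ (z + + 4)) (trans (anti-anti {2} {g₀} (A-zero⇒anti-2 A-g₀) z) (sym (2F≡g₀ z))))

    harmonic-zero : Not2,0Mod4 c h → Zero F
    harmonic-zero mod4 z = *-zero-cancel 1 (F z) (trans (2F≡g₀ z) (A-zero⇒zero mod4 A-g₀ harmonic-g₀ period-g₀ z))
      where
      harmonic-g₀ : Harmonic c g₀
      harmonic-g₀ = harmonic-+ c (λ z → a₂ z + + 3 * a₁ z) (λ z → + 2 * F z)
        (harmonic-+ c a₂ (λ z → + 3 * a₁ z) harmonic-a₂ (harmonic-* c a₁ (+ 3) harmonic-a₁)) (harmonic-* c F (+ 2) har)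
      period-g₀ : Period h g₀
      period-g₀ = period-sum (period-sum (period-A 1 (period-A 1 per)) (period-scale (+ 3) (period-A 1 per))) (period-scale (+ 2) per)

-- Symmetric and antisymmetric parts of a closed magic labelling.

module Labellings where

  open import Data.Integer.Base using (_+_; _*_; _-_; -_; 0ℤ)
  open PeriodicFunctions
  open Components

  -- For positive `s` and `t` it says that 2 has a larger exponent in `t` than in `s`. Then T^s = -1
  -- and T^t = -1 are incompatible on a nonzero function.
  OppositeParity : ℕ → ℕ → Set
  OppositeParity s t = ∃ λ m → ∃ λ k → m ℕ.* 2 ℕ.* s ≡ suc (k ℕ.* 2) ℕ.* t

  module _ (h c′ : ℕ) .{{_ : ℕ.NonZero h}} (f : ℤ → ℤ) (r : ℤ) (period-2h : Period (h ℕ.+ h) f)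
           (magic : ∀ z → f z + (A 1 f z + (A (suc c′) f z + f (z + + h))) ≡ r) where

    private
      c : ℕ
      c = suc c′
      swap⁺⁺ : ∀ z s t → z + s + t ≡ z + t + s
      swap⁺⁺ = ℤ-Solver.solve-∀
      swap⁺⁻ : ∀ z s t → z + s - t ≡ z - t + s
      swap⁺⁻ = ℤ-Solver.solve-∀

    -- Up to the factor 2, `f⁺` and `f⁻` are the components of `f` on which T^h is 1 and -1. Passing
    -- to the difference `F` removes the constant `r + r` from the equation of `f⁺`.
    f⁺ f⁻ F : ℤ → ℤ
    f⁺ z = f z + f (z + + h)
    f⁻ z = f z - f (z + + h)
    F z = f⁺ (z + + 1) - f⁺ z

    f-2h : ∀ z → f (z + + h + + h) ≡ f z
    f-2h z = trans (cong f (ℤ.+-assoc z (+ h) (+ h))) (period-2h z)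

    period-f⁺ : Period h f⁺
    period-f⁺ z = trans (cong (_+_ (f (z + + h))) (f-2h z)) (ℤ.+-comm (f (z + + h)) (f z))

    anti-f⁻ : AntiPeriod h f⁻
    anti-f⁻ z = trans (cong (_-_ (f (z + + h))) (f-2h z)) (identity (f z) (f (z + + h)))
      where
      identity : ∀ x y → y - x ≡ - (x - y)
      identity = ℤ-Solver.solve-∀

    period-F : Period h F
    period-F z = cong₂ _-_ (trans (cong f⁺ (swap⁺⁺ z (+ h) (+ 1))) (period-f⁺ (z + + 1))) (period-f⁺ z)

    magic-h : ∀ z → f (z + + h) + ((f (z + + 1 + + h) + f (z - + 1 + + h)) + ((f (z + + c + + h) + f (z - + c + + h)) + f z)) ≡ r
    magic-h z = trans (cong (_+_ (f (z + + h))) (cong₂ _+_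
        (cong₂ _+_ (cong f (swap⁺⁺ z (+ 1) (+ h))) (cong f (sym (swap⁺⁻ z (+ h) (+ 1)))))
        (cong₂ _+_ (cong₂ _+_ (cong f (swap⁺⁺ z (+ c) (+ h))) (cong f (sym (swap⁺⁻ z (+ h) (+ c))))) (sym (f-2h z)))))
      (magic (z + + h))

    f⁺-equation : ∀ z → A 1 f⁺ z + Δ c f⁺ z ≡ r + r
    f⁺-equation z = trans
      (identity (f z) (f (z + + 1)) (f (z - + 1)) (f (z + + c)) (f (z - + c))
        (f (z + + h)) (f (z + + 1 + + h)) (f (z - + 1 + + h)) (f (z + + c + + h)) (f (z - + c + + h)))
      (cong₂ _+_ (magic z) (magic-h z))
      where
      identity : ∀ x a b p q x′ a′ b′ p′ q′ →
        ((a + a′) + (b + b′)) + (+ 2 * (x + x′) + ((p + p′) + (q + q′))) ≡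
        (x + ((a + b) + ((p + q) + x′))) + (x′ + ((a′ + b′) + ((p′ + q′) + x)))
      identity = ℤ-Solver.solve-∀

    -- Both `f z` and `f (z + h)` occur in the magic sums at `z` and at `z + h`, so they cancel in
    -- the difference.
    f⁻-equation : ∀ z → A 1 f⁻ z + A c f⁻ z ≡ 0ℤ
    f⁻-equation z = trans
      (identity (f z) (f (z + + 1)) (f (z - + 1)) (f (z + + c)) (f (z - + c))
        (f (z + + h)) (f (z + + 1 + + h)) (f (z - + 1 + + h)) (f (z + + c + + h)) (f (z - + c + + h)))
      (trans (cong₂ _-_ (magic z) (magic-h z)) (ℤ.+-inverseʳ r))
      where
      identity : ∀ x a b p q x′ a′ b′ p′ q′ →
        ((a - a′) + (b - b′)) + ((p - p′) + (q - q′)) ≡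
        (x + ((a + b) + ((p + q) + x′))) - (x′ + ((a′ + b′) + ((p′ + q′) + x)))
      identity = ℤ-Solver.solve-∀

    harmonic-F : Harmonic c F
    harmonic-F z = trans
      (cong₂ (λ x y → ((f⁺ (z + + 1 + + 1) - f⁺ (z + + 1)) + (x - f⁺ (z - + 1))) + (+ 2 * F z + (y + F (z - + c))))
         (cong f⁺ (sym (swap⁺⁻ z (+ 1) (+ 1)))) (cong (_- f⁺ (z + + c)) (cong f⁺ (swap⁺⁺ z (+ c) (+ 1)))))
      (trans (cong (λ x → ((f⁺ (z + + 1 + + 1) - f⁺ (z + + 1)) + (f⁺ (z + + 1 - + 1) - f⁺ (z - + 1)))
                        + (+ 2 * F z + ((f⁺ (z + + 1 + + c) - f⁺ (z + + c)) + (x - f⁺ (z - + c))))) (cong f⁺ (sym (swap⁺⁻ z (+ 1) (+ c)))))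
      (trans (identity (f⁺ z) (f⁺ (z + + 1)) (f⁺ (z - + 1)) (f⁺ (z + + c)) (f⁺ (z - + c)) (f⁺ (z + + 1 + + 1)) (f⁺ (z + + 1 - + 1)) (f⁺ (z + + 1 + + c)) (f⁺ (z + + 1 - + c)))
        (trans (cong₂ _-_ (f⁺-equation (z + + 1)) (f⁺-equation z)) (ℤ.+-inverseʳ (r + r)))))
      where
      identity : ∀ x a b p q a′ b′ p′ q′ →
        ((a′ - a) + (b′ - b)) + (+ 2 * (a - x) + ((p′ - p) + (q′ - q))) ≡
        ((a′ + b′) + (+ 2 * a + (p′ + q′))) - ((a + b) + (+ 2 * x + (p + q)))
      identity = ℤ-Solver.solve-∀

    -- On f⁻ the equation factors as (T^(c+1) + 1) (T^(c-1) + 1) = 0, T being the translation by 1.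
    anti-P : AntiPeriod (suc c) (P c′ f⁻)
    anti-P z = trans (identity (f⁻ z) (f⁻ (z + + c′)) (f⁻ (z + + suc c)) (f⁻ (z + + suc c + + c′)))
      (trans (cong (_- P c′ f⁻ z) sum-zero) (ℤ.+-identityˡ (- P c′ f⁻ z)))
      where
      identity : ∀ x y u v → u + v ≡ ((u + y) + (v + x)) - (x + y)
      identity = ℤ-Solver.solve-∀
      e₁ : ∀ z c → z + (+ 1 + (+ 1 + c)) ≡ z + (+ 1 + c) + + 1
      e₁ = ℤ-Solver.solve-∀
      e₂ : ∀ z c → z + c ≡ z + (+ 1 + c) - + 1
      e₂ = ℤ-Solver.solve-∀
      e₃ : ∀ z c → z + (+ 1 + (+ 1 + c)) + c ≡ z + (+ 1 + c) + (+ 1 + c)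
      e₃ = ℤ-Solver.solve-∀
      e₄ : ∀ z c → z ≡ z + c - c
      e₄ = ℤ-Solver.solve-∀
      sum-zero : (f⁻ (z + + suc c) + f⁻ (z + + c′)) + (f⁻ (z + + suc c + + c′) + f⁻ z) ≡ 0ℤ
      sum-zero = trans (cong₂ _+_ (cong₂ _+_ (cong f⁻ (e₁ z (+ c′))) (cong f⁻ (e₂ z (+ c′))))
                                  (cong₂ _+_ (cong f⁻ (e₃ z (+ c′))) (cong f⁻ (e₄ z (+ c))))) (f⁻-equation (z + + c))

    anti-P-h : AntiPeriod h (P c′ f⁻)
    anti-P-h z = trans (cong₂ _+_ (anti-f⁻ z) (trans (cong f⁻ (swap⁺⁺ z (+ h) (+ c′))) (anti-f⁻ (z + + c′))))
      (sym (ℤ.neg-distrib-+ (f⁻ z) (f⁻ (z + + c′))))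

    module _ (opposite : OppositeParity (suc c) h ⊎ OppositeParity h (suc c)) where

      -- Both T^(c+1) and T^h act as -1 on this function, and the exponents of 2 in c + 1 and `h`
      -- differ.
      P-zero : Zero (P c′ f⁻)
      P-zero = cases opposite
        where
        cases : OppositeParity (suc c) h ⊎ OppositeParity h (suc c) → Zero (P c′ f⁻)
        cases (inj₁ (m , k , eq)) = even∧odd⇒zero {suc c} {h} m k eq anti-P anti-P-h
        cases (inj₂ (m , k , eq)) = even∧odd⇒zero {h} {suc c} m k eq anti-P-h anti-P

      period-f⁻ : Period (2 ℕ.* c′) f⁻
      period-f⁻ = anti-anti {c′} {f⁻} λ z →
        trans (identity (f⁻ z) (f⁻ (z + + c′))) (trans (cong (_- f⁻ z) (P-zero z)) (ℤ.+-identityˡ (- f⁻ z)))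
        where
        identity : ∀ x y → y ≡ (x + y) - x
        identity = ℤ-Solver.solve-∀

    -- f⁺ (z + s) - f⁺ z does not depend on z, and it vanishes since f⁺ is periodic.
    period-f⁺-of-F : ∀ s → Period s F → Period s f⁺
    period-f⁺-of-F s per z = trans (identity (f⁺ z) (f⁺ (z + + s))) (trans (cong (_+ f⁺ z) slope-zero) (ℤ.+-identityˡ (f⁺ z)))
      where
      slope : ℤ → ℤ
      slope z = f⁺ (z + + s) - f⁺ z
      period-1-slope : Period 1 slope
      period-1-slope z = trans (cong (λ y → f⁺ y - f⁺ (z + + 1)) (swap⁺⁺ z (+ 1) (+ s)))
        (trans (regroup (f⁺ (z + + s + + 1)) (f⁺ (z + + s)) (f⁺ (z + + 1)) (f⁺ z))
          (trans (cong (_+ slope z) (trans (cong (_- F z) (per z)) (ℤ.+-inverseʳ (F z)))) (ℤ.+-identityˡ (slope z))))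
        where
        regroup : ∀ a b c d → a - c ≡ ((a - b) - (c - d)) + (b - d)
        regroup = ℤ-Solver.solve-∀
      climb : ∀ m → f⁺ (z + + (m ℕ.* s)) ≡ f⁺ z + + m * slope z
      climb zero    = trans (cong f⁺ (ℤ.+-identityʳ z)) (sym (ℤ.+-identityʳ (f⁺ z)))
      climb (suc m) = trans (cong f⁺ (trans (cong (_+_ z) (ℤ.+-comm (+ s) (+ (m ℕ.* s)))) (sym (ℤ.+-assoc z (+ (m ℕ.* s)) (+ s)))))
        (trans (add (f⁺ (z + + (m ℕ.* s) + + s)) (f⁺ (z + + (m ℕ.* s))))
          (trans (cong₂ _+_ (climb m) (trans (cong (λ t → slope (z + + t)) (sym (ℕ.*-identityʳ (m ℕ.* s)))) (period-* {1} {slope} period-1-slope (m ℕ.* s) z)))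
            (collect (f⁺ z) (+ m) (slope z))))
        where
        add : ∀ x y → x ≡ y + (x - y)
        add = ℤ-Solver.solve-∀
        collect : ∀ x m y → x + m * y + y ≡ x + (+ 1 + m) * y
        collect = ℤ-Solver.solve-∀
      slope-zero : slope z ≡ 0ℤ
      slope-zero = ℤ.*-cancelˡ-≡ (+ h) (slope z) 0ℤ (trans (cancel (f⁺ z) (+ h * slope z))
        (trans (cong (_- f⁺ z) (trans (sym (climb h)) (trans (cong (λ t → f⁺ (z + + t)) (ℕ.*-comm h s)) (period-* {h} {f⁺} period-f⁺ s z))))
          (trans (ℤ.+-inverseʳ (f⁺ z)) (sym (ℤ.*-zeroʳ (+ h))))))
        where
        cancel : ∀ x y → y ≡ x + y - x
        cancel = ℤ-Solver.solve-∀
      identity : ∀ x y → y ≡ (y - x) + x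
      identity = ℤ-Solver.solve-∀

    -- Since 2 f = f⁺ + f⁻, and `f⁺` inherits the periods of `F`.
    period-of-parts : ∀ s → Period s F → Period s f⁻ → Period s f
    period-of-parts s perF per⁻ z = ℤ.*-cancelˡ-≡ (+ 2) _ _ (trans (double (z + + s)) (trans (cong₂ _+_ (period-f⁺-of-F s perF z) (per⁻ z)) (sym (double z))))
      where
      identity : ∀ x y → + 2 * x ≡ (x + y) + (x - y)
      identity = ℤ-Solver.solve-∀
      double : ∀ z → + 2 * f z ≡ f⁺ z + f⁻ z
      double z = identity (f z) (f (z + + h))

    module _ (opposite : OppositeParity (suc c) h ⊎ OppositeParity h (suc c)) (three : 3∣ c ⊎ 3∤ h) where

      period-4c′ : Period (c′ ℕ.* 4) f
      period-4c′ = period-of-parts (c′ ℕ.* 4) (period-* {4} {F} (period-4 h c period-F harmonic-F three) c′)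
        (period-cast {F = f⁻} (identity c′) (period-* {2 ℕ.* c′} {f⁻} (period-f⁻ opposite) 2))
        where
        identity : ∀ c → 2 ℕ.* (2 ℕ.* c) ≡ c ℕ.* 4
        identity = ℕ-Solver.solve-∀

      period-2c′ : Not2,0Mod4 c h → Period (2 ℕ.* c′) f
      period-2c′ mod4 = period-of-parts (2 ℕ.* c′) (λ z → trans (F-zero (z + + (2 ℕ.* c′))) (sym (F-zero z))) (period-f⁻ opposite)
        where
        F-zero : Zero F
        F-zero = harmonic-zero h c period-F harmonic-F three mod4

-- Sums restricted to a subset, in a commutative monoid.

module IndicatorSums (M : CommutativeMonoid 0ℓ 0ℓ) where

  open CommutativeMonoid M using (Carrier)
    renaming (_≈_ to _≈ᴹ_; sym to ≈-sym; trans to ≈-trans; refl to ≈-refl; _∙_ to _+_; ε to 0#;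
              ∙-cong to +-cong; identityˡ to +-identityˡ; identityʳ to +-identityʳ)
  open import Algebra.Properties.CommutativeMonoid.Sum M

  indicator : ∀ {n} {P : Fin n → Set} → (∀ v → Dec (P v)) → (Fin n → Carrier) → Fin n → Carrier
  indicator P? g v = if does (P? v) then g v else 0#

  sum-point : ∀ {n} {P : Fin n → Set} (P? : ∀ v → Dec (P v)) g s → P s → (∀ v → P v → v ≡ s) → sum (indicator P? g) ≈ᴹ g s
  sum-point {suc n} P? g s Ps only = ≈-trans (sum-remove {i = s} (indicator P? g))
    (≈-trans (+-cong here (≈-trans (sum-cong-≋ elsewhere) (sum-replicate-zero n))) (+-identityʳ (g s)))
    where
    here : indicator P? g s ≈ᴹ g s
    here with P? s
    ... | yes _ = ≈-refl
    ... | no ¬Ps = contradiction Ps ¬Ps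
    elsewhere : ∀ i → indicator P? g (punchIn s i) ≈ᴹ 0#
    elsewhere i with P? (punchIn s i)
    ... | yes Pi = contradiction (only _ Pi) (Fin.punchInᵢ≢i s i)
    ... | no _   = ≈-refl

  sum-⊎ : ∀ {n} {P Q R : Fin n → Set} (P? : ∀ v → Dec (P v)) (Q? : ∀ v → Dec (Q v)) (R? : ∀ v → Dec (R v)) g →
    (∀ v → P v → Q v ⊎ R v) → (∀ v → Q v → P v) → (∀ v → R v → P v) → (∀ v → Q v → ¬ R v) →
    sum (indicator P? g) ≈ᴹ sum (indicator Q? g) + sum (indicator R? g)
  sum-⊎ P? Q? R? g split Q⇒P R⇒P disjoint = ≈-trans (sum-cong-≋ pointwise) (∑-distrib-+ (indicator Q? g) (indicator R? g))
    where
    pointwise : ∀ v → indicator P? g v ≈ᴹ indicator Q? g v + indicator R? g v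
    pointwise v with P? v | Q? v | R? v
    ... | yes _ | yes q | yes r = contradiction r (disjoint v q)
    ... | yes _ | yes _ | no _  = ≈-sym (+-identityʳ (g v))
    ... | yes _ | no _  | yes _ = ≈-sym (+-identityˡ (g v))
    ... | yes p | no ¬q | no ¬r = contradiction (split v p) [ ¬q , ¬r ]′
    ... | no ¬p | yes q | _     = contradiction (Q⇒P v q) ¬p
    ... | no ¬p | _     | yes r = contradiction (R⇒P v r) ¬p
    ... | no _  | no _  | no _  = ≈-sym (+-identityˡ 0#)

  -- The generality serves two sums: labels over the neighbours of u, where φ v = v - u, and
  -- character values over the connection set itself, where φ is the identity.
  module _ {n} (φ ψ : Fin n → Fin n) (φψ : ∀ a → φ (ψ a) ≡ a) (ψφ : ∀ v → ψ (φ v) ≡ v) (g : Fin n → Carrier) where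

    sum-over : Subset n → Carrier
    sum-over S = sum (indicator (λ v → φ v ∈? S) g)

    sum-over-⁅⁆ : ∀ a → sum-over ⁅ a ⁆ ≈ᴹ g (ψ a)
    sum-over-⁅⁆ a = sum-point (λ v → φ v ∈? ⁅ a ⁆) g (ψ a) (subst (_∈ ⁅ a ⁆) (sym (φψ a)) (x∈⁅x⁆ a))
      (λ v φv∈ → trans (sym (ψφ v)) (cong ψ (x∈⁅y⁆⇒x≡y a φv∈)))

    sum-over-∪ : ∀ a S → a ∉ S → sum-over (⁅ a ⁆ ∪ S) ≈ᴹ g (ψ a) + sum-over S
    sum-over-∪ a S a∉S = ≈-trans
      (sum-⊎ (λ v → φ v ∈? (⁅ a ⁆ ∪ S)) (λ v → φ v ∈? ⁅ a ⁆) (λ v → φ v ∈? S) g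
        (λ v → x∈p∪q⁻ ⁅ a ⁆ S) (λ v → x∈p∪q⁺ ∘ inj₁) (λ v → x∈p∪q⁺ ∘ inj₂)
        (λ v v∈⁅a⁆ v∈S → a∉S (subst (_∈ S) (x∈⁅y⁆⇒x≡y a v∈⁅a⁆) v∈S)))
      (+-cong (sum-over-⁅⁆ a) ≈-refl)

    sum-over-five : ∀ {a₁ a₂ a₃ a₄ a₅} →
      a₁ ∉ ⁅ a₂ ⁆ ∪ ⁅ a₃ ⁆ ∪ ⁅ a₄ ⁆ ∪ ⁅ a₅ ⁆ → a₂ ∉ ⁅ a₃ ⁆ ∪ ⁅ a₄ ⁆ ∪ ⁅ a₅ ⁆ → a₃ ∉ ⁅ a₄ ⁆ ∪ ⁅ a₅ ⁆ → a₄ ∉ ⁅ a₅ ⁆ →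
      sum-over (⁅ a₁ ⁆ ∪ ⁅ a₂ ⁆ ∪ ⁅ a₃ ⁆ ∪ ⁅ a₄ ⁆ ∪ ⁅ a₅ ⁆) ≈ᴹ g (ψ a₁) + (g (ψ a₂) + (g (ψ a₃) + (g (ψ a₄) + g (ψ a₅))))
    sum-over-five ∉₁ ∉₂ ∉₃ ∉₄ =
      ≈-trans (sum-over-∪ _ _ ∉₁) (+-cong ≈-refl
      (≈-trans (sum-over-∪ _ _ ∉₂) (+-cong ≈-refl
      (≈-trans (sum-over-∪ _ _ ∉₃) (+-cong ≈-refl
      (≈-trans (sum-over-∪ _ _ ∉₄) (+-cong ≈-refl (sum-over-⁅⁆ _))))))))

-- Residues modulo n and the connection set.

module Residues (n : ℕ) .{{_ : ℕ.NonZero n}} where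

  open import Data.Integer.Base using (_+_; _*_; _-_; -_; 0ℤ)

  remainder-unique : ∀ {k k′} d → k ℕ.< n → k′ ℕ.< n → + k ≡ + k′ + d * + n → k ≡ k′
  remainder-unique {k} {k′} (+ zero)  k<n k′<n eq = ℤ.+-injective (trans eq (ℤ.+-identityʳ (+ k′)))
  remainder-unique {k} {k′} (+ suc d) k<n k′<n eq = contradiction k<n (ℕ.≤⇒≯ (begin
    n                    ≤⟨ ℕ.m≤m+n n (d ℕ.* n) ⟩
    suc d ℕ.* n          ≤⟨ ℕ.m≤n+m (suc d ℕ.* n) k′ ⟩
    k′ ℕ.+ suc d ℕ.* n   ≡⟨ ℤ.+-injective (trans eq (cong (_+_ (+ k′)) (sym (ℤ.pos-* (suc d) n)))) ⟨
    k ∎))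
    where open ℕ.≤-Reasoning
  remainder-unique {k} {k′} -[1+ d ]  k<n k′<n eq = sym (remainder-unique (+ suc d) k′<n k<n
    (trans (identity (+ k′) (-[1+ d ] * + n)) (cong₂ _+_ (sym eq) (ℤ.neg-distribˡ-* -[1+ d ] (+ n)))))
    where
    identity : ∀ a b → a ≡ a + b + - b
    identity = ℤ-Solver.solve-∀

  private
    r : ℤ → Fin n
    r = residue n

  toℕ-residue : ∀ z → toℕ (r z) ≡ z %ℕ n
  toℕ-residue z = Fin.toℕ-fromℕ< (n%ℕd<d z n)

  residue-spec : ∀ z → ∃ λ q → z ≡ + toℕ (r z) + q * + n
  residue-spec z = z /ℕ n , trans (a≡a%ℕn+[a/ℕn]*n z n) (cong (λ k → + k + z /ℕ n * + n) (sym (toℕ-residue z)))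

  residue-≡ : ∀ {a} {v : Fin n} q → a ≡ + toℕ v + q * + n → r a ≡ v
  residue-≡ {a} {v} q eq with residue-spec a
  ... | q′ , eq′ = Fin.toℕ-injective (remainder-unique (q - q′) (Fin.toℕ<n (r a)) (Fin.toℕ<n v)
    (trans (identity₁ (+ toℕ (r a)) (q′ * + n)) (trans (cong (_- q′ * + n) (trans (sym eq′) eq)) (identity₂ (+ toℕ v) q q′ (+ n)))))
    where
    identity₁ : ∀ x y → x ≡ x + y - y
    identity₁ = ℤ-Solver.solve-∀
    identity₂ : ∀ x q q′ n → x + q * n - q′ * n ≡ x + (q - q′) * n
    identity₂ = ℤ-Solver.solve-∀

  residue-cong : ∀ {a b} q → a ≡ b + q * + n → r a ≡ r b
  residue-cong {a} {b} q eq with residue-spec b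
  ... | q′ , eq′ = residue-≡ (q′ + q) (trans eq (trans (cong (_+ q * + n) eq′) (identity (+ toℕ (r b)) q q′ (+ n))))
    where
    identity : ∀ x q q′ n → x + q′ * n + q * n ≡ x + (q′ + q) * n
    identity = ℤ-Solver.solve-∀

  residue-injective : ∀ {a b} → r a ≡ r b → ∃ λ q → a ≡ b + q * + n
  residue-injective {a} {b} eq with residue-spec a | residue-spec b
  ... | q , ea | q′ , eb = q - q′ , trans ea (trans (cong (λ v → + toℕ v + q * + n) eq)
    (trans (identity (+ toℕ (r b)) q q′ (+ n)) (cong (_+ (q - q′) * + n) (sym eb))))
    where
    identity : ∀ x q q′ n → x + q * n ≡ x + q′ * n + (q - q′) * n
    identity = ℤ-Solver.solve-∀

  residue-+ : ∀ a b → r (+ toℕ (r a) + + toℕ (r b)) ≡ r (b + a)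
  residue-+ a b with residue-spec a | residue-spec b
  ... | q , ea | q′ , eb = sym (residue-cong {b + a} {+ toℕ (r a) + + toℕ (r b)} (q + q′) (trans (cong₂ _+_ eb ea) (identity (+ toℕ (r a)) (+ toℕ (r b)) q q′ (+ n))))
    where
    identity : ∀ x y q q′ n → y + q′ * n + (x + q * n) ≡ x + y + (q + q′) * n
    identity = ℤ-Solver.solve-∀

  toℕ-residue-+ : ∀ {k} → k ℕ.< n → toℕ (r (+ k)) ≡ k
  toℕ-residue-+ {k} k<n = trans (cong toℕ (residue-≡ {v = fromℕ< k<n} 0ℤ (trans (cong +_ (sym (Fin.toℕ-fromℕ< k<n))) (sym (ℤ.+-identityʳ _)))))
    (Fin.toℕ-fromℕ< k<n)

  toℕ-residue-neg : ∀ {k} → 0 ℕ.< k → k ℕ.≤ n → toℕ (r (- + k)) ≡ n ℕ.∸ k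
  toℕ-residue-neg {k} 0<k k≤n = trans (cong toℕ (residue-≡ {v = fromℕ< n∸k<n} (- + 1) (trans (identity (+ k) (+ n))
      (cong (_+ - + 1 * + n) (trans (trans (ℤ.m-n≡m⊖n n k) (ℤ.⊖-≥ k≤n)) (cong +_ (sym (Fin.toℕ-fromℕ< n∸k<n))))))))
    (Fin.toℕ-fromℕ< n∸k<n)
    where
    n∸k<n : n ℕ.∸ k ℕ.< n
    n∸k<n = ℕ.∸-monoʳ-< 0<k k≤n
    identity : ∀ k n → - k ≡ n - k + - + 1 * n
    identity = ℤ-Solver.solve-∀

  translate untranslate : Fin n → Fin n → Fin n
  translate u a = r (+ toℕ a + + toℕ u)
  untranslate u v = r (+ toℕ v - + toℕ u)

  untranslate-translate : ∀ u a → untranslate u (translate u a) ≡ a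
  untranslate-translate u a with residue-spec (+ toℕ a + + toℕ u)
  ... | q , eq = residue-≡ (- q) (trans (identity₁ (+ toℕ (translate u a)) (+ toℕ u) (q * + n))
    (trans (cong (λ x → x - + toℕ u - q * + n) (sym eq)) (identity₂ (+ toℕ a) (+ toℕ u) q (+ n))))
    where
    identity₁ : ∀ x u y → x - u ≡ x + y - u - y
    identity₁ = ℤ-Solver.solve-∀
    identity₂ : ∀ a u q n → a + u - u - q * n ≡ a + - q * n
    identity₂ = ℤ-Solver.solve-∀

  translate-untranslate : ∀ u v → translate u (untranslate u v) ≡ v
  translate-untranslate u v with residue-spec (+ toℕ v - + toℕ u)
  ... | q , eq = residue-≡ (- q) (trans (identity₁ (+ toℕ (untranslate u v)) (+ toℕ u) (q * + n))
    (trans (cong (λ x → x + + toℕ u - q * + n) (sym eq)) (identity₂ (+ toℕ v) (+ toℕ u) q (+ n))))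
    where
    identity₁ : ∀ x u y → x + u ≡ x + y + u - y
    identity₁ = ℤ-Solver.solve-∀
    identity₂ : ∀ a u q n → a - u + u - q * n ≡ a + - q * n
    identity₂ = ℤ-Solver.solve-∀

  -- The least nonnegative representatives satisfy 1 < c < h < n - c < n - 1. Hence the five
  -- elements are distinct, and a sum over the set has exactly five terms.
  module ConnectionSet (c h : ℕ) (n≡h+h : n ≡ h ℕ.+ h) (1<c : 1 ℕ.< c) (c<h : c ℕ.< h) where

    h<n : h ℕ.< n
    h<n = subst (h ℕ.<_) (sym n≡h+h) (ℕ.m<m+n h (ℕ.≤-<-trans ℕ.z≤n c<h))

    c<n : c ℕ.< n
    c<n = ℕ.<-trans c<h h<n

    1≤n : 1 ℕ.≤ n
    1≤n = ℕ.<⇒≤ (ℕ.<-trans 1<c c<n)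

    toℕ-1 : toℕ (r (+ 1)) ≡ 1
    toℕ-1 = toℕ-residue-+ (ℕ.<-trans 1<c c<n)

    toℕ-c : toℕ (r (+ c)) ≡ c
    toℕ-c = toℕ-residue-+ c<n

    toℕ-h : toℕ (r (+ h)) ≡ h
    toℕ-h = toℕ-residue-+ h<n

    toℕ-neg-1 : toℕ (r (- + 1)) ≡ n ℕ.∸ 1
    toℕ-neg-1 = toℕ-residue-neg ℕ.z<s 1≤n

    toℕ-neg-c : toℕ (r (- + c)) ≡ n ℕ.∸ c
    toℕ-neg-c = toℕ-residue-neg (ℕ.<-trans ℕ.z<s 1<c) (ℕ.<⇒≤ c<n)

    h<n∸c : h ℕ.< n ℕ.∸ c
    h<n∸c = subst (ℕ._< n ℕ.∸ c) (trans (cong (ℕ._∸ h) n≡h+h) (ℕ.m+n∸n≡m h h)) (ℕ.∸-monoʳ-< c<h (ℕ.<⇒≤ h<n))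

    n∸c<n∸1 : n ℕ.∸ c ℕ.< n ℕ.∸ 1
    n∸c<n∸1 = ℕ.∸-monoʳ-< 1<c (ℕ.<⇒≤ c<n)

    private

      apart : ∀ {u v : Fin n} {k l} → toℕ u ≡ k → toℕ v ≡ l → k ℕ.< l → u ≢ v
      apart eu ev k<l refl = ℕ.<-irrefl (trans (sym eu) ev) k<l

      ∉⁅⁆ : ∀ {u v : Fin n} → u ≢ v → u ∉ ⁅ v ⁆
      ∉⁅⁆ u≢v u∈ = u≢v (x∈⁅y⁆⇒x≡y _ u∈)

      ∉∪ : ∀ {u v : Fin n} {S} → u ≢ v → u ∉ S → u ∉ ⁅ v ⁆ ∪ S
      ∉∪ {v = v} {S} u≢v u∉S u∈ = [ u≢v ∘ x∈⁅y⁆⇒x≡y v , u∉S ]′ (x∈p∪q⁻ ⁅ v ⁆ S u∈)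

      c<n∸c : c ℕ.< n ℕ.∸ c
      c<n∸c = ℕ.<-trans c<h h<n∸c

      h<n∸1 : h ℕ.< n ℕ.∸ 1
      h<n∸1 = ℕ.<-trans h<n∸c n∸c<n∸1

    sum-over-connectionSet : ∀ (M : CommutativeMonoid 0ℓ 0ℓ) φ ψ φψ ψφ g → let open CommutativeMonoid M using () renaming (_≈_ to _≈ᴹ_; _∙_ to _⊕_) in
      IndicatorSums.sum-over M φ ψ φψ ψφ g
        (⁅ r (+ 1) ⁆ ∪ ⁅ r (- + 1) ⁆ ∪ ⁅ r (+ c) ⁆ ∪ ⁅ r (- + c) ⁆ ∪ ⁅ r (+ h) ⁆)
      ≈ᴹ (g (ψ (r (+ 1))) ⊕ (g (ψ (r (- + 1))) ⊕ (g (ψ (r (+ c))) ⊕ (g (ψ (r (- + c))) ⊕ g (ψ (r (+ h)))))))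
    sum-over-connectionSet M φ ψ φψ ψφ g = IndicatorSums.sum-over-five M φ ψ φψ ψφ g
      (∉∪ (apart toℕ-1 toℕ-neg-1 (ℕ.<-trans 1<c (ℕ.<-trans c<h h<n∸1)))
        (∉∪ (apart toℕ-1 toℕ-c 1<c)
        (∉∪ (apart toℕ-1 toℕ-neg-c (ℕ.<-trans 1<c c<n∸c))
        (∉⁅⁆ (apart toℕ-1 toℕ-h (ℕ.<-trans 1<c c<h))))))
      (∉∪ (≢-sym (apart toℕ-c toℕ-neg-1 (ℕ.<-trans c<h h<n∸1)))
        (∉∪ (≢-sym (apart toℕ-neg-c toℕ-neg-1 n∸c<n∸1))
        (∉⁅⁆ (≢-sym (apart toℕ-h toℕ-neg-1 h<n∸1)))))
      (∉∪ (apart toℕ-c toℕ-neg-c c<n∸c)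
        (∉⁅⁆ (apart toℕ-c toℕ-h c<h)))
      (∉⁅⁆ (≢-sym (apart toℕ-h toℕ-neg-c h<n∸c)))

-- Character sums over the connection set, and indices of both types.

module CharacterSums where

  open import Data.Nat.Divisibility using (divides)
  open CauchyProduct using (fromℕ; /-cross; /-+)
  open Trigonometry
  open PiMultiples
  open import Data.Rational.Base
  open import Data.Rational.Properties
  open import Data.Rational.Solver using (module +-*-Solver)
  open +-*-Solver using (solve; _:=_; _:+_; _:*_; _:-_; :-_; con)

  module _ {C S : ℚ → ℕ → ℚ} (turns : HalfTurns C S) where

    open HalfTurns turns

    C-reflect : ∀ p m → Null (λ k → C (- p + fromℕ m) k - sgn m * C p k)
    C-reflect p m = null-≗ (λ k → cong (λ x → C (- p + fromℕ m) k - sgn m * x) (sym (C-neg p k))) (C-shift-ℕ turns m (- p))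

    S-reflect : ∀ p m → Null (λ k → S (- p + fromℕ m) k - sgn m * (- S p k))
    S-reflect p m = null-≗ (λ k → cong (λ x → S (- p + fromℕ m) k - sgn m * x) (sym (S-neg p k))) (S-shift-ℕ turns m (- p))

    -- With `J` = j, p = 2j/n and q = 2cj/n, these are the angles of 1, -1, c, -c and n/2 in units
    -- of π. As -1 and -c are represented by n - 1 and n - c, their angles carry an extra 2j. So
    -- χⱼ(S) = -1 reduces to 2 cos pπ + 2 cos qπ + (-1)^j + 1 = 0.
    real-part : ∀ p q J → Null (λ k → C p k + C p k + (C q k + C q k) + (sgn J + 1ℚ)) →
      Null (λ k → C p k + (C (- p + fromℕ (J ℕ.* 2)) k + (C q k + (C (- q + fromℕ (J ℕ.* 2)) k + C (0ℚ + fromℕ J) k))) - (- 1ℚ))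
    real-part p q J null = null-≗
      (λ k → trans
        (solve 7 (λ p p′ q q′ z o s → p :+ (p′ :+ (q :+ (q′ :+ z))) :- (:- con 1ℚ)
           := (p :+ p :+ (q :+ q) :+ (s :+ con 1ℚ)) :+ ((p′ :- con 1ℚ :* p) :+ ((q′ :- con 1ℚ :* q) :+ ((z :- s :* o) :+ (o :- con 1ℚ) :* s)))) refl
           (C p k) (C (- p + fromℕ (J ℕ.* 2)) k) (C q k) (C (- q + fromℕ (J ℕ.* 2)) k) (C (0ℚ + fromℕ J) k) (C 0ℚ k) (sgn J))
        (cong (λ e → (C p k + C p k + (C q k + C q k) + (sgn J + 1ℚ)) + ((C (- p + fromℕ (J ℕ.* 2)) k - e * C p k)
            + ((C (- q + fromℕ (J ℕ.* 2)) k - e * C q k) + ((C (0ℚ + fromℕ J) k - sgn J * C 0ℚ k) + (C 0ℚ k - 1ℚ) * sgn J)))) (sym (sgn-even J))))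
      (null-+ null (null-+ (C-reflect p (J ℕ.* 2)) (null-+ (C-reflect q (J ℕ.* 2))
        (null-+ (C-shift-ℕ turns J 0ℚ) (null-* C-0 (bounded-const (sgn J)))))))

    -- The set is closed under negation, so the sines cancel in pairs, and n/2 contributes sin jπ =
    -- 0.
    imaginary-part : ∀ p q J →
      Null (λ k → S p k + (S (- p + fromℕ (J ℕ.* 2)) k + (S q k + (S (- q + fromℕ (J ℕ.* 2)) k + S (0ℚ + fromℕ J) k))) - 0ℚ)
    imaginary-part p q J = null-≗
      (λ k → trans
        (solve 7 (λ p p′ q q′ z o s → p :+ (p′ :+ (q :+ (q′ :+ z))) :- con 0ℚ
           := (p′ :- con 1ℚ :* (:- p)) :+ ((q′ :- con 1ℚ :* (:- q)) :+ ((z :- s :* o) :+ o :* s))) refl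
           (S p k) (S (- p + fromℕ (J ℕ.* 2)) k) (S q k) (S (- q + fromℕ (J ℕ.* 2)) k) (S (0ℚ + fromℕ J) k) (S 0ℚ k) (sgn J))
        (cong (λ e → (S (- p + fromℕ (J ℕ.* 2)) k - e * (- S p k))
            + ((S (- q + fromℕ (J ℕ.* 2)) k - e * (- S q k)) + ((S (0ℚ + fromℕ J) k - sgn J * S 0ℚ k) + S 0ℚ k * sgn J))) (sym (sgn-even J))))
      (null-+ (S-reflect p (J ℕ.* 2)) (null-+ (S-reflect q (J ℕ.* 2))
        (null-+ (S-shift-ℕ turns J 0ℚ) (null-* (S-0 turns) (bounded-const (sgn J))))))

    -- Both cosines are -1/2, so the sum is -1 - 1 + 1 + 1.
    real-type2 : ∀ p q J m → p ≡ + 2 / 3 → q ≡ + 2 / 3 + fromℕ (m ℕ.* 2) ⊎ q ≡ - (+ 2 / 3) + fromℕ (m ℕ.* 2) → sgn J ≡ 1ℚ →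
      Null (λ k → C p k + C p k + (C q k + C q k) + (sgn J + 1ℚ))
    real-type2 p q J m refl q≡ sgnJ = null-≗
      (λ k → trans (cong (λ s → C p k + C p k + (C q k + C q k) + (s + 1ℚ)) sgnJ)
        (solve 2 (λ x y → x :+ x :+ (y :+ y) :+ (con 1ℚ :+ con 1ℚ)
                       := (x :+ con ½) :* (con (1ℚ + 1ℚ + 1ℚ + 1ℚ)) :+ (y :- con 1ℚ :* x) :* con (1ℚ + 1ℚ)) refl (C p k) (C q k)))
      (null-+ (null-* (C-⅔ turns) (bounded-const (1ℚ + 1ℚ + 1ℚ + 1ℚ))) (null-* (close q≡) (bounded-const (1ℚ + 1ℚ))))
      where
      close : q ≡ + 2 / 3 + fromℕ (m ℕ.* 2) ⊎ q ≡ - (+ 2 / 3) + fromℕ (m ℕ.* 2) → Null (λ k → C q k - 1ℚ * C (+ 2 / 3) k)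
      close (inj₁ refl) = subst (λ s → Null (λ k → C q k - s * C (+ 2 / 3) k)) (sgn-even m) (C-shift-ℕ turns (m ℕ.* 2) (+ 2 / 3))
      close (inj₂ refl) = subst (λ s → Null (λ k → C q k - s * C (+ 2 / 3) k)) (sgn-even m) (C-reflect (+ 2 / 3) (m ℕ.* 2))

    -- For odd j the terms (-1)^j and 1 cancel, and since p + q is odd, cos qπ = -cos pπ.
    real-type3 : ∀ p q J m → q ≡ - p + fromℕ (suc (m ℕ.* 2)) → sgn J ≡ - 1ℚ →
      Null (λ k → C p k + C p k + (C q k + C q k) + (sgn J + 1ℚ))
    real-type3 p q J m refl sgnJ = null-≗
      (λ k → trans (cong (λ s → C p k + C p k + (C q k + C q k) + (s + 1ℚ)) sgnJ)
        (trans (solve 2 (λ x y → x :+ x :+ (y :+ y) :+ ((:- con 1ℚ) :+ con 1ℚ) := (y :- (:- con 1ℚ) :* x) :* con (1ℚ + 1ℚ)) refl (C p k) (C q k))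
          (cong (λ s → (C q k - s * C p k) * (1ℚ + 1ℚ)) (sym (sgn-odd m)))))
      (null-* (C-reflect p (suc (m ℕ.* 2))) (bounded-const (1ℚ + 1ℚ)))

  module _ (n : ℕ) .{{_ : ℕ.NonZero n}} where

    /-shift : ∀ a b k → a ≡ b ℕ.+ k ℕ.* n → + a / n ≡ + b / n + fromℕ k
    /-shift a b k eq = trans (cong (λ x → + x / n) eq) (trans (sym (/-+ (+ b) (+ (k ℕ.* n)) n))
      (cong (_+_ (+ b / n)) (/-cross (+ (k ℕ.* n)) (+ k) n 1 (trans (ℤ.*-identityʳ _) (ℤ.pos-* k n)))))

    /-reflect : ∀ a b k → a ℕ.+ b ≡ k ℕ.* n → + a / n ≡ - (+ b / n) + fromℕ k
    /-reflect a b k eq = trans (solve 2 (λ x y → x := :- y :+ (x :+ y)) refl (+ a / n) (+ b / n))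
      (cong (_+_ (- (+ b / n))) (trans (/-+ (+ a) (+ b) n) (/-cross (+ (a ℕ.+ b)) (+ k) n 1
        (trans (ℤ.*-identityʳ _) (trans (cong +_ eq) (ℤ.pos-* k n))))))

  seq-re-sum : ∀ {n} (z : Fin n → ℂ) k → seq (re (foldr _+ℂ_ 0ℂ z)) k ≡ foldr _+_ 0ℚ (λ x → seq (re (z x)) k)
  seq-re-sum {zero}  z k = refl
  seq-re-sum {suc n} z k = cong (_+_ (seq (re (z Fin.zero)) k)) (seq-re-sum (z ∘ Fin.suc) k)

  seq-im-sum : ∀ {n} (z : Fin n → ℂ) k → seq (im (foldr _+ℂ_ 0ℂ z)) k ≡ foldr _+_ 0ℚ (λ x → seq (im (z x)) k)
  seq-im-sum {zero}  z k = refl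
  seq-im-sum {suc n} z k = cong (_+_ (seq (im (z Fin.zero)) k)) (seq-im-sum (z ∘ Fin.suc) k)

  foldr-cong : ∀ {n} {f g : Fin n → ℚ} → f ≗ g → foldr _+_ 0ℚ f ≡ foldr _+_ 0ℚ g
  foldr-cong {zero}  f≗g = refl
  foldr-cong {suc n} f≗g = cong₂ _+_ (f≗g Fin.zero) (foldr-cong (f≗g ∘ Fin.suc))

  module _ (n : ℕ) .{{_ : ℕ.NonZero n}} (c : ℕ) (n≡h+h : n ≡ n ℕ./ 2 ℕ.+ n ℕ./ 2) (1<c : 1 ℕ.< c) (c<h : c ℕ.< n ℕ./ 2)
           (π : ℝ) (isPi : IsPi π) where

    open Residues n
    open ConnectionSet c (n ℕ./ 2) n≡h+h 1<c c<h

    private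
      h : ℕ
      h = n ℕ./ 2
      cosπ′ sinπ′ : ℚ → ℕ → ℚ
      cosπ′ = cosπ π isPi
      sinπ′ = sinπ π isPi

    angle : Fin n → ℕ → ℚ
    angle j s = + (2 ℕ.* s ℕ.* toℕ j) / n

    angle-neg : ∀ j s → s ℕ.≤ n → angle j (n ℕ.∸ s) ≡ - angle j s + fromℕ (toℕ j ℕ.* 2)
    angle-neg j s s≤n = /-reflect n (2 ℕ.* (n ℕ.∸ s) ℕ.* toℕ j) (2 ℕ.* s ℕ.* toℕ j) (toℕ j ℕ.* 2)
      (trans (identity (n ℕ.∸ s) s (toℕ j)) (cong (toℕ j ℕ.* 2 ℕ.*_) (ℕ.m∸n+n≡m s≤n)))
      where
      identity : ∀ x s j → 2 ℕ.* x ℕ.* j ℕ.+ 2 ℕ.* s ℕ.* j ≡ j ℕ.* 2 ℕ.* (x ℕ.+ s)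
      identity = ℕ-Solver.solve-∀

    angle-h : ∀ j → angle j h ≡ 0ℚ + fromℕ (toℕ j)
    angle-h j = trans (/-shift n (2 ℕ.* h ℕ.* toℕ j) 0 (toℕ j) (trans (identity h (toℕ j)) (cong (toℕ j ℕ.*_) (sym n≡h+h))))
      (cong (_+ fromℕ (toℕ j)) (0/n≡0 n))
      where
      identity : ∀ h j → 2 ℕ.* h ℕ.* j ≡ j ℕ.* (h ℕ.+ h)
      identity = ℕ-Solver.solve-∀

    five : (X : ℚ → ℕ → ℚ) → Fin n → ℕ → ℚ
    five X j k = X (angle j 1) k + (X (- angle j 1 + fromℕ (toℕ j ℕ.* 2)) k + (X (angle j c) k
      + (X (- angle j c + fromℕ (toℕ j ℕ.* 2)) k + X (0ℚ + fromℕ (toℕ j)) k)))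

    sum≡five : ∀ (X : ℚ → ℕ → ℚ) j k →
      foldr _+_ 0ℚ (λ x → if does (x ∈? connectionSet n c) then X (angle j (toℕ x)) k else 0ℚ) ≡ five X j k
    sum≡five X j k = trans (sum-over-connectionSet +-0-commutativeMonoid id id (λ _ → refl) (λ _ → refl) (λ x → X (angle j (toℕ x)) k))
      (cong₂ _+_ (at toℕ-1 refl) (cong₂ _+_ (at toℕ-neg-1 (angle-neg j 1 1≤n)) (cong₂ _+_ (at toℕ-c refl)
        (cong₂ _+_ (at toℕ-neg-c (angle-neg j c (ℕ.<⇒≤ c<n))) (at toℕ-h (angle-h j))))))
      where
      at : ∀ {x s p} → toℕ x ≡ s → angle j s ≡ p → X (angle j (toℕ x)) k ≡ X p k
      at refl refl = refl

    𝓙-criterion : ∀ j →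
      Null (λ k → cosπ′ (angle j 1) k + cosπ′ (angle j 1) k + (cosπ′ (angle j c) k + cosπ′ (angle j c) k) + (sgn (toℕ j) + 1ℚ)) →
      𝓙 n π (connectionSet n c) j
    𝓙-criterion j null = small re-null , small im-null
      where
      S : Subset n
      S = connectionSet n c
      re-if : ∀ (b : Bool) z k → seq (re (if b then z else 0ℂ)) k ≡ (if b then seq (re z) k else 0ℚ)
      re-if true  z k = refl
      re-if false z k = refl
      im-if : ∀ (b : Bool) z k → seq (im (if b then z else 0ℂ)) k ≡ (if b then seq (im z) k else 0ℚ)
      im-if true  z k = refl
      im-if false z k = refl
      re-five : ∀ k → seq (re (χ-sum n π j S)) k ≡ five cosπ′ j k
      re-five k = trans (seq-re-sum (λ x → if does (x ∈? S) then χ n π j x else 0ℂ) k)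
        (trans (foldr-cong (λ x → re-if (does (x ∈? S)) (χ n π j x) k)) (sum≡five cosπ′ j k))
      im-five : ∀ k → seq (im (χ-sum n π j S)) k ≡ five sinπ′ j k
      im-five k = trans (seq-im-sum (λ x → if does (x ∈? S) then χ n π j x else 0ℂ) k)
        (trans (foldr-cong (λ x → im-if (does (x ∈? S)) (χ n π j x) k)) (sum≡five sinπ′ j k))
      re-null : Null (λ k → seq (re (χ-sum n π j S)) k - (- 1ℚ))
      re-null = null-≗ (λ k → cong (_- (- 1ℚ)) (re-five k)) (real-part (halfTurns π isPi) (angle j 1) (angle j c) (toℕ j) null)
      im-null : Null (λ k → seq (im (χ-sum n π j S)) k - 0ℚ)
      im-null = null-≗ (λ k → cong (_- 0ℚ) (im-five k)) (imaginary-part (halfTurns π isPi) (angle j 1) (angle j c) (toℕ j))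

    multiple-≈ : ∀ {p q r} → p ≡ q + r → (p · π ≈ q · π +ℝ r · π) × (q · π +ℝ r · π ≈ p · π)
    multiple-≈ {p} {q} {r} refl =
        small (null-eventually 0 λ k _ → trans (cong (_- (q * seq π k + r * seq π k)) (*-distribʳ-+ (seq π k) q r)) (+-inverseʳ (q * seq π k + r * seq π k)))
      , small (null-eventually 0 λ k _ → trans (cong (_-_ (q * seq π k + r * seq π k)) (*-distribʳ-+ (seq π k) q r)) (+-inverseʳ (q * seq π k + r * seq π k)))

    ≈-trans : ∀ {x y z} → x ≈ y → y ≈ z → x ≈ z
    ≈-trans {x} {y} {z} x≈y y≈z = small (null-≗ (λ k → solve 3 (λ a b c → a :- c := (a :- b) :+ (b :- c)) refl (seq x k) (seq y k) (seq z k))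
      (null-+ (mkNull x≈y) (mkNull y≈z)))

    pair-cong : ∀ {x y x′ y′} → x ≈ x′ × x′ ≈ x → y ≈ y′ × y′ ≈ y → pair x y ≐ pair x′ y′
    pair-cong {x} {y} {x′} {y′} (x≈x′ , x′≈x) (y≈y′ , y′≈y) =
        (λ { {z} (inj₁ z≈x) → inj₁ (≈-trans {z} {x} {x′} z≈x x≈x′) ; {z} (inj₂ z≈y) → inj₂ (≈-trans {z} {y} {y′} z≈y y≈y′) })
      , (λ { {z} (inj₁ z≈x) → inj₁ (≈-trans {z} {x′} {x} z≈x x′≈x) ; {z} (inj₂ z≈y) → inj₂ (≈-trans {z} {y′} {y} z≈y y′≈y) })

    -- The index is j = n/3 = 2m, of angle 2π/3. Since 3 does not divide `c`, multiplying by `c`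
    -- gives 2π/3 or -2π/3 up to full turns.
    type2-exists : ∀ m → h ≡ m ℕ.* 3 → (∃ λ q → c ≡ q ℕ.* 3 ℕ.+ 1) ⊎ (∃ λ q → c ≡ q ℕ.* 3 ℕ.+ 2) → ∃ λ j → Type2 n π c j
    type2-exists m h≡3m c-mod-3 = j , type2 c-mod-3
      where
      n≡6m : n ≡ m ℕ.* 3 ℕ.+ m ℕ.* 3
      n≡6m = trans n≡h+h (cong₂ ℕ._+_ h≡3m h≡3m)
      2m<n : m ℕ.* 2 ℕ.< n
      2m<n = ℕ.≤-<-trans (subst (m ℕ.* 2 ℕ.≤_) (sym h≡3m) (ℕ.*-monoʳ-≤ m (ℕ.s≤s (ℕ.s≤s ℕ.z≤n)))) h<n
      j : Fin n
      j = fromℕ< 2m<n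
      j≡2m : toℕ j ≡ m ℕ.* 2
      j≡2m = Fin.toℕ-fromℕ< 2m<n
      even : sgn (toℕ j) ≡ 1ℚ
      even = trans (cong sgn j≡2m) (sgn-even m)
      /n≡ : ∀ a b → a ℕ.* 3 ≡ b ℕ.* (m ℕ.* 3 ℕ.+ m ℕ.* 3) → + a / n ≡ + b / 3
      /n≡ a b eq = /-cross (+ a) (+ b) n 3 (trans (sym (ℤ.pos-* a 3)) (trans (cong +_ (trans eq (cong (b ℕ.*_) (sym n≡6m)))) (ℤ.pos-* b n)))
      angle≡ : ∀ s → angle j s ≡ + (2 ℕ.* s) / 3
      angle≡ s = /n≡ (2 ℕ.* s ℕ.* toℕ j) (2 ℕ.* s) (trans (cong (λ x → 2 ℕ.* s ℕ.* x ℕ.* 3) j≡2m) (identity s m))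
        where
        identity : ∀ s m → 2 ℕ.* s ℕ.* (m ℕ.* 2) ℕ.* 3 ≡ 2 ℕ.* s ℕ.* (m ℕ.* 3 ℕ.+ m ℕ.* 3)
        identity = ℕ-Solver.solve-∀
      p≡ : + (2 ℕ.* toℕ j) / n ≡ + 2 / 3
      p≡ = trans (cong (λ x → + (x ℕ.* toℕ j) / n) (ℕ.*-identityʳ 2)) (angle≡ 1)
      q≡ : + (2 ℕ.* toℕ j ℕ.* c) / n ≡ angle j c
      q≡ = cong (λ x → + x / n) (identity (toℕ j) c)
        where
        identity : ∀ j c → 2 ℕ.* j ℕ.* c ≡ 2 ℕ.* c ℕ.* j
        identity = ℕ-Solver.solve-∀
      fromℕ≡ : ∀ k → fromℕ (k ℕ.* 2) ≡ (+ 2 ℤ.* + k) / 1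
      fromℕ≡ k = cong (_/ 1) (trans (cong +_ (ℕ.*-comm k 2)) (ℤ.pos-* 2 k))
      build : ∀ s k →
        ((s ℤ.◃ 2) / 3 ≡ + 2 / 3 × angle j c ≡ + 2 / 3 + fromℕ (k ℕ.* 2)) ⊎
        ((s ℤ.◃ 2) / 3 ≡ - (+ 2 / 3) × angle j c ≡ - (+ 2 / 3) + fromℕ (k ℕ.* 2)) → Type2 n π c j
      build s k eq =
          𝓙-criterion j (real-type2 (halfTurns π isPi) (angle j 1) (angle j c) (toℕ j) k (angle≡ 1) ([ inj₁ ∘ proj₂ , inj₂ ∘ proj₂ ]′ eq) even)
        , divides m j≡2m
        , + 0 , + k , Sign.+ , s
        , pair-cong {(+ (2 ℕ.* toℕ j) / n) · π} {(+ (2 ℕ.* toℕ j ℕ.* c) / n) · π} {±2π/3+2kπ n π Sign.+ (+ 0)} {±2π/3+2kπ n π s (+ k)}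
            (multiple-≈ {+ (2 ℕ.* toℕ j) / n} {+ 2 / 3} {0ℚ} (trans p≡ (sym (+-identityʳ (+ 2 / 3)))))
            (multiple-≈ {+ (2 ℕ.* toℕ j ℕ.* c) / n} {(s ℤ.◃ 2) / 3} {(+ 2 ℤ.* + k) / 1} (trans q≡ ([ rewrite-angle , rewrite-angle ]′ eq)))
        where
        rewrite-angle : ∀ {t} → ((s ℤ.◃ 2) / 3 ≡ t × angle j c ≡ t + fromℕ (k ℕ.* 2)) → angle j c ≡ (s ℤ.◃ 2) / 3 + (+ 2 ℤ.* + k) / 1
        rewrite-angle (t≡ , a≡) = trans a≡ (cong₂ _+_ (sym t≡) (fromℕ≡ k))
      type2 : (∃ λ q → c ≡ q ℕ.* 3 ℕ.+ 1) ⊎ (∃ λ q → c ≡ q ℕ.* 3 ℕ.+ 2) → Type2 n π c j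
      type2 (inj₁ (q , c≡)) = build Sign.+ q (inj₁ (refl , trans (angle≡ c) (/-shift 3 (2 ℕ.* c) 2 (q ℕ.* 2) (trans (cong (2 ℕ.*_) c≡) (identity q)))))
        where
        identity : ∀ q → 2 ℕ.* (q ℕ.* 3 ℕ.+ 1) ≡ 2 ℕ.+ q ℕ.* 2 ℕ.* 3
        identity = ℕ-Solver.solve-∀
      -- Here 2c/3 = 2q + 4/3 = -2/3 + 2 (q + 1), whence the sign and the successor.
      type2 (inj₂ (q , c≡)) = build Sign.- (suc q)
        (inj₂ (refl , trans (angle≡ c) (/-reflect 3 (2 ℕ.* c) 2 (suc q ℕ.* 2) (trans (cong (λ x → 2 ℕ.* x ℕ.+ 2) c≡) (identity q)))))
        where
        identity : ∀ q → 2 ℕ.* (q ℕ.* 3 ℕ.+ 2) ℕ.+ 2 ≡ suc q ℕ.* 2 ℕ.* 3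
        identity = ℕ-Solver.solve-∀

    -- With c + 1 = u d and h = w d for odd u and w, the index j = w satisfies j (c + 1) = u h. So
    -- the angles of 1 and `c` add up to the odd multiple uπ, and their cosines cancel.
    type3⁺-exists : ∀ d k l → suc c ≡ suc (k ℕ.* 2) ℕ.* d → h ≡ suc (l ℕ.* 2) ℕ.* d → ∃ λ j → Type3⁺ n π c j
    type3⁺-exists d k l c+1≡ud h≡wd = j
      , 𝓙-criterion j (real-type3 (halfTurns π isPi) (angle j 1) (angle j c) (toℕ j) k reflected (trans (cong sgn j≡w) (sgn-odd l)))
      , (λ { (divides q eq) → odd q (trans (sym j≡w) eq) })
      , + k , /-cross (+ toℕ j) (+ n ℤ.* (+ 2 ℤ.* + k ℤ.+ + 1)) 1 (2 ℕ.* suc c) position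
      where
      u w : ℕ
      u = suc (k ℕ.* 2)
      w = suc (l ℕ.* 2)
      d≢0 : d ≢ 0
      d≢0 refl = ℕ.1+n≢0 (trans c+1≡ud (ℕ.*-zeroʳ u))
      w<n : w ℕ.< n
      w<n = ℕ.≤-<-trans (subst (w ℕ.≤_) (sym h≡wd) (ℕ.m≤m*n w d {{ℕ.≢-nonZero d≢0}})) h<n
      j : Fin n
      j = fromℕ< w<n
      j≡w : toℕ j ≡ w
      j≡w = Fin.toℕ-fromℕ< w<n
      odd : ∀ q → w ≢ q ℕ.* 2
      odd q eq = ℕ.even≢odd q l (trans (ℕ.*-comm 2 q) (trans (sym eq) (cong suc (ℕ.*-comm l 2))))
      n≡ : n ≡ w ℕ.* d ℕ.+ w ℕ.* d
      n≡ = trans n≡h+h (cong₂ ℕ._+_ h≡wd h≡wd)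
      reflected : angle j c ≡ - angle j 1 + fromℕ u
      reflected = /-reflect n (2 ℕ.* c ℕ.* toℕ j) (2 ℕ.* 1 ℕ.* toℕ j) u (begin
        2 ℕ.* c ℕ.* toℕ j ℕ.+ 2 ℕ.* 1 ℕ.* toℕ j ≡⟨ identity₁ c (toℕ j) ⟩
        2 ℕ.* suc c ℕ.* toℕ j                   ≡⟨ cong₂ (λ x y → 2 ℕ.* x ℕ.* y) c+1≡ud j≡w ⟩
        2 ℕ.* (u ℕ.* d) ℕ.* w                   ≡⟨ identity₂ u d w ⟩
        u ℕ.* (w ℕ.* d ℕ.+ w ℕ.* d)             ≡⟨ cong (u ℕ.*_) n≡ ⟨
        u ℕ.* n                                 ∎)
        where
        open ≡-Reasoning
        identity₁ : ∀ c j → 2 ℕ.* c ℕ.* j ℕ.+ 2 ℕ.* 1 ℕ.* j ≡ 2 ℕ.* suc c ℕ.* j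
        identity₁ = ℕ-Solver.solve-∀
        identity₂ : ∀ u d w → 2 ℕ.* (u ℕ.* d) ℕ.* w ≡ u ℕ.* (w ℕ.* d ℕ.+ w ℕ.* d)
        identity₂ = ℕ-Solver.solve-∀
      position : + toℕ j ℤ.* + (2 ℕ.* suc c) ≡ + n ℤ.* (+ 2 ℤ.* + k ℤ.+ + 1) ℤ.* + 1
      position = begin
        + toℕ j ℤ.* + (2 ℕ.* suc c)
          ≡⟨ ℤ.pos-* (toℕ j) (2 ℕ.* suc c) ⟨
        + (toℕ j ℕ.* (2 ℕ.* suc c))
          ≡⟨ cong +_ (trans (cong₂ (λ x y → x ℕ.* (2 ℕ.* y)) j≡w c+1≡ud) (trans (identity u d w) (cong (ℕ._* u) (sym n≡)))) ⟩
        + (n ℕ.* u)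
          ≡⟨ ℤ.pos-* n u ⟩
        + n ℤ.* + u
          ≡⟨ cong (+ n ℤ.*_) (trans (cong +_ (trans (ℕ.+-comm 1 (k ℕ.* 2)) (cong (ℕ._+ 1) (ℕ.*-comm k 2)))) (cong (ℤ._+ + 1) (ℤ.pos-* 2 k))) ⟩
        + n ℤ.* (+ 2 ℤ.* + k ℤ.+ + 1)
          ≡⟨ ℤ.*-identityʳ _ ⟨
        + n ℤ.* (+ 2 ℤ.* + k ℤ.+ + 1) ℤ.* + 1 ∎
        where
        open ≡-Reasoning
        identity : ∀ u d w → w ℕ.* (2 ℕ.* (u ℕ.* d)) ≡ (w ℕ.* d ℕ.+ w ℕ.* d) ℕ.* u
        identity = ℕ-Solver.solve-∀

-- Divisibility of `c`, `c + 1` and `h` by 2, 3 and 4.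

module Arithmetic where

  open import Data.Nat.Divisibility using (_∣_; divides; ∣⇒≤)
  open import Data.Nat.GCD using (gcd; gcd[m,n]∣m; gcd[m,n]∣n; gcd-greatest)
  open Components
  open Labellings

  parity : ∀ n → (∃ λ m → n ≡ m ℕ.* 2) ⊎ (∃ λ m → n ≡ suc (m ℕ.* 2))
  parity zero    = inj₁ (0 , refl)
  parity (suc n) with parity n
  ... | inj₁ (m , refl) = inj₂ (m , refl)
  ... | inj₂ (m , refl) = inj₁ (suc m , refl)

  mod3 : ∀ n → 3∣ n ⊎ 3∤ n
  mod3 zero    = inj₁ (0 , refl)
  mod3 (suc n) with mod3 n
  ... | inj₁ (q , refl)        = inj₂ (inj₁ (q , ℕ.+-comm 1 (q ℕ.* 3)))
  ... | inj₂ (inj₁ (q , refl)) = inj₂ (inj₂ (q , sym (ℕ.+-suc (q ℕ.* 3) 1)))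
  ... | inj₂ (inj₂ (q , refl)) = inj₁ (suc q , ℕ.+-comm (suc (q ℕ.* 3)) 2)

  -- Of c ≡ 2 modulo 4 the second alternative keeps only that `c` is even; this is what later
  -- clashes with c - 1 being even.
  mod4 : ∀ c h → Not2,0Mod4 c h ⊎ (2 ∣ c × 4 ∣ h)
  mod4 c h with parity c
  ... | inj₂ (m , refl) = inj₁ (c-odd m)
  ... | inj₁ (a , refl) with parity a
  ...   | inj₁ (m , refl) = inj₁ (subst (λ c → Not2,0Mod4 c h) (sym (ℕ.*-assoc m 2 2)) (c≡0 m))
  ...   | inj₂ _ with parity h
  ...     | inj₂ (m , refl) = inj₁ (h-odd m)
  ...     | inj₁ (b , refl) with parity b
  ...       | inj₁ (m , refl) = inj₂ (divides a refl , divides m (ℕ.*-assoc m 2 2))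
  ...       | inj₂ (m , refl) = inj₁ (subst (Not2,0Mod4 (a ℕ.* 2)) (identity m) (h≡2 m))
    where
    identity : ∀ m → m ℕ.* 4 ℕ.+ 2 ≡ suc (m ℕ.* 2) ℕ.* 2
    identity = ℕ-Solver.solve-∀

  -- The first alternative holds exactly when 2 has the same exponent in s and in t.
  parities : ∀ s t .{{_ : ℕ.NonZero s}} →
    (∃ λ d → ∃ λ k → ∃ λ l → s ≡ suc (k ℕ.* 2) ℕ.* d × t ≡ suc (l ℕ.* 2) ℕ.* d) ⊎ (OppositeParity s t ⊎ OppositeParity t s)
  parities s t with gcd[m,n]∣m s t | gcd[m,n]∣n s t
  ... | divides u s≡ud | divides w t≡wd = cases (parity u) (parity w)
    where
    d : ℕ
    d = gcd s t
    commute : u ℕ.* t ≡ w ℕ.* s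
    commute = trans (cong (u ℕ.*_) t≡wd) (trans (identity u w d) (cong (w ℕ.*_) (sym s≡ud)))
      where
      identity : ∀ u w d → u ℕ.* (w ℕ.* d) ≡ w ℕ.* (u ℕ.* d)
      identity = ℕ-Solver.solve-∀
    d≢0 : d ≢ 0
    d≢0 d≡0 = ℕ.≢-nonZero⁻¹ s (trans s≡ud (trans (cong (u ℕ.*_) d≡0) (ℕ.*-zeroʳ u)))
    cases : (∃ λ m → u ≡ m ℕ.* 2) ⊎ (∃ λ m → u ≡ suc (m ℕ.* 2)) → (∃ λ m → w ≡ m ℕ.* 2) ⊎ (∃ λ m → w ≡ suc (m ℕ.* 2)) →
      (∃ λ d → ∃ λ k → ∃ λ l → s ≡ suc (k ℕ.* 2) ℕ.* d × t ≡ suc (l ℕ.* 2) ℕ.* d) ⊎ (OppositeParity s t ⊎ OppositeParity t s)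
    cases (inj₂ (k , u≡)) (inj₂ (l , w≡)) = inj₁ (d , k , l , trans s≡ud (cong (ℕ._* d) u≡) , trans t≡wd (cong (ℕ._* d) w≡))
    cases (inj₁ (m , u≡)) (inj₂ (l , w≡)) = inj₂ (inj₂ (m , l , trans (cong (ℕ._* t) (sym u≡)) (trans commute (cong (ℕ._* s) w≡))))
    cases (inj₂ (k , u≡)) (inj₁ (m , w≡)) = inj₂ (inj₁ (m , k , trans (cong (ℕ._* s) (sym w≡)) (trans (sym commute) (cong (ℕ._* t) u≡))))
    -- If both cofactors were even, 2 d would divide `s` and `t`, hence their gcd `d`.
    cases (inj₁ (k , u≡)) (inj₁ (m , w≡)) = contradiction
      (∣⇒≤ {{ℕ.≢-nonZero d≢0}} (gcd-greatest {s} {t} (divides k (trans s≡ud (trans (cong (ℕ._* d) u≡) (ℕ.*-assoc k 2 d))))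
                                                   (divides m (trans t≡wd (trans (cong (ℕ._* d) w≡) (ℕ.*-assoc m 2 d))))))
      (ℕ.<⇒≱ (ℕ.m<m+n d (subst (0 ℕ.<_) (sym (ℕ.+-identityʳ d)) (ℕ.n≢0⇒n>0 d≢0))))

-- Periods of a closed magic labelling of the Cayley graph.

module MagicLabelling (n : ℕ) .{{_ : ℕ.NonZero n}} (c′ : ℕ) (n≡h+h : n ≡ n ℕ./ 2 ℕ.+ n ℕ./ 2)
  (1<c : 1 ℕ.< suc c′) (c<h : suc c′ ℕ.< n ℕ./ 2) (closed : ClosedDistanceMagic (Cay n (connectionSet n (suc c′)))) where

  open import Data.Integer.Base using (_+_; _*_; _-_; -_; 0ℤ)
  open import Data.Nat.Divisibility using (_∣_; divides; ∣-trans; ∣⇒≤; *-cancelʳ-∣; ∣1⇒≡1; ∣m+n∣m⇒∣n)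
  open PeriodicFunctions
  open Components
  open Labellings
  open Arithmetic
  open Residues n
  open ClosedDistanceMagic closed

  private
    c h : ℕ
    c = suc c′
    h = n ℕ./ 2

  open ConnectionSet c h n≡h+h 1<c c<h

  instance
    h≢0 : ℕ.NonZero h
    h≢0 = ℕ.>-nonZero (ℕ.≤-<-trans ℕ.z≤n c<h)

  f : ℤ → ℤ
  f z = + label (residue n z)

  period-f : Period (h ℕ.+ h) f
  period-f z = cong (λ v → + label v) (residue-cong {b = z} (+ 1) (cong (_+_ z) (trans (cong +_ (sym n≡h+h)) (sym (ℤ.*-identityˡ (+ n))))))

  magic-f : ∀ z → f z + (A 1 f z + (A c f z + f (z + + h))) ≡ + r
  magic-f z = begin
    f z + ((f (z + + 1) + f (z - + 1)) + ((f (z + + c) + f (z - + c)) + f (z + + h)))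
      ≡⟨ identity (f z) (f (z + + 1)) (f (z - + 1)) (f (z + + c)) (f (z - + c)) (f (z + + h)) ⟩
    f z + (f (z + + 1) + (f (z - + 1) + (f (z + + c) + (f (z - + c) + f (z + + h)))))
      ≡⟨ cong (_+_ (f z)) (cong₂ _+_ (at (+ 1)) (cong₂ _+_ (at (- + 1)) (cong₂ _+_ (at (+ c)) (cong₂ _+_ (at (- + c)) (at (+ h)))))) ⟨
    + (label u ℕ.+ (neighbour (+ 1) ℕ.+ (neighbour (- + 1) ℕ.+ (neighbour (+ c) ℕ.+ (neighbour (- + c) ℕ.+ neighbour (+ h))))))
      ≡⟨ cong (λ x → + (label u ℕ.+ x)) (sum-over-connectionSet ℕ.+-0-commutativeMonoid
           (untranslate u) (translate u) (untranslate-translate u) (translate-untranslate u) label) ⟨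
    + (label u ℕ.+ _)
      ≡⟨ cong +_ (magic u) ⟩
    + r ∎
    where
    open ≡-Reasoning
    u : Fin n
    u = residue n z
    neighbour : ℤ → ℕ
    neighbour s = label (translate u (residue n s))
    at : ∀ s → + neighbour s ≡ f (z + s)
    at s = cong (λ v → + label v) (residue-+ s z)
    identity : ∀ x a b p q y → x + ((a + b) + ((p + q) + y)) ≡ x + (a + (b + (p + (q + y))))
    identity = ℤ-Solver.solve-∀

  -- Labels are distinct, so f s = f 0 already forces s ≡ 0 modulo n.
  period⇒∣ : ∀ s → Period s f → n ∣ s
  period⇒∣ s per with residue-injective {+ s} {0ℤ} (Bijection.injective ℓ (Fin.toℕ-injective (ℕ.suc-injective (ℤ.+-injective
                        (trans (cong f (sym (ℤ.+-identityˡ (+ s)))) (per 0ℤ))))))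
  ... | q , eq = divides ℤ.∣ q ∣ (trans (cong ℤ.∣_∣ (trans eq (ℤ.+-identityˡ (q * + n)))) (ℤ.abs-* q (+ n)))

  2c′<n : 2 ℕ.* c′ ℕ.< n
  2c′<n = subst₂ ℕ._<_ (cong (c′ ℕ.+_) (sym (ℕ.+-identityʳ c′))) (sym n≡h+h) (ℕ.+-mono-< (ℕ.<-trans (ℕ.n<1+n c′) c<h) (ℕ.<-trans (ℕ.n<1+n c′) c<h))

  impossible : OppositeParity (suc c) h ⊎ OppositeParity h (suc c) → ¬ (3∣ c ⊎ 3∤ h)
  impossible opposite three with mod4 c h
  -- The period 2 c′ is positive, as 1 < c, and less than `n`.
  ... | inj₁ good = ℕ.<⇒≱ 2c′<n (∣⇒≤ {{ℕ.m*n≢0 2 c′ {{_}} {{ℕ.>-nonZero (ℕ.s<s⁻¹ 1<c)}}}}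
                      (period⇒∣ (2 ℕ.* c′) (period-2c′ h c′ f (+ r) period-f magic-f opposite three good)))
  -- Here 8 divides n = 2h, and n divides 4 c′, so c′ = c - 1 would be even along with `c`.
  ... | inj₂ (2∣c , divides q h≡4q) = contradiction (∣1⇒≡1 (∣m+n∣m⇒∣n (subst (2 ∣_) (ℕ.+-comm 1 c′) 2∣c) 2∣c′)) λ ()
    where
    8∣n : 2 ℕ.* 4 ∣ n
    8∣n = divides q (trans n≡h+h (trans (cong₂ ℕ._+_ h≡4q h≡4q) (identity q)))
      where
      identity : ∀ q → q ℕ.* 4 ℕ.+ q ℕ.* 4 ≡ q ℕ.* (2 ℕ.* 4)
      identity = ℕ-Solver.solve-∀
    2∣c′ : 2 ∣ c′
    2∣c′ = *-cancelʳ-∣ 4 (∣-trans 8∣n (period⇒∣ (c′ ℕ.* 4) (period-4c′ h c′ f (+ r) period-f magic-f opposite three)))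

-- The case distinction on `c` and `h`.

open import Data.Nat.Base using (NonZero; _≤_; _<_; _/_)
open import Data.Nat.Divisibility using (_∣_)

proposition4p3 : (π : ℝ) → IsPi π →
    (n : ℕ) .{{_ : NonZero n}} → 6 ≤ n → 2 ∣ n →
    (c : ℕ) → 1 < c → c < n / 2 →
    ClosedDistanceMagic (Cay n (connectionSet n c)) →
    ∃ λ (j : Fin n) → 𝓙 n π (connectionSet n c) j × (Type2 n π c j ⊎ Type3⁺ n π c j)
proposition4p3 π isPi n _ 2∣n (suc c′) 1<c c<h closed = cases (parities (suc c) h) (mod3 c) (mod3 h)
  where
  open Components using (3∣; 3∤)
  open Labellings using (OppositeParity)
  open Arithmetic
  open CharacterSums using (type2-exists; type3⁺-exists)
  c h : ℕ
  c = suc c′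
  h = n / 2
  n≡h+h : n ≡ h ℕ.+ h
  n≡h+h = trans (sym (m/n*n≡m 2∣n)) (trans (ℕ.*-comm h 2) (cong (h ℕ.+_) (ℕ.+-identityʳ h)))
  Goal : Set
  Goal = ∃ λ (j : Fin n) → 𝓙 n π (connectionSet n c) j × (Type2 n π c j ⊎ Type3⁺ n π c j)
  impossible : OppositeParity (suc c) h ⊎ OppositeParity h (suc c) → ¬ (3∣ c ⊎ 3∤ h)
  impossible = MagicLabelling.impossible n c′ n≡h+h 1<c c<h closed
  cases : (∃ λ d → ∃ λ k → ∃ λ l → suc c ≡ suc (k ℕ.* 2) ℕ.* d × h ≡ suc (l ℕ.* 2) ℕ.* d) ⊎ (OppositeParity (suc c) h ⊎ OppositeParity h (suc c)) →
    3∣ c ⊎ 3∤ c → 3∣ h ⊎ 3∤ h → Goal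
  cases (inj₁ (d , k , l , c+1≡ , h≡)) _ _ =
    let j , type3 = type3⁺-exists n c n≡h+h 1<c c<h π isPi d k l c+1≡ h≡ in j , proj₁ type3 , inj₂ type3
  cases (inj₂ opposite) (inj₂ 3∤c) (inj₁ (m , h≡3m)) =
    let j , type2 = type2-exists n c n≡h+h 1<c c<h π isPi m h≡3m 3∤c in j , proj₁ type2 , inj₁ type2
  -- The pairs left over satisfy the hypotheses under which a labelling would have a forbidden
  -- period.
  cases (inj₂ opposite) (inj₁ 3∣c) _        = contradiction (inj₁ 3∣c) (impossible opposite)
  cases (inj₂ opposite) _ (inj₂ 3∤h)        = contradiction (inj₂ 3∤h) (impossible opposite)
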